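{- Let $\lambda$ be a partition of length at most $n$ and let $\tau\in S_n/\mathrm{Stab}(\lambda)$ (a minimal length coset representative). Then $$\bar\pi_\tau(\mathbf{x}^\lambda)=\sum_{\pi\in\widehat\Pi_\tau(\lambda)}\mathbf{x}^{\pi(1)},$$ that is, the Demazure atom $\bar\pi_\tau(\mathbf{x}^\lambda)$ is the sum of the weights of all Lakshmibai-Seshadri paths of shape $\lambda$ beginning in the direction $\tau(\lambda)$.
   Context: Pad $\lambda$ with zeros to length $n$. $S_n$ acts on $\mathbb{R}^n$ on the left by permuting coordinates, $s_i$ exchanging coordinates $i$ and $i+1$, and on $\mathbb{Z}[x_1,\dots,x_n]$ by permuting variables. $\mathbf{x}^\beta=x_1^{\beta_1}\cdots x_n^{\beta_n}$. Demazure atoms. For $1\le i<n$ define operators on $\mathbb{Z}[x_1,\dots,x_n]$: $\partial_i=\frac{1-s_i}{x_i-x_{i+1}}$, $\pi_i=\partial_ix_i$ (i.e. $\pi_i(f)=\partial_i(x_if)$), $\bar\pi_i=\pi_i-1$. The $\bar\pi_i$ satisfy the braid relations, so $\bar\pi_\tau=\bar\pi_{i_1}\cdots\bar\pi_{i_k}$ is well defined for any reduced word $\tau=s_{i_1}\cdots s_{i_k}$. The Demazure atom is $\bar\pi_\tau(\mathbf{x}^\lambda)$. LS-paths. $\mathrm{Stab}(\lambda)$ is the stabilizer of $\lambda$ in $S_n$; $S_n/\mathrm{Stab}(\lambda)$ is identified with the set of minimal length coset representatives, with length $\ell$ and Bruhat order. Roots are $e_a-e_b$ ($a\neq b$), positive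 if $a<b$; $s_\beta$ is the reflection (transposition) of a root $\beta$, and $\langle\cdot,\cdot\rangle$ is the standard inner product on $\mathbb{R}^n$. A rational path of shape $\lambda$ is a pair $\pi=(\underline\tau;\underline a)$ with $\underline\tau:\tau_1>\cdots>\tau_r$ a strictly decreasing sequence (Bruhat order) in $S_n/\mathrm{Stab}(\lambda)$ and $\underline a:0=a_0<a_1<\cdots<a_r=1$ rational numbers; it is identified with the piecewise linear map $\pi\colon[0,1]\to\mathbb{R}^n$ given by $\pi(t)=\sum_{i=1}^{j-1}(a_i-a_{i-1})\tau_i(\lambda)+(t-a_{j-1})\tau_j(\lambda)$ for $t\in[a_{j-1},a_j]$, $j=1,\dots,r$. Its weight is $\pi(1)$. For $\tau>\sigma$ in $S_n/\mathrm{Stab}(\lambda)$ and rational $0<a<1$, an $a$-chain for $(\tau,\sigma)$ is a sequence $\tau=\kappa_0>\kappa_1>\cdots>\kappa_s=\sigma$ in $S_n/\mathrm{Stab}(\lambda)$ such that $\ell(\kappa_i)=\ell(\kappa_{i-1})-1$ and $a\langle\kappa_i(\lambda),\beta_i\rangle\in\mathbb{Z}$ for each $i=1,\dots,s$, where $\beta_i$ is the positive root with $\kappa_i=s_{\beta_i}\kappa_{i-1}$. A rational path $\pi=(\underline\tau;\underline a)$ of shape $\lambda$ is a Lakshmibai-Seshadri path (LS-path) of shape $\lambda$ if for each $1\le i\le r-1$ there is an $a_i$-chain for $(\tau_i,\tau_{i+1})$. For an LS-path one has $\pi(1)\in\mathbb{Z}^n$. $\widehat\Pi_\tau(\lambda)$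 is the set of LS-paths $\pi=(\underline\omega;\underline a)$ of shape $\lambda$ with first element $\omega_1=\tau$. -}

module Defs where

open import Data.Bool.Base using (true; false; if_then_else_)
open import Data.Fin.Base as Fin using (Fin; zero; suc; inject₁; inject; fromℕ; toℕ)
import Data.Fin.Properties as Fin
open import Data.Fin.Permutation
  using (Permutation′; id; _∘ₚ_; transpose; _⟨$⟩ˡ_)
  renaming (_≈_ to _≈ₚ_)
open import Data.Integer.Base as ℤ using (ℤ; 0ℤ; 1ℤ)
import Data.Integer.Properties as ℤ
import Data.Integer.Tactic.RingSolver as ℤ-Solver
open import Data.List.Base as List
  using (List; []; _∷_; _++_; length; foldr; concatMap; cartesianProductWith)
open import Data.List.Relation.Unary.All using (All)
open import Data.List.Relation.Unary.AllPairs using (AllPairs)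
open import Data.List.Relation.Unary.Any using (Any)
open import Data.Nat.Base as ℕ using (ℕ; zero; suc; pred)
import Data.Nat.Properties as ℕ
open import Data.Product.Base using (∃; ∃₂; _×_; _,_; map₁; map₂)
open import Data.Rational.Base as ℚ using (ℚ; 0ℚ; 1ℚ)
import Data.Rational.Properties as ℚ
open import Data.Sum.Base using (inj₁; inj₂)
open import Data.Vec.Base using (Vec; lookup; tabulate; zipWith)
open import Data.Vec.Functional using (Vector)
open import Data.Vec.Properties
  using (≡-dec; lookup∘tabulate; lookup-zipWith; zipWith-assoc; zipWith-comm)
open import Data.Vec.Relation.Binary.Pointwise.Inductive using (Pointwise)
open import Data.Vec.Relation.Binary.Pointwise.Extensional using (ext; Pointwise-≡⇒≡)
open import Relation.Binary.Construct.Closure.Transitive using (TransClosure)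
open import Relation.Binary.PropositionalEquality
open import Relation.Nullary using (¬_; Dec; does; yes; no; contradiction)

open import Algebra.Properties.CommutativeMonoid.Sum ℚ.+-0-commutativeMonoid
  using (sum)

private
  variable
    n : ℕ

------------------------------------------------------------------------
-- The symmetric group

Perm : ℕ → Set
Perm = Permutation′

-- (τ · σ)(i) = τ(σ(i)); the library's _∘ₚ_ composes diagrammatically.
infixr 7 _·_
_·_ : Perm n → Perm n → Perm n
τ · σ = σ ∘ₚ τ

-- Left action: the entry of v in position i is moved to position σ(i).
infixr 8 _•_
_•_ : ∀ {A : Set} → Perm n → Vec A n → Vec A n
σ • v = tabulate λ j → lookup v (σ ⟨$⟩ˡ j)

-- An index i : Fin (pred n) stands for the pair of adjacent positions
-- lo i and hi i = lo i + 1.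
lo hi : Fin (pred n) → Fin n
lo {suc n} i = inject₁ i
hi {suc n} i = suc i

s : Fin (pred n) → Perm n
s i = transpose (lo i) (hi i)

Word : ℕ → Set
Word n = List (Fin (pred n))

product : Word n → Perm n
product = foldr (λ i σ → s i · σ) id

IsReducedWord : Perm n → Word n → Set
IsReducedWord τ w =
  product w ≈ₚ τ × (∀ v → product v ≈ₚ τ → length w ℕ.≤ length v)

-- ℓ(τ) = k
HasLength : Perm n → ℕ → Set
HasLength τ k = ∃ λ w → IsReducedWord τ w × length w ≡ k

------------------------------------------------------------------------
-- Roots and Bruhat order

-- The positive root e_a − e_b.
record PositiveRoot (n : ℕ) : Set where
  field
    a b : Fin n
    a<b : a Fin.< b

reflection : PositiveRoot n → Perm n
reflection β = transpose a b where open PositiveRoot β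

-- Bruhat order is the transitive closure of  σ < s_β σ  whenever
-- ℓ(σ) < ℓ(s_β σ).
BruhatStep : Perm n → Perm n → Set
BruhatStep σ τ =
  (∃ λ β → τ ≈ₚ reflection β · σ) ×
  (∃₂ λ k m → HasLength σ k × HasLength τ m × k ℕ.< m)

infix 4 _<ᴮ_
_<ᴮ_ : Perm n → Perm n → Set
_<ᴮ_ = TransClosure BruhatStep

Stabilizes : Vec ℕ n → Perm n → Set
Stabilizes lam σ = σ • lam ≡ lam

-- τ has minimal length in the coset τ Stab(lam).
IsMinimalRep : Vec ℕ n → Perm n → Set
IsMinimalRep lam τ = ∀ σ → Stabilizes lam σ →
  ∀ {k m} → HasLength τ k → HasLength (τ · σ) m → k ℕ.≤ m

-- A partition of length at most n, padded with zeros.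
IsPartition : Vec ℕ n → Set
IsPartition lam = ∀ i j → i Fin.≤ j → lookup lam j ℕ.≤ lookup lam i

------------------------------------------------------------------------
-- Rational vectors

fromℕᵛ : Vec ℕ n → Vector ℚ n
fromℕᵛ v i = (ℤ.+ lookup v i) ℚ./ 1

unit : Fin n → Vector ℚ n
unit a i = if does (i Fin.≟ a) then 1ℚ else 0ℚ

root : PositiveRoot n → Vector ℚ n
root β i = unit a i ℚ.- unit b i where open PositiveRoot β

⟨_,_⟩ : Vector ℚ n → Vector ℚ n → ℚ
⟨ u , v ⟩ = sum λ i → u i ℚ.* v i

IsInteger : ℚ → Set
IsInteger q = ∃ λ (z : ℤ) → q ≡ z ℚ./ 1

------------------------------------------------------------------------
-- LS-paths

record ChainStep (lam : Vec ℕ n) (a : ℚ) (κ′ κ : Perm n) : Set where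
  field
    minimal′   : IsMinimalRep lam κ′
    minimal    : IsMinimalRep lam κ
    descends   : κ <ᴮ κ′
    covers     : ∃ λ k → HasLength κ k × HasLength κ′ (suc k)
    β          : PositiveRoot n
    reflects   : κ ≈ₚ reflection β · κ′
    integral   : IsInteger (a ℚ.* ⟨ fromℕᵛ (κ • lam) , root β ⟩)

-- a-chains for (τ , σ). As τ > σ, there is at least one step.
Chain : Vec ℕ n → ℚ → Perm n → Perm n → Set
Chain lam a = TransClosure (ChainStep lam a)

-- Here r = suc m. The breakpoints a₀,…,a_r are indexed as usual, whereas
-- lookup τ i is τ_{i+1}.
record RationalPath (lam : Vec ℕ n) : Set where
  field
    m          : ℕ
    τ          : Vec (Perm n) (suc m)
    a          : Vec ℚ (suc (suc m))
    minimal    : ∀ i → IsMinimalRep lam (lookup τ i)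
    decreasing : ∀ i → lookup τ (suc i) <ᴮ lookup τ (inject₁ i)
    a-first    : lookup a zero ≡ 0ℚ
    a-last     : lookup a (fromℕ (suc m)) ≡ 1ℚ
    increasing : ∀ i → lookup a (inject₁ i) ℚ.< lookup a (suc i)

  direction : Fin (suc m) → Vector ℚ n
  direction i = fromℕᵛ (lookup τ i • lam)

  -- The value π(t) for t in the interval [ a_j , a_{j+1} ].
  position : Fin (suc m) → ℚ → Vector ℚ n
  position j t c =
    sum (λ (i : Fin (toℕ j)) →
      let i′ = inject {i = j} i in
      (lookup a (suc i′) ℚ.- lookup a (inject₁ i′)) ℚ.* direction i′ c)
    ℚ.+ (t ℚ.- lookup a (inject₁ j)) ℚ.* direction j c

  -- π(1)
  weight : Vector ℚ n
  weight = position (fromℕ m) 1ℚ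

-- The proof components of a path are disregarded.
record _≈π_ {lam : Vec ℕ n} (π ρ : RationalPath lam) : Set where
  private
    module π = RationalPath π
    module ρ = RationalPath ρ
  field
    τ≈ : Pointwise _≈ₚ_ π.τ ρ.τ
    a≈ : Pointwise _≡_ π.a ρ.a

IsLSPath : {lam : Vec ℕ n} → RationalPath lam → Set
IsLSPath {lam = lam} π = ∀ (i : Fin m) →
  Chain lam (lookup a (suc (inject₁ i))) (lookup τ (inject₁ i)) (lookup τ (suc i))
  where open RationalPath π

-- The set of LS-paths with first direction τ.
Π̂ : (lam : Vec ℕ n) → Perm n → RationalPath lam → Set
Π̂ lam τ π = IsLSPath π × lookup (RationalPath.τ π) zero ≈ₚ τ

-- The list πs contains each element of P exactly once, up to _≈π_, and
-- nothing else.
record Enumerates {lam : Vec ℕ n} (P : RationalPath lam → Set)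
                  (πs : List (RationalPath lam)) : Set where
  field
    sound    : All P πs
    distinct : AllPairs (λ π ρ → ¬ (π ≈π ρ)) πs
    complete : ∀ π → P π → Any (π ≈π_) πs

------------------------------------------------------------------------
-- The ring ℤ[x₁,…,xₙ]

Exponent : ℕ → Set
Exponent = Vec ℕ

Term : ℕ → Set
Term n = ℤ × Exponent n

-- A finite sum of terms c x^α. Exponents may repeat and coefficients may
-- vanish, so equality of polynomials is _≈_ below.
Poly : ℕ → Set
Poly n = List (Term n)

_≟ᵉ_ : (α β : Exponent n) → Dec (α ≡ β)
_≟ᵉ_ = ≡-dec ℕ._≟_

coeffTerm : ℤ → Exponent n → Exponent n → ℤ
coeffTerm c α γ = if does (α ≟ᵉ γ) then c else 0ℤ

coeff : Poly n → Exponent n → ℤ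
coeff []            γ = 0ℤ
coeff ((c , α) ∷ f) γ = coeffTerm c α γ ℤ.+ coeff f γ

infix 4 _≈_
_≈_ : Poly n → Poly n → Set
f ≈ g = ∀ γ → coeff f γ ≡ coeff g γ

x^_ : Exponent n → Poly n
x^ α = (1ℤ , α) ∷ []

infixl 6 _+_ _-_
infixl 7 _*_

_+_ : Poly n → Poly n → Poly n
_+_ = _++_

neg : Poly n → Poly n
neg = List.map (map₁ λ c → ℤ.- c)

_-_ : Poly n → Poly n → Poly n
f - g = f + neg g

_⊕_ : Exponent n → Exponent n → Exponent n
_⊕_ = zipWith ℕ._+_

mulTerm : Term n → Term n → Term n
mulTerm (c , α) (d , β) = c ℤ.* d , α ⊕ β

_*_ : Poly n → Poly n → Poly n
_*_ = cartesianProductWith mulTerm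

spike : Fin n → ℕ → Exponent n
spike i k = tabulate λ j → if does (j Fin.≟ i) then k else 0

x : Fin n → Poly n
x i = x^ spike i 1

-- x_j ↦ x_{σ(j)}, which sends x^α to x^{σ • α}.
permute : Perm n → Poly n → Poly n
permute σ = List.map (map₂ (σ •_))

sumPoly : List (Poly n) → Poly n
sumPoly = foldr _+_ []

------------------------------------------------------------------------
-- Demazure operators

-- c x^γ (x_i^d − x_j^d) / (x_i − x_j)
--   = c x^γ (x_i^{d−1} + x_i^{d−2} x_j + ⋯ + x_j^{d−1})
ladder : Fin n → Fin n → ℤ → ℕ → Exponent n → Poly n
ladder i j c zero    γ = []
ladder i j c (suc d) γ = (c , γ ⊕ spike i d) ∷ ladder i j c d (γ ⊕ spike j 1)

-- With γ the entrywise minimum of α and s_i • α, and d the absolute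
-- difference of α_i and α_{i+1}, the polynomial x^α − x^{s_i • α} is
-- ± x^γ (x_i^d − x_{i+1}^d). At least one of the two ladders is empty.
∂Term : Fin (pred n) → Term n → Poly n
∂Term i (c , α) =
  ladder (lo i) (hi i) c       (p ℕ.∸ q) γ +
  ladder (lo i) (hi i) (ℤ.- c) (q ℕ.∸ p) γ
  where
  p = lookup α (lo i)
  q = lookup α (hi i)
  γ = zipWith ℕ._⊓_ α (s i • α)

-- (f − s_i f) / (x_i − x_{i+1}); that this is the quotient is ∂-quotient.
∂ : Fin (pred n) → Poly n → Poly n
∂ i = concatMap (∂Term i)

demazure : Fin (pred n) → Poly n → Poly n
demazure i f = ∂ i (x (lo i) * f)

demazureAtomOp : Fin (pred n) → Poly n → Poly n
demazureAtomOp i f = demazure i f - f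

demazureAtomOpWord : Word n → Poly n → Poly n
demazureAtomOpWord w f = foldr demazureAtomOp f w

------------------------------------------------------------------------
-- ∂ i f is the quotient of f − s_i f by x_i − x_{i+1}

module Quotient where

  vec-ext : {u v : Exponent n} → (∀ k → lookup u k ≡ lookup v k) → u ≡ v
  vec-ext h = Pointwise-≡⇒≡ (ext h)

  lookup-spike-same : (i : Fin n) (d : ℕ) → lookup (spike i d) i ≡ d
  lookup-spike-same i d rewrite lookup∘tabulate (λ j → if does (j Fin.≟ i) then d else 0) i
    with i Fin.≟ i
  ... | yes _  = refl
  ... | no i≢i = contradiction refl i≢i

  lookup-spike-other : (i k : Fin n) (d : ℕ) → k ≢ i → lookup (spike i d) k ≡ 0
  lookup-spike-other i k d k≢i rewrite lookup∘tabulate (λ j → if does (j Fin.≟ i) then d else 0) k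
    with k Fin.≟ i
  ... | yes k≡i = contradiction k≡i k≢i
  ... | no _    = refl

  lookup-⊕ : (u v : Exponent n) (k : Fin n) →
             lookup (u ⊕ v) k ≡ lookup u k ℕ.+ lookup v k
  lookup-⊕ u v k = lookup-zipWith ℕ._+_ k u v

  spike-+ : (i : Fin n) (d e : ℕ) → spike i d ⊕ spike i e ≡ spike i (d ℕ.+ e)
  spike-+ i d e = vec-ext λ k → trans (lookup-⊕ (spike i d) (spike i e) k) (go k)
    where
    go : ∀ k → lookup (spike i d) k ℕ.+ lookup (spike i e) k ≡ lookup (spike i (d ℕ.+ e)) k
    go k with k Fin.≟ i
    ... | yes refl = trans
      (cong₂ ℕ._+_ (lookup-spike-same i d) (lookup-spike-same i e))
      (sym (lookup-spike-same i (d ℕ.+ e)))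
    ... | no k≢i   = trans
      (cong₂ ℕ._+_ (lookup-spike-other i k d k≢i) (lookup-spike-other i k e k≢i))
      (sym (lookup-spike-other i k (d ℕ.+ e) k≢i))

  spike-0 : (i k : Fin n) → lookup (spike i 0) k ≡ 0
  spike-0 i k with k Fin.≟ i
  ... | yes refl = lookup-spike-same i 0
  ... | no k≢i   = lookup-spike-other i k 0 k≢i

  ⊕-spike-0 : (γ : Exponent n) (i : Fin n) → γ ⊕ spike i 0 ≡ γ
  ⊕-spike-0 γ i = vec-ext λ k → trans (lookup-⊕ γ (spike i 0) k)
    (trans (cong (lookup γ k ℕ.+_) (spike-0 i k)) (ℕ.+-identityʳ _))

  ⊕-assoc : (u v w : Exponent n) → (u ⊕ v) ⊕ w ≡ u ⊕ (v ⊕ w)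
  ⊕-assoc = zipWith-assoc ℕ.+-assoc

  ⊕-comm : (u v : Exponent n) → u ⊕ v ≡ v ⊕ u
  ⊕-comm = zipWith-comm ℕ.+-comm

  raise : (γ : Exponent n) (d : ℕ) (k : Fin n) →
          spike k 1 ⊕ (γ ⊕ spike k d) ≡ γ ⊕ spike k (suc d)
  raise γ d k = trans (⊕-comm (spike k 1) _) (trans (⊕-assoc γ _ _)
    (cong (γ ⊕_) (trans (spike-+ k d 1) (cong (spike k) (ℕ.+-comm d 1)))))

  shift : (γ : Exponent n) (d : ℕ) (i j : Fin n) →
          spike j 1 ⊕ (γ ⊕ spike i d) ≡ (γ ⊕ spike j 1) ⊕ spike i d
  shift γ d i j = trans (sym (⊕-assoc (spike j 1) γ _)) (cong (_⊕ spike i d) (⊕-comm _ γ))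

  coeff-+ : (f g : Poly n) (δ : Exponent n) →
            coeff (f + g) δ ≡ coeff f δ ℤ.+ coeff g δ
  coeff-+ []            g δ = sym (ℤ.+-identityˡ _)
  coeff-+ ((c , α) ∷ f) g δ = trans
    (cong (λ z → coeffTerm c α δ ℤ.+ z) (coeff-+ f g δ))
    (sym (ℤ.+-assoc (coeffTerm c α δ) (coeff f δ) (coeff g δ)))

  coeffTerm-neg : (c : ℤ) (α δ : Exponent n) →
                  coeffTerm (ℤ.- c) α δ ≡ ℤ.- coeffTerm c α δ
  coeffTerm-neg c α δ with does (α ≟ᵉ δ)
  ... | true  = refl
  ... | false = refl

  module _ (i j : Fin n) where

    D : Poly n → Exponent n → ℤ
    D g = coeff ((x i - x j) * g)

    D-unfold : ∀ g δ → D g δ ≡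
      coeff (List.map (mulTerm (1ℤ , spike i 1)) g) δ ℤ.+
      coeff (List.map (mulTerm (ℤ.- 1ℤ , spike j 1)) g) δ
    D-unfold g δ = trans
      (coeff-+ (List.map (mulTerm (1ℤ , spike i 1)) g) _ δ)
      (cong (λ z → coeff (List.map (mulTerm (1ℤ , spike i 1)) g) δ ℤ.+ z)
        (trans (coeff-+ (List.map (mulTerm (ℤ.- 1ℤ , spike j 1)) g) [] δ)
               (ℤ.+-identityʳ _)))

    D-∷ : ∀ c α g δ → D ((c , α) ∷ g) δ ≡
      (coeffTerm c (spike i 1 ⊕ α) δ ℤ.- coeffTerm c (spike j 1 ⊕ α) δ) ℤ.+ D g δ
    D-∷ c α g δ
      rewrite D-unfold ((c , α) ∷ g) δ
            | D-unfold g δ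
            | ℤ.*-identityˡ c
            | ℤ.-1*i≡-i c
            | coeffTerm-neg c (spike j 1 ⊕ α) δ
            = rearrange (coeffTerm c (spike i 1 ⊕ α) δ) (coeffTerm c (spike j 1 ⊕ α) δ)
                  (coeff (List.map (mulTerm (1ℤ , spike i 1)) g) δ)
                  (coeff (List.map (mulTerm (ℤ.- 1ℤ , spike j 1)) g) δ)
      where
      rearrange : ∀ a b u v → (a ℤ.+ u) ℤ.+ (ℤ.- b ℤ.+ v) ≡ (a ℤ.- b) ℤ.+ (u ℤ.+ v)
      rearrange = ℤ-Solver.solve-∀

    D-+ : ∀ f g δ → D (f + g) δ ≡ D f δ ℤ.+ D g δ
    D-+ [] g δ = sym (trans (cong (λ z → z ℤ.+ D g δ) (D-unfold [] δ)) (ℤ.+-identityˡ (D g δ)))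
    D-+ ((c , α) ∷ f) g δ
      rewrite D-∷ c α (f + g) δ | D-∷ c α f δ | D-+ f g δ
      = sym (ℤ.+-assoc (coeffTerm c (spike i 1 ⊕ α) δ ℤ.- coeffTerm c (spike j 1 ⊕ α) δ) _ _)

    D-ladder : ∀ c d γ δ → D (ladder i j c d γ) δ ≡
      coeffTerm c (γ ⊕ spike i d) δ ℤ.- coeffTerm c (γ ⊕ spike j d) δ
    D-ladder c zero γ δ
      rewrite ⊕-spike-0 γ i | ⊕-spike-0 γ j | D-unfold [] δ
      = sym (ℤ.+-inverseʳ (coeffTerm c γ δ))
    D-ladder c (suc d) γ δ
      rewrite D-∷ c (γ ⊕ spike i d) (ladder i j c d (γ ⊕ spike j 1)) δ
            | D-ladder c d (γ ⊕ spike j 1) δ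
            | raise γ d i | shift γ d i j | ⊕-assoc γ (spike j 1) (spike j d) | spike-+ j 1 d
      = telescope (coeffTerm c (γ ⊕ spike i (suc d)) δ)
                  (coeffTerm c ((γ ⊕ spike j 1) ⊕ spike i d) δ)
                  (coeffTerm c (γ ⊕ spike j (suc d)) δ)
      where
      telescope : ∀ a b e → (a ℤ.- b) ℤ.+ (b ℤ.- e) ≡ a ℤ.- e
      telescope = ℤ-Solver.solve-∀

  module _ (i j : Fin n) (i≢j : i ≢ j) (α : Exponent n) where

    private
      σα = transpose i j • α
      γ  = zipWith ℕ._⊓_ α σα
      p  = lookup α i
      q  = lookup α j

    swapped-i : lookup σα i ≡ q
    swapped-i rewrite lookup∘tabulate (λ k → lookup α (transpose i j ⟨$⟩ˡ k)) i
      with i Fin.≟ j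
    ... | yes i≡j = contradiction i≡j i≢j
    ... | no _ with i Fin.≟ i
    ...   | yes _  = refl
    ...   | no i≢i = contradiction refl i≢i

    swapped-j : lookup σα j ≡ p
    swapped-j rewrite lookup∘tabulate (λ k → lookup α (transpose i j ⟨$⟩ˡ k)) j
      with j Fin.≟ j
    ... | yes _  = refl
    ... | no j≢j = contradiction refl j≢j

    swapped-other : ∀ k → k ≢ i → k ≢ j → lookup σα k ≡ lookup α k
    swapped-other k k≢i k≢j
      rewrite lookup∘tabulate (λ k → lookup α (transpose i j ⟨$⟩ˡ k)) k
      with k Fin.≟ j
    ... | yes k≡j = contradiction k≡j k≢j
    ... | no _ with k Fin.≟ i
    ...   | yes k≡i = contradiction k≡i k≢i
    ...   | no _    = refl

    entrywise : {u : Exponent n} (l : Fin n) (d : ℕ) →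
      (∀ k → lookup u k ≡ (lookup α k ℕ.⊓ lookup σα k) ℕ.+ lookup (spike l d) k) →
      u ≡ γ ⊕ spike l d
    entrywise l d h = vec-ext λ k → trans (h k) (sym (trans (lookup-⊕ γ (spike l d) k)
      (cong (ℕ._+ lookup (spike l d) k) (lookup-zipWith ℕ._⊓_ k α σα))))

    min-at-i : lookup α i ℕ.⊓ lookup σα i ≡ p ℕ.⊓ q
    min-at-i = cong (p ℕ.⊓_) swapped-i

    min-at-j : lookup α j ℕ.⊓ lookup σα j ≡ p ℕ.⊓ q
    min-at-j = trans (cong (q ℕ.⊓_) swapped-j) (ℕ.⊓-comm q p)

    min-at-other : ∀ k → k ≢ i → k ≢ j → lookup α k ℕ.⊓ lookup σα k ≡ lookup α k
    min-at-other k k≢i k≢j =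
      trans (cong (lookup α k ℕ.⊓_) (swapped-other k k≢i k≢j)) (ℕ.⊓-idem _)

    decompose : (u : Exponent n) (l l′ : Fin n) (d : ℕ) → l ≢ l′ →
      lookup u l ≡ (p ℕ.⊓ q) ℕ.+ d →
      lookup u l′ ≡ p ℕ.⊓ q →
      lookup α l ℕ.⊓ lookup σα l ≡ p ℕ.⊓ q →
      lookup α l′ ℕ.⊓ lookup σα l′ ≡ p ℕ.⊓ q →
      (∀ k → k ≢ l → k ≢ l′ → lookup u k ≡ lookup α k ℕ.⊓ lookup σα k) →
      u ≡ γ ⊕ spike l d
    decompose u l l′ d l≢l′ ul ul′ ml ml′ other = entrywise l d go
      where
      go : ∀ k → lookup u k ≡ (lookup α k ℕ.⊓ lookup σα k) ℕ.+ lookup (spike l d) k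
      go k with k Fin.≟ l | k Fin.≟ l′
      ... | yes refl | _ = trans ul (sym (cong₂ ℕ._+_ ml (lookup-spike-same l d)))
      ... | no k≢l | yes refl = trans ul′ (sym (trans
        (cong₂ ℕ._+_ ml′ (lookup-spike-other l k d k≢l)) (ℕ.+-identityʳ _)))
      ... | no k≢l | no k≢l′ = trans (other k k≢l k≢l′) (sym (trans
        (cong (_ ℕ.+_) (lookup-spike-other l k d k≢l)) (ℕ.+-identityʳ _)))

    α-other : ∀ k → k ≢ i → k ≢ j → lookup α k ≡ lookup α k ℕ.⊓ lookup σα k
    α-other k k≢i k≢j = sym (min-at-other k k≢i k≢j)

    σα-other : ∀ k → k ≢ i → k ≢ j → lookup σα k ≡ lookup α k ℕ.⊓ lookup σα k
    σα-other k k≢i k≢j = trans (swapped-other k k≢i k≢j) (α-other k k≢i k≢j)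

    module _ (q≤p : q ℕ.≤ p) where
      private
        min≡q : p ℕ.⊓ q ≡ q
        min≡q = ℕ.m≥n⇒m⊓n≡n q≤p
        p≡ : p ≡ (p ℕ.⊓ q) ℕ.+ (p ℕ.∸ q)
        p≡ = sym (trans (cong (ℕ._+ (p ℕ.∸ q)) min≡q) (ℕ.m+[n∸m]≡n q≤p))

      α≡₁ : α ≡ γ ⊕ spike i (p ℕ.∸ q)
      α≡₁ = decompose α i j _ i≢j p≡ (sym min≡q) min-at-i min-at-j α-other

      σα≡₁ : σα ≡ γ ⊕ spike j (p ℕ.∸ q)
      σα≡₁ = decompose σα j i _ (≢-sym i≢j) (trans swapped-j p≡)
        (trans swapped-i (sym min≡q)) min-at-j min-at-i (λ k a b → σα-other k b a)

    module _ (p≤q : p ℕ.≤ q) where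
      private
        min≡p : p ℕ.⊓ q ≡ p
        min≡p = ℕ.m≤n⇒m⊓n≡m p≤q
        q≡ : q ≡ (p ℕ.⊓ q) ℕ.+ (q ℕ.∸ p)
        q≡ = sym (trans (cong (ℕ._+ (q ℕ.∸ p)) min≡p) (ℕ.m+[n∸m]≡n p≤q))

      α≡₂ : α ≡ γ ⊕ spike j (q ℕ.∸ p)
      α≡₂ = decompose α j i _ (≢-sym i≢j) q≡ (sym min≡p) min-at-j min-at-i
        (λ k a b → α-other k b a)

      σα≡₂ : σα ≡ γ ⊕ spike i (q ℕ.∸ p)
      σα≡₂ = decompose σα i j _ i≢j (trans swapped-i q≡)
        (trans swapped-j (sym min≡p)) min-at-i min-at-j σα-other

    D-monomial : ∀ c δ →
      D i j (ladder i j c (p ℕ.∸ q) γ + ladder i j (ℤ.- c) (q ℕ.∸ p) γ) δ ≡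
      coeffTerm c α δ ℤ.- coeffTerm c σα δ
    D-monomial c δ with ℕ.≤-total q p
    ... | inj₁ q≤p
      rewrite D-+ i j (ladder i j c (p ℕ.∸ q) γ) (ladder i j (ℤ.- c) (q ℕ.∸ p) γ) δ
            | D-ladder i j c (p ℕ.∸ q) γ δ
            | sym (α≡₁ q≤p) | sym (σα≡₁ q≤p)
            | ℕ.m≤n⇒m∸n≡0 q≤p | D-unfold i j [] δ
      = ℤ.+-identityʳ (coeffTerm c α δ ℤ.- coeffTerm c σα δ)
    ... | inj₂ p≤q
      rewrite D-+ i j (ladder i j c (p ℕ.∸ q) γ) (ladder i j (ℤ.- c) (q ℕ.∸ p) γ) δ
            | D-ladder i j (ℤ.- c) (q ℕ.∸ p) γ δ
            | sym (α≡₂ p≤q) | sym (σα≡₂ p≤q)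
            | ℕ.m≤n⇒m∸n≡0 p≤q | D-unfold i j [] δ
            | coeffTerm-neg c α δ | coeffTerm-neg c σα δ
      = flip (coeffTerm c α δ) (coeffTerm c σα δ)
      where
      flip : ∀ a b → 0ℤ ℤ.+ (ℤ.- b ℤ.- (ℤ.- a)) ≡ a ℤ.- b
      flip = ℤ-Solver.solve-∀

  lo≢hi : (i : Fin (pred n)) → lo {n} i ≢ hi {n} i
  lo≢hi {suc n} i eq = ℕ.1+n≢n (sym (trans (sym (Fin.toℕ-inject₁ i)) (cong toℕ eq)))

open Quotient

∂-quotient : (i : Fin (pred n)) (f : Poly n) →
             (x (lo i) - x (hi i)) * ∂ i f ≈ f - permute (s i) f
∂-quotient {n} i []            δ = D-unfold {n} (lo i) (hi i) [] δ
∂-quotient {n} i ((c , α) ∷ f) δ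
  rewrite D-+ (lo i) (hi i) (∂Term i (c , α)) (∂ i f) δ
        | D-monomial (lo i) (hi i) (lo≢hi {n} i) α c δ
        | ∂-quotient i f δ
        | coeff-+ f (neg (permute (s i) f)) δ
        | coeff-+ f ((ℤ.- c , s i • α) ∷ neg (permute (s i) f)) δ
        | coeffTerm-neg c (s i • α) δ
  = rearrange (coeffTerm c α δ) (coeffTerm c (s i • α) δ)
              (coeff f δ) (coeff (neg (permute (s i) f)) δ)
  where
  rearrange : ∀ a b u v → (a ℤ.- b) ℤ.+ (u ℤ.+ v) ≡ a ℤ.+ (u ℤ.+ (ℤ.- b ℤ.+ v))
  rearrange = ℤ-Solver.solve-∀

{-# OPTIONS --safe #-}

-- Fix N such that all breakpoints of LS-paths of shape lam lie in (1/N) ℤ, and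
-- compute their generating function by a recursion running backwards through
-- the times j / N. Let κ be a vector in the orbit of lam, d = κ_i − κ_{i+1} > 0,
-- and let f and g count the ways to continue after time j / N a path arriving
-- with direction κ and s_i κ, respectively. Then g is obtained from f by a
-- Demazure operator twisted by a residue e ≡ − j d modulo N. Running straight
-- for one unit of time changes the twist by d. At a possible turn the relation
-- persists: a cover that turns ν_i < ν_{i+1} into ν_i ≥ ν_{i+1} is the swap of
-- these two entries, so the vectors below s_i κ are those below κ with each pair
-- {ν , s_i ν} adjusted, and the image of the operator with twist N − e is
-- annihilated by the operator with twist e. At time 0 the twist is N, and the
-- operator is π̄_i.

module Submission where

open import Defs
open import Data.Bool.Base using (if_then_else_; true; false)
open import Data.Fin.Base as Fin using (Fin; zero; suc; inject₁; inject; fromℕ; toℕ)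
open import Data.Fin.Permutation as Perm using (id; transpose; _⟨$⟩ʳ_; _⟨$⟩ˡ_) renaming (_≈_ to _≈ₚ_)
import Data.Fin.Permutation.Components as PC
import Data.Fin.Properties as Fin
open import Data.Integer.Base as ℤ using (ℤ; 0ℤ; 1ℤ)
open import Data.Integer.Divisibility.Signed as ℤ using (_∣_)
import Data.Integer.Properties as ℤ
import Data.Integer.Tactic.RingSolver as ℤ-Solver
open import Data.List.Base using (List; map)
open import Data.List.Base as List
  using ([]; _∷_; _++_; length; foldr; concatMap; deduplicate; cartesianProduct; allFin; filter)
open import Data.List.Membership.Propositional using (_∈_; find; lose)
open import Data.List.Membership.Propositional.Properties
  using (∈-concatMap⁺; ∈-concatMap⁻; ∈-deduplicate⁺; ∈-deduplicate⁻; ∈-cartesianProduct⁺; ∈-allFin;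
         ∈-filter⁺; ∈-filter⁻; ∈-map⁺; ∈-map⁻; ∈-++⁻; ∈-++⁺ˡ; ∈-++⁺ʳ)
open import Data.List.Membership.Propositional.Properties.WithK using (unique∧set⇒bag)
open import Data.List.Relation.Binary.BagAndSetEquality using (∼bag⇒↭)
open import Data.List.Relation.Binary.Permutation.Propositional as ↭ using (_↭_)
open import Data.List.Relation.Binary.Pointwise using (Pointwise)
open import Data.List.Relation.Binary.Pointwise using ([]; _∷_)
open import Data.List.Relation.Unary.All as All using (All; []; _∷_)
open import Data.List.Relation.Unary.AllPairs using (AllPairs; []; _∷_)
open import Data.List.Relation.Unary.Any using (Any; here; there)
import Data.List.Relation.Unary.Unique.DecPropositional.Properties as Unique
open import Data.List.Relation.Unary.Unique.Propositional using (Unique)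
open import Data.List.Relation.Unary.Unique.Propositional.Properties as Unique using (Unique[x∷xs]⇒x∉xs)
open import Data.Nat.Base using (ℕ)
open import Data.Nat.Base as ℕ using (zero; suc; pred; _!)
import Data.Nat.Coprimality as Coprime
import Data.Nat.Divisibility as ℕ
import Data.Nat.DivMod as ℕ using (m/n*n≡m)
import Data.Nat.Properties as ℕ
import Data.Nat.Tactic.RingSolver as ℕ-Solver
open import Data.Product.Base using (Σ-syntax; _×_)
open import Data.Product.Base using (∃; _,_; proj₁; proj₂)
open import Data.Rational.Base as ℚ using (ℚ; 0ℚ; 1ℚ; mkℚ)
import Data.Rational.Properties as ℚ
import Data.Rational.Solver as ℚ-Solver
open import Data.Sum.Base using (_⊎_; inj₁; inj₂)
open import Data.Vec.Base using (Vec)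
open import Data.Vec.Base as Vec using ([]; _∷_; lookup; tabulate; replicate)
open import Data.Vec.Functional using (Vector)
open import Data.Vec.Properties
  using (lookup∘tabulate; tabulate-cong; tabulate∘lookup; lookup-replicate; lookup-map; ≡-dec)
open import Data.Vec.Relation.Binary.Pointwise.Inductive as Pointwiseᵛ using ([]; _∷_)
open import Function.Base using (_∘_)
open import Function.Bundles using (mk⇔)
open import Relation.Binary.Construct.Closure.ReflexiveTransitive using (Star; ε; _◅_; _◅◅_)
open import Relation.Binary.Construct.Closure.Transitive as Transitive using (TransClosure; [_]; _∷_)
open import Relation.Binary.Definitions using (tri<; tri≈; tri>)
open import Relation.Binary.PropositionalEquality
open import Relation.Nullary using (¬_; Dec; does; yes; no; contradiction)
open import Relation.Nullary.Decidable using (dec-true; dec-false; does-⇔; _×-dec_)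

open import Algebra.Properties.CommutativeMonoid.Sum ℚ.+-0-commutativeMonoid
  using (sum; sum-cong-≗; sum-replicate-zero)

-- The relation between f and g is an identity, so the twist has to be the right integer and not
-- merely the right residue. This governs the choice of N as a common multiple of all positive
-- differences of entries of `lam`. If D = ν_i - ν_{i+1} > 0, then D divides N and N divides e + j
-- D, so D divides e. A positive e is therefore at least D, and e - D is again nonnegative, with no
-- reduction modulo N. At time j / N a path need not be at a lattice point, which is why exponents
-- are scaled by N. Integrality returns at the end: seen from time 0, only exponents divisible by N
-- occur, and restricting the relation with twist N to them gives the relation of π̄_i itself.
-- Twists and shifts lead to negative exponents, so generating functions are arbitrary functions on
-- integer vectors. No division by x_i^N - x_{i+1}^N is carried out on them; instead, vanishing at
-- negative exponents makes the solution of the relation unique.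

private
  variable
    n : ℕ
    A B : Set

-- Permutations acting on vectors

lookup-ext : {u v : Vec A n} → (∀ k → lookup u k ≡ lookup v k) → u ≡ v
lookup-ext {u = u} {v} h =
  trans (sym (tabulate∘lookup u)) (trans (tabulate-cong h) (tabulate∘lookup v))

lookup-• : (σ : Perm n) (v : Vec A n) (k : Fin n) →
           lookup (σ • v) k ≡ lookup v (σ ⟨$⟩ˡ k)
lookup-• σ v = lookup∘tabulate _

id-• : (v : Vec A n) → id • v ≡ v
id-• = tabulate∘lookup

·-• : (τ σ : Perm n) (v : Vec A n) → (τ · σ) • v ≡ τ • (σ • v)
·-• τ σ v = tabulate-cong λ k → sym (lookup-• σ v (τ ⟨$⟩ˡ k))

≈ₚ-sym : {σ τ : Perm n} → σ ≈ₚ τ → τ ≈ₚ σ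
≈ₚ-sym σ≈τ k = sym (σ≈τ k)

≈ₚ-trans : {σ τ υ : Perm n} → σ ≈ₚ τ → τ ≈ₚ υ → σ ≈ₚ υ
≈ₚ-trans σ≈τ τ≈υ k = trans (σ≈τ k) (τ≈υ k)

·-congˡ : (υ : Perm n) {σ τ : Perm n} → σ ≈ₚ τ → υ · σ ≈ₚ υ · τ
·-congˡ υ σ≈τ k = cong (υ ⟨$⟩ʳ_) (σ≈τ k)

≈ₚ⇒≈ˡ : {σ τ : Perm n} → σ ≈ₚ τ → ∀ k → σ ⟨$⟩ˡ k ≡ τ ⟨$⟩ˡ k
≈ₚ⇒≈ˡ {σ = σ} {τ} σ≈τ k = trans
  (cong (σ ⟨$⟩ˡ_) (trans (sym (Perm.inverseʳ τ)) (sym (σ≈τ (τ ⟨$⟩ˡ k)))))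
  (Perm.inverseˡ σ)

•-cong : {σ τ : Perm n} → σ ≈ₚ τ → (v : Vec A n) → σ • v ≡ τ • v
•-cong {σ = σ} {τ} σ≈τ v = tabulate-cong λ k → cong (lookup v) (≈ₚ⇒≈ˡ {σ = σ} {τ} σ≈τ k)

transpose-first : (a b : Fin n) → PC.transpose a b a ≡ b
transpose-first a b rewrite dec-true (a Fin.≟ a) refl = refl

transpose-second : (a b : Fin n) → PC.transpose a b b ≡ a
transpose-second a b with b Fin.≟ a
... | yes b≡a = b≡a
... | no _ rewrite dec-true (b Fin.≟ b) refl = refl

transpose-other : (a b c : Fin n) → c ≢ a → c ≢ b → PC.transpose a b c ≡ c
transpose-other a b c c≢a c≢b
  rewrite dec-false (c Fin.≟ a) c≢a | dec-false (c Fin.≟ b) c≢b = refl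

transpose-involutive : (a b c : Fin n) → PC.transpose a b (PC.transpose a b c) ≡ c
transpose-involutive a b c with c Fin.≟ a
... | yes refl = transpose-second c b
... | no c≢a with c Fin.≟ b
...   | yes refl = transpose-first a c
...   | no c≢b = transpose-other a b c c≢a c≢b

transpose-comm : (a b c : Fin n) → PC.transpose a b c ≡ PC.transpose b a c
transpose-comm a b c = trans
  (sym (PC.transpose-inverse b a))
  (cong (PC.transpose b a) (transpose-involutive a b c))

transpose-conj : (σ : Perm n) (a b c : Fin n) →
  PC.transpose a b (σ ⟨$⟩ˡ c) ≡ σ ⟨$⟩ˡ (PC.transpose (σ ⟨$⟩ʳ a) (σ ⟨$⟩ʳ b) c)
transpose-conj σ a b c with c Fin.≟ σ ⟨$⟩ʳ a
... | yes refl = trans (cong (PC.transpose a b) (Perm.inverseˡ σ))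
  (trans (transpose-first a b) (sym (Perm.inverseˡ σ)))
... | no c≢σa with c Fin.≟ σ ⟨$⟩ʳ b
...   | yes refl = trans (cong (PC.transpose a b) (Perm.inverseˡ σ))
  (trans (transpose-second a b) (sym (Perm.inverseˡ σ)))
...   | no c≢σb = transpose-other a b (σ ⟨$⟩ˡ c) (away c≢σa) (away c≢σb)
  where
  away : ∀ {d} → c ≢ σ ⟨$⟩ʳ d → σ ⟨$⟩ˡ c ≢ d
  away c≢σd eq = c≢σd (trans (sym (Perm.inverseʳ σ)) (cong (σ ⟨$⟩ʳ_) eq))

lookup-transpose : (a b : Fin n) (v : Vec A n) (k : Fin n) →
  lookup (transpose a b • v) k ≡ lookup v (PC.transpose a b k)
lookup-transpose a b v k = trans (lookup-• (transpose a b) v k)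
  (cong (lookup v) (transpose-comm b a k))

lookup-transpose-first : (a b : Fin n) (v : Vec A n) →
  lookup (transpose a b • v) a ≡ lookup v b
lookup-transpose-first a b v = trans (lookup-transpose a b v a) (cong (lookup v) (transpose-first a b))

lookup-transpose-second : (a b : Fin n) (v : Vec A n) →
  lookup (transpose a b • v) b ≡ lookup v a
lookup-transpose-second a b v = trans (lookup-transpose a b v b) (cong (lookup v) (transpose-second a b))

lookup-transpose-other : (a b : Fin n) (v : Vec A n) (k : Fin n) → k ≢ a → k ≢ b →
  lookup (transpose a b • v) k ≡ lookup v k
lookup-transpose-other a b v k k≢a k≢b = trans (lookup-transpose a b v k)
  (cong (lookup v) (transpose-other a b k k≢a k≢b))

•-involutive : (a b : Fin n) (v : Vec A n) → transpose a b • (transpose a b • v) ≡ v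
•-involutive a b v = lookup-ext λ k → trans (lookup-transpose a b (transpose a b • v) k)
  (trans (lookup-transpose a b v (PC.transpose a b k)) (cong (lookup v) (transpose-involutive a b k)))

transpose-• : (a b : Fin n) (v : Vec A n) → lookup v a ≡ lookup v b → transpose a b • v ≡ v
transpose-• a b v va≡vb = lookup-ext λ k → trans (lookup-transpose a b v k) (go k)
  where
  go : ∀ k → lookup v (PC.transpose a b k) ≡ lookup v k
  go k with k Fin.≟ a
  ... | yes refl = sym va≡vb
  ... | no k≢a with k Fin.≟ b
  ...   | yes refl = va≡vb
  ...   | no k≢b   = refl

•-conj : (σ : Perm n) (a b : Fin n) (v : Vec A n) →
  σ • (transpose a b • v) ≡ transpose (σ ⟨$⟩ʳ a) (σ ⟨$⟩ʳ b) • (σ • v)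
•-conj σ a b v = lookup-ext λ k → trans (lookup-• σ (transpose a b • v) k) (trans
  (lookup-transpose a b v (σ ⟨$⟩ˡ k)) (trans (cong (lookup v) (transpose-conj σ a b k)) (sym (trans
  (lookup-transpose _ _ (σ • v) k) (lookup-• σ v (PC.transpose (σ ⟨$⟩ʳ a) (σ ⟨$⟩ʳ b) k))))))

s-involutive : (i : Fin (pred n)) (v : Vec A n) → s i • (s i • v) ≡ v
s-involutive i = •-involutive (lo i) (hi i)

lo<hi : (i : Fin (pred n)) → lo {n} i Fin.< hi {n} i
lo<hi {suc n} i = ℕ.s≤s (ℕ.≤-reflexive (Fin.toℕ-inject₁ i))

s-zero : (a b : A) (v : Vec A n) → s {suc (suc n)} zero • (a ∷ b ∷ v) ≡ b ∷ a ∷ v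
s-zero a b v = cong (λ u → b ∷ a ∷ u) (tabulate∘lookup v)

s-suc : (i : Fin n) (a : A) (v : Vec A (suc n)) → s (suc i) • (a ∷ v) ≡ a ∷ s i • v
s-suc i a v = cong (a ∷_) (tabulate-cong λ k → go k)
  where
  go : ∀ k → lookup (a ∷ v) (PC.transpose (suc (suc i)) (suc (inject₁ i)) (suc k))
           ≡ lookup v (PC.transpose (suc i) (inject₁ i) k)
  go k = cong (lookup (a ∷ v)) (Perm.lift₀-transpose (suc i) (inject₁ i) (suc k))

-- Ascents

ascent : ℕ → ℕ → ℕ
ascent a b = if does (a ℕ.<? b) then 1 else 0

above : ℕ → Vec ℕ n → ℕ
above a []      = 0
above a (b ∷ v) = ascent a b ℕ.+ above a v

-- If v lies in the orbit of a partition, this is the length of the minimal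
-- coset representative that moves the partition to v.
ascents : Vec ℕ n → ℕ
ascents []      = 0
ascents (a ∷ v) = above a v ℕ.+ ascents v

ascent-yes : ∀ {a b} → a ℕ.< b → ascent a b ≡ 1
ascent-yes {a} {b} a<b rewrite dec-true (a ℕ.<? b) a<b = refl

ascent-no : ∀ {a b} → ¬ a ℕ.< b → ascent a b ≡ 0
ascent-no {a} {b} a≮b rewrite dec-false (a ℕ.<? b) a≮b = refl

ascent-mono : ∀ {a b c d} → (a ℕ.< b → c ℕ.< d) → ascent a b ℕ.≤ ascent c d
ascent-mono {a} {b} {c} {d} = go (a ℕ.<? b) (c ℕ.<? d)
  where
  go : ∀ {P Q : Set} (p? : Dec P) (q? : Dec Q) → (P → Q) →
       (if does p? then 1 else 0) ℕ.≤ (if does q? then 1 else 0)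
  go (no _)  q?      h = ℕ.z≤n
  go (yes p) (yes _) h = ℕ.≤-refl
  go (yes p) (no ¬q) h = contradiction (h p) ¬q

above-mono : ∀ {a b} (u v : Vec ℕ n) →
  (∀ k → a ℕ.< lookup u k → b ℕ.< lookup v k) → above a u ℕ.≤ above b v
above-mono []      []      h = ℕ.z≤n
above-mono (_ ∷ u) (_ ∷ v) h =
  ℕ.+-mono-≤ (ascent-mono (h zero)) (above-mono u v (h ∘ suc))

ascents-mono : (u v : Vec ℕ n) →
  (∀ k l → k Fin.< l → lookup u k ℕ.< lookup u l → lookup v k ℕ.< lookup v l) →
  ascents u ℕ.≤ ascents v
ascents-mono []      []      h = ℕ.z≤n
ascents-mono (_ ∷ u) (_ ∷ v) h = ℕ.+-mono-≤
  (above-mono u v λ k → h zero (suc k) (ℕ.s≤s ℕ.z≤n))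
  (ascents-mono u v λ k l k<l → h (suc k) (suc l) (ℕ.s≤s k<l))

above-s : (a : ℕ) (i : Fin n) (v : Vec ℕ (suc n)) → above a (s i • v) ≡ above a v
above-s a zero (b ∷ c ∷ v) = trans (cong (above a) (s-zero b c v)) (
  swap (ascent a c) (ascent a b) (above a v))
  where
  swap : ∀ p q r → p ℕ.+ (q ℕ.+ r) ≡ q ℕ.+ (p ℕ.+ r)
  swap = ℕ-Solver.solve-∀
above-s a (suc i) (b ∷ v) = trans (cong (above a) (s-suc i b v))
  (cong (ascent a b ℕ.+_) (above-s a i v))

-- Only the comparison between the two swapped entries changes; `above-s` disposes of the entries in
-- front of them.
ascents-s< : (i : Fin (pred n)) (v : Vec ℕ n) → lookup v (lo i) ℕ.< lookup v (hi i) →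
  ascents v ≡ suc (ascents (s i • v))
ascents-s< {suc n} zero (a ∷ b ∷ v) a<b = trans
  (swap (above a v) (above b v) (ascents v) (ascent-yes a<b) (ascent-no (ℕ.<-asym a<b)))
  (cong (suc ∘ ascents) (sym (s-zero a b v)))
  where
  comm : ∀ p q r → p ℕ.+ (q ℕ.+ r) ≡ q ℕ.+ (p ℕ.+ r)
  comm = ℕ-Solver.solve-∀
  swap : ∀ {o o′} p q r → o ≡ 1 → o′ ≡ 0 → (o ℕ.+ p) ℕ.+ (q ℕ.+ r) ≡ suc ((o′ ℕ.+ q) ℕ.+ (p ℕ.+ r))
  swap p q r refl refl = cong suc (comm p q r)
ascents-s< {suc n} (suc i) (a ∷ v) v< = trans
  (cong₂ ℕ._+_ (sym (above-s a i v)) (ascents-s< i v v<))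
  (trans (ℕ.+-suc (above a (s i • v)) _) (cong (suc ∘ ascents) (sym (s-suc i a v))))

lookup-s-lo : (i : Fin (pred n)) (v : Vec A n) → lookup (s i • v) (lo i) ≡ lookup v (hi i)
lookup-s-lo i = lookup-transpose-first (lo i) (hi i)

lookup-s-hi : (i : Fin (pred n)) (v : Vec A n) → lookup (s i • v) (hi i) ≡ lookup v (lo i)
lookup-s-hi i = lookup-transpose-second (lo i) (hi i)

s-fixes : (i : Fin (pred n)) (v : Vec A n) → lookup v (lo i) ≡ lookup v (hi i) → s i • v ≡ v
s-fixes i = transpose-• (lo i) (hi i)

ascents-s> : (i : Fin (pred n)) (v : Vec ℕ n) → lookup v (hi i) ℕ.< lookup v (lo i) →
  ascents (s i • v) ≡ suc (ascents v)
ascents-s> i v v> = trans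
  (ascents-s< i (s i • v) (subst₂ ℕ._<_ (sym (lookup-s-lo i v)) (sym (lookup-s-hi i v)) v>))
  (cong (suc ∘ ascents) (s-involutive i v))

ascents-s≤ : (i : Fin (pred n)) (v : Vec ℕ n) → lookup v (lo i) ℕ.≤ lookup v (hi i) →
  ascents (s i • v) ℕ.≤ ascents v
ascents-s≤ i v v≤ with ℕ.m≤n⇒m<n∨m≡n v≤
... | inj₁ v< = ℕ.≤-trans (ℕ.n≤1+n _) (ℕ.≤-reflexive (sym (ascents-s< i v v<)))
... | inj₂ v≡ = ℕ.≤-reflexive (cong ascents (s-fixes i v v≡))

ascents-s≥ : (i : Fin (pred n)) (v : Vec ℕ n) → lookup v (hi i) ℕ.≤ lookup v (lo i) →
  ascents v ℕ.≤ ascents (s i • v)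
ascents-s≥ i v v≥ = subst (λ u → ascents u ℕ.≤ ascents (s i • v)) (s-involutive i v)
  (ascents-s≤ i (s i • v) (subst₂ ℕ._≤_ (sym (lookup-s-lo i v)) (sym (lookup-s-hi i v)) v≥))

ascents-s≤1+ : (i : Fin (pred n)) (v : Vec ℕ n) → ascents (s i • v) ℕ.≤ suc (ascents v)
ascents-s≤1+ i v with ℕ.≤-total (lookup v (lo i)) (lookup v (hi i))
... | inj₁ v≤ = ℕ.m≤n⇒m≤1+n (ascents-s≤ i v v≤)
... | inj₂ v≥ with ℕ.m≤n⇒m<n∨m≡n v≥
...   | inj₁ v> = ℕ.≤-reflexive (ascents-s> i v v>)
...   | inj₂ v≡ = ℕ.m≤n⇒m≤1+n (ℕ.≤-reflexive (cong ascents (s-fixes i v (sym v≡))))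

s-lo : (i : Fin (pred n)) → s {n} i ⟨$⟩ʳ lo i ≡ hi i
s-lo {n} i = transpose-first (lo {n} i) (hi i)

s-hi : (i : Fin (pred n)) → s {n} i ⟨$⟩ʳ hi i ≡ lo i
s-hi {n} i = transpose-second (lo {n} i) (hi i)

s-other : (i : Fin (pred n)) (k : Fin n) → k ≢ lo i → k ≢ hi i → s i ⟨$⟩ʳ k ≡ k
s-other {n} i = transpose-other (lo {n} i) (hi i)

private
  data At (i : Fin (pred n)) (k : Fin n) : Set where
    is-lo : k ≡ lo i → At i k
    is-hi : k ≡ hi i → At i k
    is-other : k ≢ lo i → k ≢ hi i → At i k

  at : (i : Fin (pred n)) (k : Fin n) → At i k
  at i k with k Fin.≟ lo i
  ... | yes p = is-lo p
  ... | no ¬p with k Fin.≟ hi i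
  ...   | yes q = is-hi q
  ...   | no ¬q = is-other ¬p ¬q

toℕ-hi : (i : Fin (pred n)) → toℕ (hi {n} i) ≡ suc (toℕ (lo {n} i))
toℕ-hi {suc n} i = cong suc (sym (Fin.toℕ-inject₁ i))

-- In terms of roots: a simple reflection permutes the positive roots other than its own.
s-preserves-< : (i : Fin (pred n)) (k l : Fin n) → k Fin.< l → ¬ (k ≡ lo i × l ≡ hi i) →
  s i ⟨$⟩ʳ k Fin.< s i ⟨$⟩ʳ l
s-preserves-< {n} i k l k<l ¬simple with at i k | at i l
... | is-lo refl | is-lo refl = contradiction k<l (ℕ.<-irrefl refl)
... | is-lo refl | is-hi refl = contradiction (refl , refl) ¬simple
... | is-lo refl | is-other _ l≢hi rewrite s-lo {n} i | s-other i l (λ { refl → ℕ.<-irrefl refl k<l }) l≢hi =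
  ℕ.≤∧≢⇒< (subst (ℕ._≤ toℕ l) (sym (toℕ-hi {n} i)) k<l) (λ eq → l≢hi (Fin.toℕ-injective (sym eq)))
... | is-hi refl | is-lo refl = contradiction k<l (ℕ.<-asym (lo<hi {n} i))
... | is-hi refl | is-hi refl = contradiction k<l (ℕ.<-irrefl refl)
... | is-hi refl | is-other l≢lo l≢hi rewrite s-hi {n} i | s-other i l l≢lo l≢hi =
  ℕ.<-trans (lo<hi {n} i) k<l
... | is-other k≢lo k≢hi | is-lo refl rewrite s-lo {n} i | s-other i k k≢lo k≢hi =
  ℕ.<-trans k<l (lo<hi {n} i)
... | is-other k≢lo k≢hi | is-hi refl rewrite s-hi {n} i | s-other i k k≢lo k≢hi =
  ℕ.≤∧≢⇒< (ℕ.s≤s⁻¹ (subst (suc (toℕ k) ℕ.≤_) (toℕ-hi {n} i) k<l)) (k≢lo ∘ Fin.toℕ-injective)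
... | is-other k≢lo k≢hi | is-other l≢lo l≢hi
  rewrite s-other i k k≢lo k≢hi | s-other i l l≢lo l≢hi = k<l

-- For l > k + 1 the transposition (k l) is conjugated to (k l−1) by s_{l−1}.
-- The two outer factors together do not increase the number of ascents.
ascents-transpose : (v : Vec ℕ n) (k l : Fin n) → k Fin.< l → lookup v k ℕ.< lookup v l →
  ascents (transpose k l • v) ℕ.< ascents v
ascents-transpose {n} v k l k<l v< = go (toℕ l) v k l refl k<l v<
  where
  go : ∀ {n} m (v : Vec ℕ n) (k l : Fin n) → toℕ l ≡ m → k Fin.< l →
       lookup v k ℕ.< lookup v l → ascents (transpose k l • v) ℕ.< ascents v
  go {suc n} (suc m) v k (suc i) eq k<l v< with k Fin.≟ inject₁ i
  ... | yes refl = ℕ.≤-reflexive (sym (ascents-s< i v v<))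
  ... | no k≢i = subst (λ u → ascents u ℕ.< ascents v) (sym decompose) step
    where
    l-1 = inject₁ i
    u = s i • v
    w = transpose k l-1 • u
    k<l-1 : k Fin.< l-1
    k<l-1 = ℕ.≤∧≢⇒< (subst (toℕ k ℕ.≤_) (sym (Fin.toℕ-inject₁ i)) (ℕ.s≤s⁻¹ k<l))
      (k≢i ∘ Fin.toℕ-injective)
    k≢l : k ≢ suc i
    k≢l refl = ℕ.<-irrefl refl k<l
    decompose : transpose k (suc i) • v ≡ s i • w
    decompose = sym (trans (•-conj (s i) k l-1 u) (trans
      (cong₂ (λ a b → transpose a b • (s i • u)) (s-other i k k≢i k≢l) (s-lo i))
      (cong (transpose k (suc i) •_) (s-involutive i v))))
    p = lookup v k
    q = lookup v l-1
    r = lookup v (suc i)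
    uk : lookup u k ≡ p
    uk = lookup-transpose-other l-1 (suc i) v k k≢i k≢l
    ul : lookup u l-1 ≡ r
    ul = lookup-s-lo i v
    wlo : lookup w l-1 ≡ p
    wlo = trans (lookup-transpose-second k l-1 u) uk
    whi : lookup w (suc i) ≡ q
    whi = trans (lookup-transpose-other k l-1 u (suc i) (≢-sym k≢l)
      (λ e → ℕ.1+n≢n (trans (cong toℕ e) (Fin.toℕ-inject₁ i)))) (lookup-s-hi i v)
    inner : ascents w ℕ.< ascents u
    inner = go m u k l-1 (trans (Fin.toℕ-inject₁ i) (ℕ.suc-injective eq)) k<l-1
      (subst₂ ℕ._<_ (sym uk) (sym ul) v<)
    step : ascents (s i • w) ℕ.< ascents v
    step with ℕ.<-cmp q r
    ... | tri< q<r _ _ = ℕ.≤-trans (ℕ.s≤s (ascents-s≤1+ i w))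
      (ℕ.≤-trans (ℕ.s≤s inner) (ℕ.≤-reflexive (sym (ascents-s< i v q<r))))
    ... | tri≈ _ q≡r _ = ℕ.≤-trans
      (ℕ.s≤s (ascents-s≤ i w (subst₂ ℕ._≤_ (sym wlo) (sym whi) (subst (p ℕ.≤_) (sym q≡r) (ℕ.<⇒≤ v<)))))
      (ℕ.≤-trans inner (ascents-s≤ i v (ℕ.≤-reflexive q≡r)))
    ... | tri> _ _ r<q = ℕ.≤-trans
      (ℕ.≤-reflexive (sym (ascents-s< i w (subst₂ ℕ._<_ (sym wlo) (sym whi) (ℕ.<-trans v< r<q)))))
      (ℕ.s≤s⁻¹ (ℕ.≤-trans inner (ascents-s≤1+ i v)))

ascents-transpose⁻¹ : (v : Vec ℕ n) (k l : Fin n) → k Fin.< l →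
  ascents (transpose k l • v) ℕ.< ascents v → lookup v k ℕ.< lookup v l
ascents-transpose⁻¹ v k l k<l lt with ℕ.<-cmp (lookup v k) (lookup v l)
... | tri< v< _ _ = v<
... | tri≈ _ v≡ _ = contradiction lt (ℕ.<-irrefl (cong ascents (transpose-• k l v v≡)))
... | tri> _ _ v> = contradiction lt (ℕ.<-asym (subst (λ u → ascents u ℕ.< ascents (transpose k l • v))
  (•-involutive k l v) (ascents-transpose (transpose k l • v) k l k<l
    (subst₂ ℕ._<_ (sym (lookup-transpose-first k l v)) (sym (lookup-transpose-second k l v)) v>))))

-- The inductions on length below descend along the adjacent ascent found here, since swapping it
-- lowers `ascents` by one. If there is none, then `a ≥ b` and nothing in `v` exceeds `b`, so
-- nothing in `v` exceeds `a`.
find-ascent : (v : Vec ℕ n) → (∃ λ i → lookup v (lo i) ℕ.< lookup v (hi i)) ⊎ ascents v ≡ 0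
find-ascent []          = inj₂ refl
find-ascent (a ∷ [])    = inj₂ refl
find-ascent (a ∷ b ∷ v) with a ℕ.<? b | find-ascent (b ∷ v)
... | yes a<b | _             = inj₁ (zero , a<b)
... | no _    | inj₁ (i , lt) = inj₁ (suc i , lt)
... | no a≮b  | inj₂ eq       = inj₂ (cong₂ ℕ._+_ (cong₂ ℕ._+_ (ascent-no a≮b) above≡0) eq)
  where
  above≡0 : above a v ≡ 0
  above≡0 = ℕ.n≤0⇒n≡0 (ℕ.≤-trans
    (above-mono v v λ k → ℕ.≤-<-trans (ℕ.≮⇒≥ a≮b))
    (ℕ.≤-reflexive (ℕ.m+n≡0⇒m≡0 _ eq)))

-- Chains of vectors

lookup-•-ʳ : (σ : Perm n) (v : Vec A n) (k : Fin n) → lookup (σ • v) (σ ⟨$⟩ʳ k) ≡ lookup v k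
lookup-•-ʳ σ v k = trans (lookup-• σ v _) (cong (lookup v) (Perm.inverseˡ σ))

diff : Vec ℕ n → Fin n → Fin n → ℤ
diff v k l = ℤ.+ lookup v k ℤ.- ℤ.+ lookup v l

diff-s : (i : Fin (pred n)) (v : Vec ℕ n) → diff (s i • v) (lo i) (hi i) ≡ diff v (hi i) (lo i)
diff-s i v = cong₂ (λ p q → ℤ.+ p ℤ.- ℤ.+ q) (lookup-s-lo i v) (lookup-s-hi i v)

Neg NonNeg Pos NonPos : Fin (pred n) → Vec ℕ n → Set
Neg    i v = lookup v (lo i) ℕ.< lookup v (hi i)
NonPos i v = lookup v (lo i) ℕ.≤ lookup v (hi i)
Pos    i v = lookup v (hi i) ℕ.< lookup v (lo i)
NonNeg i v = lookup v (hi i) ℕ.≤ lookup v (lo i)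

Neg⇒Pos-s : (i : Fin (pred n)) (v : Vec ℕ n) → Neg i v → Pos i (s i • v)
Neg⇒Pos-s i v = subst₂ ℕ._<_ (sym (lookup-s-hi i v)) (sym (lookup-s-lo i v))

Pos⇒Neg-s : (i : Fin (pred n)) (v : Vec ℕ n) → Pos i v → Neg i (s i • v)
Pos⇒Neg-s i v = subst₂ ℕ._<_ (sym (lookup-s-lo i v)) (sym (lookup-s-hi i v))

-- The images κ • lam and κ′ • lam of two consecutive elements of an a-chain,
-- where a = j / N.
record Step (N j : ℕ) (κ′ κ : Vec ℕ n) : Set where
  constructor step
  field
    β        : PositiveRoot n
    reflects : κ ≡ reflection β • κ′
    covers   : ascents κ′ ≡ suc (ascents κ)
    integral : ℤ.+ N ∣ ℤ.+ j ℤ.* diff κ′ (PositiveRoot.a β) (PositiveRoot.b β)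

Reach : (N j : ℕ) → Vec ℕ n → Vec ℕ n → Set
Reach N j = Star (Step N j)

-- Lifting chains along a simple reflection

module _ {N j : ℕ} where

  private
    _∣ⱼ_ : ℕ → ℤ → Set
    M ∣ⱼ z = ℤ.+ M ∣ ℤ.+ j ℤ.* z

    ∣ⱼ-flip : ∀ p q → N ∣ⱼ (p ℤ.- q) → N ∣ⱼ (q ℤ.- p)
    ∣ⱼ-flip p q h = subst (ℤ.+ N ∣_) (flip (ℤ.+ j) p q) (ℤ.∣m⇒∣-m h)
      where
      flip : ∀ j p q → ℤ.- (j ℤ.* (p ℤ.- q)) ≡ j ℤ.* (q ℤ.- p)
      flip = ℤ-Solver.solve-∀

  Congruent : Vec ℕ n → Vec ℕ n → Set
  Congruent u v = ∀ k → N ∣ⱼ (ℤ.+ lookup u k ℤ.- ℤ.+ lookup v k)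

  step-ascends : {κ ν : Vec ℕ n} → (st : Step N j κ ν) →
    lookup κ (PositiveRoot.a (Step.β st)) ℕ.< lookup κ (PositiveRoot.b (Step.β st))
  step-ascends {κ = κ} (step β refl covers _) = ascents-transpose⁻¹ κ a b a<b (ℕ.≤-reflexive (sym covers))
    where open PositiveRoot β

  congruent-refl : (u : Vec ℕ n) → Congruent u u
  congruent-refl u k = ℤ.divides 0ℤ (lemma (ℤ.+ j) (ℤ.+ lookup u k))
    where
    lemma : ∀ p q → p ℤ.* (q ℤ.- q) ≡ 0ℤ
    lemma = ℤ-Solver.solve-∀

  congruent-trans : (u v w : Vec ℕ n) → Congruent u v → Congruent v w → Congruent u w
  congruent-trans u v w uv vw k = subst (ℤ.+ N ∣_)
    (lemma (ℤ.+ j) (ℤ.+ lookup u k) (ℤ.+ lookup v k) (ℤ.+ lookup w k))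
    (ℤ.∣m∣n⇒∣m+n (uv k) (vw k))
    where
    lemma : ∀ p a b c → p ℤ.* (a ℤ.- b) ℤ.+ p ℤ.* (b ℤ.- c) ≡ p ℤ.* (a ℤ.- c)
    lemma = ℤ-Solver.solve-∀

  step-congruent : {κ ν : Vec ℕ n} → Step N j κ ν → Congruent κ ν
  step-congruent {κ = κ} (step β refl _ integral) k = go (k Fin.≟ a) (k Fin.≟ b)
    where
    open PositiveRoot β
    go : Dec (k ≡ a) → Dec (k ≡ b) →
         N ∣ⱼ (ℤ.+ lookup κ k ℤ.- ℤ.+ lookup (transpose a b • κ) k)
    go (yes refl) _ rewrite lookup-transpose-first a b κ = integral
    go (no _) (yes refl) rewrite lookup-transpose-second a b κ =
      ∣ⱼ-flip (ℤ.+ lookup κ a) (ℤ.+ lookup κ b) integral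
    go (no k≢a) (no k≢b) rewrite lookup-transpose-other a b κ k k≢a k≢b = congruent-refl κ k

  -- A step changes two entries, each by a difference that becomes divisible by N after
  -- multiplication by j. Hence the integrality condition for swapping the entries i and i + 1 at
  -- time j / N holds at every vector of a chain or at none.
  reach-congruent : {κ ν : Vec ℕ n} → Reach N j κ ν → Congruent κ ν
  reach-congruent {κ = κ} ε          = congruent-refl κ
  reach-congruent {κ = κ} {ν} (_◅_ {j = μ} st r) = congruent-trans κ μ ν (step-congruent st) (reach-congruent r)

  congruent-diff : (u v : Vec ℕ n) (k l : Fin n) → Congruent u v →
    N ∣ⱼ (diff u k l ℤ.- diff v k l)
  congruent-diff u v k l c = subst (ℤ.+ N ∣_)
    (lemma (ℤ.+ j) (ℤ.+ lookup u k) (ℤ.+ lookup v k) (ℤ.+ lookup u l) (ℤ.+ lookup v l))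
    (ℤ.∣m∣n⇒∣m-n (c k) (c l))
    where
    lemma : ∀ p a b c d → p ℤ.* (a ℤ.- b) ℤ.- p ℤ.* (c ℤ.- d) ≡ p ℤ.* ((a ℤ.- c) ℤ.- (b ℤ.- d))
    lemma = ℤ-Solver.solve-∀

  congruent-∣ : (u v : Vec ℕ n) (k l : Fin n) (e : ℤ) → Congruent u v →
    ℤ.+ N ∣ e ℤ.+ ℤ.+ j ℤ.* diff u k l → ℤ.+ N ∣ e ℤ.+ ℤ.+ j ℤ.* diff v k l
  congruent-∣ u v k l e c h = subst (ℤ.+ N ∣_)
    (lemma e (ℤ.+ j) (diff u k l) (diff v k l))
    (ℤ.∣m∣n⇒∣m-n h (congruent-diff u v k l c))
    where
    lemma : ∀ e p a b → (e ℤ.+ p ℤ.* a) ℤ.- p ℤ.* (a ℤ.- b) ≡ e ℤ.+ p ℤ.* b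
    lemma = ℤ-Solver.solve-∀

  congruent-∣₀ : (u v : Vec ℕ n) (k l : Fin n) → Congruent u v →
    N ∣ⱼ diff u k l → N ∣ⱼ diff v k l
  congruent-∣₀ u v k l c h = subst (ℤ.+ N ∣_) (ℤ.+-identityˡ _)
    (congruent-∣ u v k l 0ℤ c (subst (ℤ.+ N ∣_) (sym (ℤ.+-identityˡ _)) h))

  congruent-sym : (u v : Vec ℕ n) → Congruent u v → Congruent v u
  congruent-sym u v c k = ∣ⱼ-flip (ℤ.+ lookup u k) (ℤ.+ lookup v k) (c k)

  diff-flip : (v : Vec ℕ n) (k l : Fin n) → N ∣ⱼ diff v k l → N ∣ⱼ diff v l k
  diff-flip v k l = ∣ⱼ-flip (ℤ.+ lookup v k) (ℤ.+ lookup v l)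

  private
    Simple : Fin (pred n) → PositiveRoot n → Set
    Simple i β = PositiveRoot.a β ≡ lo i × PositiveRoot.b β ≡ hi i

    simple? : (i : Fin (pred n)) (β : PositiveRoot n) → Dec (Simple i β)
    simple? i β = (PositiveRoot.a β Fin.≟ lo i) ×-dec (PositiveRoot.b β Fin.≟ hi i)

    -- The reflected root is again positive, and it joins `s i • κ` to `s i • ν` by swapping the
    -- same two ascending entries.
    s-ascents : (i : Fin (pred n)) {κ ν : Vec ℕ n} (st : Step N j κ ν) → ¬ Simple i (Step.β st) →
      ascents (s i • ν) ℕ.< ascents (s i • κ)
    s-ascents i {κ} st@(step β refl covers integral) ¬simple =
      subst (λ u → ascents u ℕ.< ascents (s i • κ)) (sym (•-conj (s i) a b κ))
        (ascents-transpose (s i • κ) (s i ⟨$⟩ʳ a) (s i ⟨$⟩ʳ b) (s-preserves-< i a b a<b ¬simple)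
          (subst₂ ℕ._<_ (sym (lookup-•-ʳ (s i) κ a)) (sym (lookup-•-ʳ (s i) κ b)) (step-ascends st)))
      where open PositiveRoot β

    s-step : (i : Fin (pred n)) {κ ν : Vec ℕ n} (st : Step N j κ ν) → ¬ Simple i (Step.β st) →
      ascents (s i • κ) ≡ suc (ascents (s i • ν)) → Step N j (s i • κ) (s i • ν)
    s-step i {κ} (step β refl _ integral) ¬simple covers = step
      (record { a = s i ⟨$⟩ʳ a ; b = s i ⟨$⟩ʳ b ; a<b = s-preserves-< i a b a<b ¬simple })
      (•-conj (s i) a b κ) covers
      (subst (λ d → ℤ.+ N ∣ ℤ.+ j ℤ.* d)
        (sym (cong₂ (λ p q → ℤ.+ p ℤ.- ℤ.+ q) (lookup-•-ʳ (s i) κ a) (lookup-•-ʳ (s i) κ b)))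
        integral)
      where open PositiveRoot β

    s-step-Neg : (i : Fin (pred n)) {κ ν : Vec ℕ n} → Step N j κ ν → Neg i κ → Neg i ν →
      Step N j (s i • κ) (s i • ν)
    s-step-Neg i {κ} {ν} st@(step β@record{} refl covers _) κ<0 ν<0 = s-step i st
      (λ { (refl , refl) → ℕ.<-asym ν<0 (Neg⇒Pos-s i κ κ<0) })
      (ℕ.suc-injective (trans (sym (ascents-s< i κ κ<0)) (trans covers (cong suc (ascents-s< i ν ν<0)))))

    s-step-Pos : (i : Fin (pred n)) {κ ν : Vec ℕ n} → Step N j κ ν → Pos i κ → Pos i ν →
      Step N j (s i • κ) (s i • ν)
    s-step-Pos i {κ} {ν} st@(step β@record{} refl covers _) κ>0 ν>0 = s-step i st
      (λ { (refl , refl) → ℕ.<-asym κ>0 (step-ascends st) })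
      (trans (ascents-s> i κ κ>0) (trans (cong suc covers) (cong suc (sym (ascents-s> i ν ν>0)))))

    -- For any other root, `s-ascents` gives fewer ascents to `s i • ν` than to `s i • κ`. But the
    -- swap lowers the count of κ by one, to that of ν, and it cannot lower the count of ν.
    step-up : (i : Fin (pred n)) {κ ν : Vec ℕ n} → Step N j κ ν → Neg i κ → NonNeg i ν →
      ν ≡ s i • κ × N ∣ⱼ diff κ (lo i) (hi i)
    step-up i {κ} {ν} st@(step β@record{} ν≡ covers integral) κ<0 ν≥0 with simple? i β
    ... | yes (refl , refl) = ν≡ , integral
    ... | no ¬simple = contradiction
      (ℕ.≤-trans (s-ascents i st ¬simple) (ℕ.≤-trans
        (ℕ.≤-reflexive (ℕ.suc-injective (trans (sym (ascents-s< i κ κ<0)) covers)))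
        (ascents-s≥ i ν ν≥0)))
      (ℕ.<-irrefl refl)

    -- The same count, with the strict inequality assumed of ν instead of κ.
    step-up′ : (i : Fin (pred n)) {κ ν : Vec ℕ n} → Step N j κ ν → NonPos i κ → Pos i ν →
      ν ≡ s i • κ × N ∣ⱼ diff κ (lo i) (hi i)
    step-up′ i {κ} {ν} st@(step β@record{} ν≡ covers integral) κ≤0 ν>0 with simple? i β
    ... | yes (refl , refl) = ν≡ , integral
    ... | no ¬simple = contradiction
      (ℕ.≤-trans (s-ascents i st ¬simple) (ℕ.≤-trans (ascents-s≤ i κ κ≤0)
        (ℕ.≤-reflexive (trans covers (sym (ascents-s> i ν ν>0))))))
      (ℕ.<-irrefl refl)

  α-step : (i : Fin (pred n)) {κ : Vec ℕ n} → Neg i κ → N ∣ⱼ diff κ (lo i) (hi i) →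
    Step N j κ (s i • κ)
  α-step {n} i {κ} κ<0 = step (record { a = lo i ; b = hi i ; a<b = lo<hi {n} i }) refl (ascents-s< i κ κ<0)

  α-step′ : (i : Fin (pred n)) {κ : Vec ℕ n} → Pos i κ → N ∣ⱼ diff κ (lo i) (hi i) →
    Step N j (s i • κ) κ
  α-step′ i {κ} κ>0 h = subst (Step N j (s i • κ)) (s-involutive i κ)
    (α-step i (Pos⇒Neg-s i κ κ>0) (subst (N ∣ⱼ_) (sym (diff-s i κ)) (diff-flip κ (lo i) (hi i) h)))

  -- The chain leaves the negative side for the first time in a single step, which by `step-up` is
  -- the swap itself. Dropping this step and reflecting everything before it gives the new chain.
  -- This is the lifting property of Bruhat order, refined by integrality.
  reach-up : (i : Fin (pred n)) {κ ν : Vec ℕ n} → Reach N j κ ν → Neg i κ → NonNeg i ν →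
    Reach N j (s i • κ) ν × N ∣ⱼ diff κ (lo i) (hi i)
  reach-up i ε κ<0 ν≥0 = contradiction κ<0 (ℕ.≤⇒≯ ν≥0)
  reach-up i {κ} {ν} (_◅_ {j = μ} st r) κ<0 ν≥0 with ℕ.≤-<-connex (lookup μ (hi i)) (lookup μ (lo i))
  ... | inj₁ μ≥0 with step-up i st κ<0 μ≥0
  ...   | refl , d = r , d
  reach-up i {κ} {ν} (_◅_ {j = μ} st r) κ<0 ν≥0 | inj₂ μ<0 with reach-up i r μ<0 ν≥0
  ...   | r′ , d = s-step-Neg i st κ<0 μ<0 ◅ r′ ,
    congruent-∣₀ μ κ (lo i) (hi i) (congruent-sym κ μ (step-congruent st)) d

  -- A chain that stays negative is reflected step by step. Otherwise the crossing step lands on the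
  -- reflection of its source, so the rest of the chain already has the desired start, and a swap
  -- appended at ν, integral by congruence, gives the desired end.
  reach-Neg : (i : Fin (pred n)) {κ ν : Vec ℕ n} → Reach N j κ ν → Neg i κ → Neg i ν →
    Reach N j (s i • κ) (s i • ν)
  reach-Neg i ε κ<0 ν<0 = ε
  reach-Neg i {κ} {ν} (_◅_ {j = μ} st r) κ<0 ν<0 with ℕ.≤-<-connex (lookup μ (hi i)) (lookup μ (lo i))
  ... | inj₂ μ<0 = s-step-Neg i st κ<0 μ<0 ◅ reach-Neg i r μ<0 ν<0
  ... | inj₁ μ≥0 with step-up i st κ<0 μ≥0
  ...   | refl , d = r ◅◅ (α-step i ν<0
    (congruent-∣₀ κ ν (lo i) (hi i) (reach-congruent (st ◅ r)) d) ◅ ε)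

  reach-s : (i : Fin (pred n)) {κ ν : Vec ℕ n} → NonNeg i κ → N ∣ⱼ diff κ (lo i) (hi i) →
    Reach N j κ ν → Reach N j (s i • κ) ν
  reach-s i {κ} {ν} κ≥0 d r with ℕ.m≤n⇒m<n∨m≡n κ≥0
  ... | inj₁ κ>0 = α-step′ i κ>0 d ◅ r
  ... | inj₂ κ≡0 = subst (λ u → Reach N j u ν) (sym (s-fixes i κ (sym κ≡0))) r

  -- The chain may leave the positive side and return, so `go` keeps both the part already
  -- traversed, κ to μ, and its reflection as far as it exists. On a return from μ to μ′ =
  -- `s i • μ`, the target `s i • μ′` is μ, and the unreflected part preceded by a swap at κ serves.
  reach-Pos : (i : Fin (pred n)) {κ ν : Vec ℕ n} → NonNeg i κ → Pos i ν → Reach N j κ ν →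
    Reach N j (s i • κ) (s i • ν)
  reach-Pos i {κ} κ≥0 ν>0 = λ r → go ε (λ _ → ε) r ν>0
    where
    go : ∀ {μ ν} → Reach N j κ μ → (Pos i μ → Reach N j (s i • κ) (s i • μ)) → Reach N j μ ν →
         Pos i ν → Reach N j (s i • κ) (s i • ν)
    go κ↝μ h ε = h
    go {μ} κ↝μ h (_◅_ {j = μ′} st r) = go (κ↝μ ◅◅ st ◅ ε) h′ r
      where
      h′ : Pos i μ′ → Reach N j (s i • κ) (s i • μ′)
      h′ μ′>0 with ℕ.≤-<-connex (lookup μ (lo i)) (lookup μ (hi i))
      ... | inj₂ μ>0 = h μ>0 ◅◅ s-step-Pos i st μ>0 μ′>0 ◅ ε
      ... | inj₁ μ≤0 with step-up′ i st μ≤0 μ′>0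
      ...   | refl , d = reach-s i κ≥0
        (congruent-∣₀ μ κ (lo i) (hi i) (congruent-sym κ μ (reach-congruent κ↝μ)) d)
        (subst (Reach N j κ) (sym (s-involutive i μ)) κ↝μ)

-- Enumeration of the vectors reachable by chains

-- The map `r` recovers from an element the block that contains it, so different blocks are
-- disjoint.
concatMap-unique : (f : A → List B) (r : B → A) → (∀ {a b} → b ∈ f a → r b ≡ a) →
  (∀ a → Unique (f a)) → ∀ {as} → Unique as → Unique (concatMap f as)
concatMap-unique f r retract f! [] = []
concatMap-unique f r retract f! {a ∷ as} as!@(_ ∷ as′!) = Unique.++⁺ (f! a)
  (concatMap-unique f r retract f! as′!) disjoint
  where
  disjoint : ∀ {b} → ¬ (b ∈ f a × b ∈ concatMap f as)
  disjoint (b∈a , b∈as) with find (∈-concatMap⁻ f b∈as)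
  ... | a′ , a′∈as , b∈a′ = Unique[x∷xs]⇒x∉xs as!
    (subst (_∈ as) (trans (sym (retract b∈a′)) (retract b∈a)) a′∈as)

unique-set⇒↭ : {as bs : List A} → Unique as → Unique bs →
  (∀ {a} → a ∈ as → a ∈ bs) → (∀ {a} → a ∈ bs → a ∈ as) → as ↭ bs
unique-set⇒↭ as! bs! to from = ∼bag⇒↭ (unique∧set⇒bag as! bs! (mk⇔ to from))

module _ (N j : ℕ) where

  IsStep : Vec ℕ n → Fin n × Fin n → Set
  IsStep κ (k , l) = k Fin.< l × ascents κ ≡ suc (ascents (transpose k l • κ)) ×
    ℤ.+ N ∣ ℤ.+ j ℤ.* diff κ k l

  isStep? : (κ : Vec ℕ n) (kl : Fin n × Fin n) → Dec (IsStep κ kl)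
  isStep? κ (k , l) = k Fin.<? l ×-dec (ascents κ ℕ.≟ suc (ascents (transpose k l • κ))) ×-dec
    (ℤ.+ N ℤ.∣? ℤ.+ j ℤ.* diff κ k l)

  steps : Vec ℕ n → List (Vec ℕ n)
  steps {n} κ = List.map (λ (k , l) → transpose k l • κ)
    (filter (isStep? κ) (cartesianProduct (allFin n) (allFin n)))

  ∈-steps⁻ : {κ ν : Vec ℕ n} → ν ∈ steps κ → Step N j κ ν
  ∈-steps⁻ {n} {κ} ν∈ with ∈-map⁻ _ ν∈
  ... | (k , l) , kl∈ , refl with ∈-filter⁻ (isStep? κ) {xs = cartesianProduct (allFin n) (allFin n)} kl∈
  ...   | _ , k<l , covers , integral = step (record { a = k ; b = l ; a<b = k<l }) refl covers integral

  ∈-steps⁺ : {κ ν : Vec ℕ n} → Step N j κ ν → ν ∈ steps κ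
  ∈-steps⁺ {n} {κ} (step β refl covers integral) = ∈-map⁺ (λ (k , l) → transpose k l • κ)
    (∈-filter⁺ (isStep? κ) (∈-cartesianProduct⁺ (∈-allFin a) (∈-allFin b)) (a<b , covers , integral))
    where open PositiveRoot β

  -- The fuel is the number of ascents of κ, which every step lowers.
  reachable : ℕ → Vec ℕ n → List (Vec ℕ n)
  reachable zero       κ = []
  reachable (suc fuel) κ = concatMap (λ μ → μ ∷ reachable fuel μ) (steps κ)

  ∈-reachable⁻ : ∀ fuel {κ ν : Vec ℕ n} → ν ∈ reachable fuel κ → TransClosure (Step N j) κ ν
  ∈-reachable⁻ (suc fuel) {κ} ν∈ with find (∈-concatMap⁻ (λ μ → μ ∷ reachable fuel μ) {xs = steps κ} ν∈)
  ... | μ , μ∈ , here refl = [ ∈-steps⁻ μ∈ ]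
  ... | μ , μ∈ , there ν∈′ = ∈-steps⁻ μ∈ ∷ ∈-reachable⁻ fuel ν∈′

  ∈-reachable⁺ : ∀ fuel {κ ν : Vec ℕ n} → ascents κ ≡ fuel → TransClosure (Step N j) κ ν →
    ν ∈ reachable fuel κ
  ∈-reachable⁺ zero eq [ step _ _ covers _ ] = contradiction (trans (sym eq) covers) λ ()
  ∈-reachable⁺ zero eq (step _ _ covers _ ∷ _) = contradiction (trans (sym eq) covers) λ ()
  ∈-reachable⁺ (suc fuel) eq [ st ] = ∈-concatMap⁺ (λ μ → μ ∷ reachable fuel μ)
    (lose (∈-steps⁺ st) (here refl))
  ∈-reachable⁺ (suc fuel) eq (st ∷ sts) = ∈-concatMap⁺ (λ μ → μ ∷ reachable fuel μ)
    (lose (∈-steps⁺ st) (there (∈-reachable⁺ fuel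
      (ℕ.suc-injective (trans (sym (Step.covers st)) eq)) sts)))

  below : Vec ℕ n → List (Vec ℕ n)
  below κ = deduplicate _≟ᵉ_ (reachable (ascents κ) κ)

  ∈-below⁻ : {κ ν : Vec ℕ n} → ν ∈ below κ → TransClosure (Step N j) κ ν
  ∈-below⁻ {κ = κ} ν∈ = ∈-reachable⁻ (ascents κ) (∈-deduplicate⁻ _≟ᵉ_ (reachable (ascents κ) κ) ν∈)

  ∈-below⁺ : {κ ν : Vec ℕ n} → TransClosure (Step N j) κ ν → ν ∈ below κ
  ∈-below⁺ κ↝ν = ∈-deduplicate⁺ _≟ᵉ_ (∈-reachable⁺ _ refl κ↝ν)

  below-unique : (κ : Vec ℕ n) → Unique (below κ)
  below-unique κ = Unique.deduplicate-! _≟ᵉ_ (reachable (ascents κ) κ)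

  ascents-decrease : {κ ν : Vec ℕ n} → TransClosure (Step N j) κ ν → ascents ν ℕ.< ascents κ
  ascents-decrease [ step _ _ covers _ ]      = ℕ.≤-reflexive (sym covers)
  ascents-decrease (step _ _ covers _ ∷ μ↝ν) =
    ℕ.<-trans (ascents-decrease μ↝ν) (ℕ.≤-reflexive (sym covers))

  atOrBelow : Vec ℕ n → List (Vec ℕ n)
  atOrBelow κ = κ ∷ below κ

  private
    Star⇒TransClosure : {κ μ ν : Vec ℕ n} → Step N j κ μ → Reach N j μ ν → TransClosure (Step N j) κ ν
    Star⇒TransClosure st ε        = [ st ]
    Star⇒TransClosure st (r ◅ rs) = st ∷ Star⇒TransClosure r rs

  TransClosure⇒Star : {κ ν : Vec ℕ n} → TransClosure (Step N j) κ ν → Reach N j κ ν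
  TransClosure⇒Star [ st ]     = st ◅ ε
  TransClosure⇒Star (st ∷ sts) = st ◅ TransClosure⇒Star sts

  ∈-atOrBelow⁻ : {κ ν : Vec ℕ n} → ν ∈ atOrBelow κ → Reach N j κ ν
  ∈-atOrBelow⁻ (here refl) = ε
  ∈-atOrBelow⁻ (there ν∈)  = TransClosure⇒Star (∈-below⁻ ν∈)

  ∈-atOrBelow⁺ : {κ ν : Vec ℕ n} → Reach N j κ ν → ν ∈ atOrBelow κ
  ∈-atOrBelow⁺ ε        = here refl
  ∈-atOrBelow⁺ (st ◅ r) = there (∈-below⁺ (Star⇒TransClosure st r))

  atOrBelow-unique : (κ : Vec ℕ n) → Unique (atOrBelow κ)
  atOrBelow-unique κ = All.tabulate (λ { ν∈ refl → ℕ.<-irrefl refl (ascents-decrease (∈-below⁻ {κ = κ} ν∈)) })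
    ∷ below-unique κ

-- For κ_i ≥ κ_{i+1} and 0 ≤ e < N with N ∣ e + j (κ_i − κ_{i+1}), the elements
-- below s_i κ are obtained by replacing each ν below κ by expand i e ν.
expand : Fin (pred n) → ℕ → Vec ℕ n → List (Vec ℕ n)
expand i e ν with ℕ.<-cmp (lookup ν (lo i)) (lookup ν (hi i)) | e
... | tri< _ _ _ | _     = []
... | tri≈ _ _ _ | zero  = ν ∷ []
... | tri≈ _ _ _ | suc _ = []
... | tri> _ _ _ | zero  = ν ∷ s i • ν ∷ []
... | tri> _ _ _ | suc _ = s i • ν ∷ []

contract : Fin (pred n) → Vec ℕ n → Vec ℕ n
contract i ν with lookup ν (lo i) ℕ.<? lookup ν (hi i)
... | yes _ = s i • ν
... | no _  = ν

contract-Neg : (i : Fin (pred n)) (ν : Vec ℕ n) → Neg i ν → contract i ν ≡ s i • ν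
contract-Neg i ν ν<0 with lookup ν (lo i) ℕ.<? lookup ν (hi i)
... | yes _   = refl
... | no ν≮0 = contradiction ν<0 ν≮0

contract-NonNeg : (i : Fin (pred n)) (ν : Vec ℕ n) → NonNeg i ν → contract i ν ≡ ν
contract-NonNeg i ν ν≥0 with lookup ν (lo i) ℕ.<? lookup ν (hi i)
... | yes ν<0 = contradiction ν<0 (ℕ.≤⇒≯ ν≥0)
... | no _    = refl

contract-expand : (i : Fin (pred n)) (e : ℕ) {ν μ : Vec ℕ n} → μ ∈ expand i e ν → contract i μ ≡ ν
contract-expand i e {ν} μ∈ with ℕ.<-cmp (lookup ν (lo i)) (lookup ν (hi i)) | e | μ∈
... | tri≈ _ ν≡0 _ | zero  | here refl = contract-NonNeg i ν (ℕ.≤-reflexive (sym ν≡0))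
... | tri> _ _ ν>0 | zero  | here refl = contract-NonNeg i ν (ℕ.<⇒≤ ν>0)
... | tri> _ _ ν>0 | zero  | there (here refl) = trans (contract-Neg i (s i • ν) (Pos⇒Neg-s i ν ν>0)) (s-involutive i ν)
... | tri> _ _ ν>0 | suc _ | here refl = trans (contract-Neg i (s i • ν) (Pos⇒Neg-s i ν ν>0)) (s-involutive i ν)

expand-unique : (i : Fin (pred n)) (e : ℕ) (ν : Vec ℕ n) → Unique (expand i e ν)
expand-unique i e ν with ℕ.<-cmp (lookup ν (lo i)) (lookup ν (hi i)) | e
... | tri< _ _ _ | _     = []
... | tri≈ _ _ _ | zero  = [] ∷ []
... | tri≈ _ _ _ | suc _ = []
... | tri> _ _ ν>0 | zero = ((λ eq → ℕ.<-asym ν>0 (subst (Neg i) (sym eq) (Pos⇒Neg-s i ν ν>0))) ∷ []) ∷ [] ∷ []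
... | tri> _ _ _ | suc _ = [] ∷ []

∈-expand-Pos : (i : Fin (pred n)) (e : ℕ) (ν : Vec ℕ n) → Pos i ν → s i • ν ∈ expand i e ν
∈-expand-Pos i e ν ν>0 with ℕ.<-cmp (lookup ν (lo i)) (lookup ν (hi i)) | e
... | tri< _ _ ν≯0 | _     = contradiction ν>0 ν≯0
... | tri≈ _ _ ν≯0 | _     = contradiction ν>0 ν≯0
... | tri> _ _ _   | zero  = there (here refl)
... | tri> _ _ _   | suc _ = here refl

∈-expand-NonNeg : (i : Fin (pred n)) (ν : Vec ℕ n) → NonNeg i ν → ν ∈ expand i 0 ν
∈-expand-NonNeg i ν ν≥0 with ℕ.<-cmp (lookup ν (lo i)) (lookup ν (hi i))
... | tri< ν<0 _ _ = contradiction ν<0 (ℕ.≤⇒≯ ν≥0)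
... | tri≈ _ _ _   = here refl
... | tri> _ _ _   = here refl

small-∣ : ∀ {N e} → e ℕ.< N → ℤ.+ N ∣ ℤ.+ e → e ≡ 0
small-∣ {N} {zero}  e<N N∣e = refl
small-∣ {N} {suc e} e<N N∣e = contradiction (ℕ.∣⇒≤ (ℤ.∣⇒∣ᵤ N∣e)) (ℕ.<⇒≱ e<N)

module _ {N j : ℕ} where

  -- By congruence along chains, e = 0 holds exactly when swapping the entries i and i + 1 is
  -- integral at time j / N, at κ and equally at every ν below it. This decides whether ν itself
  -- stays in the list next to `s i • ν`. Neither list has repetitions, the second because
  -- `contract` recovers ν from each element of `expand i e ν`; so mutual inclusion, by the lifting
  -- lemmas, is enough.
  atOrBelow-s : (i : Fin (pred n)) (κ : Vec ℕ n) → NonNeg i κ → (e : ℕ) → e ℕ.< N →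
    ℤ.+ N ∣ ℤ.+ e ℤ.+ ℤ.+ j ℤ.* diff κ (lo i) (hi i) →
    atOrBelow N j (s i • κ) ↭ concatMap (expand i e) (atOrBelow N j κ)
  atOrBelow-s {n} i κ κ≥0 e e<N N∣ = unique-set⇒↭ (atOrBelow-unique N j (s i • κ))
    (concatMap-unique (expand i e) (contract i) (contract-expand i e) (expand-unique i e)
      (atOrBelow-unique N j κ))
    (λ μ∈ → to (∈-atOrBelow⁻ N j μ∈)) from
    where
    κ′ = s i • κ

    e≡0⇒∣ : e ≡ 0 → ℤ.+ N ∣ ℤ.+ j ℤ.* diff κ (lo i) (hi i)
    e≡0⇒∣ refl = subst (ℤ.+ N ∣_) (ℤ.+-identityˡ _) N∣

    ∣⇒e≡0 : ℤ.+ N ∣ ℤ.+ j ℤ.* diff κ (lo i) (hi i) → e ≡ 0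
    ∣⇒e≡0 h = small-∣ e<N (ℤ.∣m+n∣m⇒∣n
      (subst (ℤ.+ N ∣_) (ℤ.+-comm (ℤ.+ e) (ℤ.+ j ℤ.* diff κ (lo i) (hi i))) N∣) h)

    diff≡0 : lookup κ (hi i) ≡ lookup κ (lo i) → ℤ.+ N ∣ ℤ.+ j ℤ.* diff κ (lo i) (hi i)
    diff≡0 eq rewrite eq = congruent-refl {N = N} {j} κ (lo i)

    to-Neg : ∀ {μ} → Reach N j κ′ μ → Neg i μ → Reach N j κ (s i • μ)
    to-Neg {μ} r μ<0 with ℕ.m≤n⇒m<n∨m≡n κ≥0
    ... | inj₁ κ>0 = subst (λ u → Reach N j u (s i • μ)) (s-involutive i κ)
      (reach-Neg i r (Pos⇒Neg-s i κ κ>0) μ<0)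
    ... | inj₂ κ≡0 = κ↝μ ◅◅ (α-step i μ<0
        (congruent-∣₀ {N = N} {j} κ μ (lo i) (hi i) (reach-congruent κ↝μ) (diff≡0 κ≡0)) ◅ ε)
      where
      κ↝μ : Reach N j κ μ
      κ↝μ = subst (λ u → Reach N j u μ) (s-fixes i κ (sym κ≡0)) r

    to-NonNeg : ∀ {μ} → Reach N j κ′ μ → NonNeg i μ → Reach N j κ μ × e ≡ 0
    to-NonNeg {μ} r μ≥0 with ℕ.m≤n⇒m<n∨m≡n κ≥0
    ... | inj₂ κ≡0 = subst (λ u → Reach N j u μ) (s-fixes i κ (sym κ≡0)) r , ∣⇒e≡0 (diff≡0 κ≡0)
    ... | inj₁ κ>0 with reach-up i r (Pos⇒Neg-s i κ κ>0) μ≥0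
    ...   | r′ , d = subst (λ u → Reach N j u μ) (s-involutive i κ) r′ ,
      ∣⇒e≡0 (diff-flip {N = N} {j} κ (hi i) (lo i) (subst (λ z → ℤ.+ N ∣ ℤ.+ j ℤ.* z) (diff-s i κ) d))

    to : ∀ {μ} → Reach N j κ′ μ → μ ∈ concatMap (expand i e) (atOrBelow N j κ)
    to {μ} r with ℕ.≤-<-connex (lookup μ (hi i)) (lookup μ (lo i))
    ... | inj₂ μ<0 = ∈-concatMap⁺ (expand i e) (lose (∈-atOrBelow⁺ N j (to-Neg r μ<0))
      (subst (_∈ expand i e (s i • μ)) (s-involutive i μ) (∈-expand-Pos i e (s i • μ) (Neg⇒Pos-s i μ μ<0))))
    ... | inj₁ μ≥0 with to-NonNeg r μ≥0
    ...   | r′ , refl = ∈-concatMap⁺ (expand i e) (lose (∈-atOrBelow⁺ N j r′) (∈-expand-NonNeg i μ μ≥0))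

    from′ : ∀ e′ → e ≡ e′ → ∀ {μ ν} → Reach N j κ ν → μ ∈ expand i e′ ν → Reach N j κ′ μ
    from′ e′ eq {μ} {ν} r μ∈ with ℕ.<-cmp (lookup ν (lo i)) (lookup ν (hi i)) | e′ | μ∈
    ... | tri≈ _ _ _   | zero  | here refl         = reach-s i κ≥0 (e≡0⇒∣ eq) r
    ... | tri> _ _ _   | zero  | here refl         = reach-s i κ≥0 (e≡0⇒∣ eq) r
    ... | tri> _ _ ν>0 | zero  | there (here refl) = reach-Pos i κ≥0 ν>0 r
    ... | tri> _ _ ν>0 | suc _ | here refl         = reach-Pos i κ≥0 ν>0 r

    from : ∀ {μ} → μ ∈ concatMap (expand i e) (atOrBelow N j κ) → μ ∈ atOrBelow N j κ′
    from μ∈ with find (∈-concatMap⁻ (expand i e) {xs = atOrBelow N j κ} μ∈)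
    ... | ν , ν∈ , μ∈ν = ∈-atOrBelow⁺ N j (from′ e refl (∈-atOrBelow⁻ N j ν∈) μ∈ν)

-- Demazure operators on coefficient functions

-- The coefficients of a Laurent polynomial
Coeffs : ℕ → Set
Coeffs n = Vec ℤ n → ℤ

infixl 6 _⊟_
_⊟_ : Vec ℤ n → Vec ℕ n → Vec ℤ n
γ ⊟ ν = tabulate λ c → lookup γ c ℤ.- ℤ.+ lookup ν c

lookup-⊟ : (γ : Vec ℤ n) (ν : Vec ℕ n) (c : Fin n) → lookup (γ ⊟ ν) c ≡ lookup γ c ℤ.- ℤ.+ lookup ν c
lookup-⊟ γ ν = lookup∘tabulate _

s-⊟ : (i : Fin (pred n)) (γ : Vec ℤ n) (ν : Vec ℕ n) → s i • (γ ⊟ ν) ≡ (s i • γ) ⊟ (s i • ν)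
s-⊟ i γ ν = lookup-ext λ c → trans (lookup-• (s i) (γ ⊟ ν) c) (trans (lookup-⊟ γ ν _) (sym (trans
  (lookup-⊟ (s i • γ) (s i • ν) c)
  (cong₂ (λ p q → p ℤ.- ℤ.+ q) (lookup-• (s i) γ c) (lookup-• (s i) ν c)))))

simpleRoot : Fin (pred n) → Fin n → ℤ
simpleRoot i c = if does (c Fin.≟ lo i) then 1ℤ else if does (c Fin.≟ hi i) then ℤ.- 1ℤ else 0ℤ

simpleRoot-lo : (i : Fin (pred n)) → simpleRoot {n} i (lo i) ≡ 1ℤ
simpleRoot-lo {n} i rewrite dec-true (lo {n} i Fin.≟ lo i) refl = refl

simpleRoot-hi : (i : Fin (pred n)) → simpleRoot {n} i (hi i) ≡ ℤ.- 1ℤ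
simpleRoot-hi {n} i rewrite dec-false (hi {n} i Fin.≟ lo i) (≢-sym (Quotient.lo≢hi {n} i))
  | dec-true (hi {n} i Fin.≟ hi i) refl = refl

simpleRoot-other : (i : Fin (pred n)) (c : Fin n) → c ≢ lo i → c ≢ hi i → simpleRoot i c ≡ 0ℤ
simpleRoot-other i c c≢lo c≢hi rewrite dec-false (c Fin.≟ lo i) c≢lo | dec-false (c Fin.≟ hi i) c≢hi = refl

-- γ + k α_i
shift : Fin (pred n) → ℤ → Vec ℤ n → Vec ℤ n
shift i k γ = tabulate λ c → lookup γ c ℤ.+ k ℤ.* simpleRoot i c

lookup-shift : (i : Fin (pred n)) (k : ℤ) (γ : Vec ℤ n) (c : Fin n) →
  lookup (shift i k γ) c ≡ lookup γ c ℤ.+ k ℤ.* simpleRoot i c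
lookup-shift i k γ = lookup∘tabulate _

lookup-shift-lo : (i : Fin (pred n)) (k : ℤ) (γ : Vec ℤ n) →
  lookup (shift i k γ) (lo i) ≡ lookup γ (lo i) ℤ.+ k
lookup-shift-lo {n} i k γ = trans (lookup-shift i k γ (lo i))
  (cong (λ z → lookup γ (lo i) ℤ.+ z) (trans (cong (λ z → k ℤ.* z) (simpleRoot-lo {n} i)) (ℤ.*-identityʳ k)))

shift-shift : (i : Fin (pred n)) (k l : ℤ) (γ : Vec ℤ n) → shift i k (shift i l γ) ≡ shift i (k ℤ.+ l) γ
shift-shift i k l γ = lookup-ext λ c → trans (lookup-shift i k (shift i l γ) c) (trans
  (cong (λ z → z ℤ.+ k ℤ.* simpleRoot i c) (lookup-shift i l γ c)) (trans
  (lemma (lookup γ c) k l (simpleRoot i c)) (sym (lookup-shift i (k ℤ.+ l) γ c))))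
  where
  lemma : ∀ g k l a → (g ℤ.+ l ℤ.* a) ℤ.+ k ℤ.* a ≡ g ℤ.+ (k ℤ.+ l) ℤ.* a
  lemma = ℤ-Solver.solve-∀

shift-0 : (i : Fin (pred n)) (γ : Vec ℤ n) → shift i 0ℤ γ ≡ γ
shift-0 i γ = lookup-ext λ c → trans (lookup-shift i 0ℤ γ c) (lemma (lookup γ c) (simpleRoot i c))
  where
  lemma : ∀ g a → g ℤ.+ 0ℤ ℤ.* a ≡ g
  lemma = ℤ-Solver.solve-∀

shift-⊟ : (i : Fin (pred n)) (k : ℤ) (γ : Vec ℤ n) (ν : Vec ℕ n) → shift i k (γ ⊟ ν) ≡ shift i k γ ⊟ ν
shift-⊟ i k γ ν = lookup-ext λ c → trans (lookup-shift i k (γ ⊟ ν) c) (trans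
  (cong (λ z → z ℤ.+ k ℤ.* simpleRoot i c) (lookup-⊟ γ ν c)) (trans
  (lemma (lookup γ c) (ℤ.+ lookup ν c) k (simpleRoot i c)) (sym (trans (lookup-⊟ (shift i k γ) ν c)
  (cong (λ z → z ℤ.- ℤ.+ lookup ν c) (lookup-shift i k γ c))))))
  where
  lemma : ∀ g v k a → (g ℤ.- v) ℤ.+ k ℤ.* a ≡ (g ℤ.+ k ℤ.* a) ℤ.- v
  lemma = ℤ-Solver.solve-∀

simpleRoot-s : (i : Fin (pred n)) (c : Fin n) → simpleRoot i (s i ⟨$⟩ˡ c) ≡ ℤ.- simpleRoot i c
simpleRoot-s {n} i c = by (c Fin.≟ lo i) (c Fin.≟ hi i)
  where
  by : Dec (c ≡ lo i) → Dec (c ≡ hi i) → simpleRoot i (PC.transpose (hi i) (lo i) c) ≡ ℤ.- simpleRoot i c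
  by (yes refl) _ = trans (cong (simpleRoot {n} i) (transpose-second (hi i) (lo i)))
    (trans (simpleRoot-hi {n} i) (cong ℤ.-_ (sym (simpleRoot-lo {n} i))))
  by (no _) (yes refl) = trans (cong (simpleRoot {n} i) (transpose-first (hi i) (lo i)))
    (trans (simpleRoot-lo {n} i) (cong ℤ.-_ (sym (simpleRoot-hi {n} i))))
  by (no c≢lo) (no c≢hi) = trans (cong (simpleRoot i) (transpose-other (hi i) (lo i) c c≢hi c≢lo))
    (trans (simpleRoot-other i c c≢lo c≢hi) (cong ℤ.-_ (sym (simpleRoot-other i c c≢lo c≢hi))))

s-shift : (i : Fin (pred n)) (k : ℤ) (γ : Vec ℤ n) → s i • shift i k γ ≡ shift i (ℤ.- k) (s i • γ)
s-shift i k γ = lookup-ext λ c → trans (lookup-• (s i) (shift i k γ) c) (trans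
  (lookup-shift i k γ (s i ⟨$⟩ˡ c)) (trans
  (cong (λ a → lookup γ (s i ⟨$⟩ˡ c) ℤ.+ k ℤ.* a) (simpleRoot-s i c)) (trans
  (lemma (lookup γ (s i ⟨$⟩ˡ c)) k (simpleRoot i c)) (sym (trans
  (lookup-shift i (ℤ.- k) (s i • γ) c)
  (cong (λ z → z ℤ.+ ℤ.- k ℤ.* simpleRoot i c) (lookup-• (s i) γ c)))))))
  where
  lemma : ∀ g k a → g ℤ.+ k ℤ.* (ℤ.- a) ≡ g ℤ.+ ℤ.- k ℤ.* a
  lemma = ℤ-Solver.solve-∀

-- The reflection formula s_i ν = ν - (ν_i - ν_{i+1}) α_i.
⊟-s : (i : Fin (pred n)) (γ : Vec ℤ n) (ν : Vec ℕ n) →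
  γ ⊟ (s i • ν) ≡ shift i (diff ν (lo i) (hi i)) (γ ⊟ ν)
⊟-s {n} i γ ν = lookup-ext λ c → trans (lookup-⊟ γ (s i • ν) c) (sym (trans
  (lookup-shift i d (γ ⊟ ν) c) (trans (cong (λ z → z ℤ.+ d ℤ.* simpleRoot i c) (lookup-⊟ γ ν c)) (go c))))
  where
  d = diff ν (lo i) (hi i)
  at-lo : ∀ g p q → (g ℤ.- p) ℤ.+ (p ℤ.- q) ℤ.* 1ℤ ≡ g ℤ.- q
  at-lo = ℤ-Solver.solve-∀
  at-hi : ∀ g p q → (g ℤ.- q) ℤ.+ (p ℤ.- q) ℤ.* (ℤ.- 1ℤ) ≡ g ℤ.- p
  at-hi = ℤ-Solver.solve-∀
  away : ∀ z d → z ℤ.+ d ℤ.* 0ℤ ≡ z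
  away = ℤ-Solver.solve-∀
  go : ∀ c → (lookup γ c ℤ.- ℤ.+ lookup ν c) ℤ.+ d ℤ.* simpleRoot i c ≡ lookup γ c ℤ.- ℤ.+ lookup (s i • ν) c
  go c = by (c Fin.≟ lo i) (c Fin.≟ hi i)
    where
    by : Dec (c ≡ lo i) → Dec (c ≡ hi i) →
      (lookup γ c ℤ.- ℤ.+ lookup ν c) ℤ.+ d ℤ.* simpleRoot i c ≡ lookup γ c ℤ.- ℤ.+ lookup (s i • ν) c
    by (yes refl) _ = trans
      (cong (λ a → (lookup γ (lo i) ℤ.- ℤ.+ lookup ν (lo i)) ℤ.+ d ℤ.* a) (simpleRoot-lo {n} i))
      (trans (at-lo (lookup γ (lo i)) (ℤ.+ lookup ν (lo i)) (ℤ.+ lookup ν (hi i)))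
        (cong (λ a → lookup γ (lo i) ℤ.- ℤ.+ a) (sym (lookup-s-lo i ν))))
    by (no _) (yes refl) = trans
      (cong (λ a → (lookup γ (hi i) ℤ.- ℤ.+ lookup ν (hi i)) ℤ.+ d ℤ.* a) (simpleRoot-hi {n} i))
      (trans (at-hi (lookup γ (hi i)) (ℤ.+ lookup ν (lo i)) (ℤ.+ lookup ν (hi i)))
        (cong (λ a → lookup γ (hi i) ℤ.- ℤ.+ a) (sym (lookup-s-hi i ν))))
    by (no c≢lo) (no c≢hi) = trans
      (cong (λ a → (lookup γ c ℤ.- ℤ.+ lookup ν c) ℤ.+ d ℤ.* a) (simpleRoot-other i c c≢lo c≢hi))
      (trans (away (lookup γ c ℤ.- ℤ.+ lookup ν c) d)
        (cong (λ a → lookup γ c ℤ.- ℤ.+ a) (sym (lookup-transpose-other (lo i) (hi i) ν c c≢lo c≢hi))))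

-- On unrestricted coefficient functions, multiplication by x_i^N - x_{i+1}^N is not injective:
-- functions periodic under N α_i are killed. This condition excludes the nonzero ones.
Vanishes : Coeffs n → Set
Vanishes f = ∀ γ c → lookup γ c ℤ.< 0ℤ → f γ ≡ 0ℤ

module _ (N : ℕ) (i : Fin (pred n)) where

  -- The coefficientwise form of the identity
  --   (x_i^N − x_{i+1}^N) g = x_i^{N−e} x_{i+1}^e f − x_{i+1}^N s_i f
  -- divided by x_{i+1}^N. For N = 1 it says g = π_i f if e = 0 and g = π̄_i f
  -- if e = 1. In general it is π_i in the variables x_i^N, multiplied from both
  -- sides by (x_{i+1} / x_i)^{e/2}.
  Demazure : ℤ → Coeffs n → Coeffs n → Set
  Demazure e f g = ∀ γ → g (shift i (ℤ.- ℤ.+ N) γ) ℤ.- g γ ≡ f (shift i (e ℤ.- ℤ.+ N) γ) ℤ.- f (s i • γ)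

  private
    M : ℤ
    M = ℤ.+ N

  demazure-cong : ∀ {e f f′ g g′} → f ≗ f′ → g ≗ g′ → Demazure e f g → Demazure e f′ g′
  demazure-cong f≗ g≗ rel γ = trans (sym (cong₂ ℤ._-_ (g≗ _) (g≗ _)))
    (trans (rel γ) (cong₂ ℤ._-_ (f≗ _) (f≗ _)))

  demazure-zero : ∀ e → Demazure e (λ _ → 0ℤ) (λ _ → 0ℤ)
  demazure-zero e γ = refl

  demazure-+ : ∀ {e f g f′ g′} → Demazure e f g → Demazure e f′ g′ →
    Demazure e (λ γ → f γ ℤ.+ f′ γ) (λ γ → g γ ℤ.+ g′ γ)
  demazure-+ {f = f} {g} {f′} {g′} r r′ γ = trans
    (regroup (g _) (g′ _) (g γ) (g′ γ)) (trans (cong₂ ℤ._+_ (r γ) (r′ γ)) (sym (regroup (f _) (f′ _) (f _) (f′ _))))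
    where
    regroup : ∀ a b c d → (a ℤ.+ b) ℤ.- (c ℤ.+ d) ≡ (a ℤ.- c) ℤ.+ (b ℤ.- d)
    regroup = ℤ-Solver.solve-∀

  -- Here f is multiplied by x^κ and g by its image under s_i. The term with s_i f is thereby
  -- multiplied by the same monomial as g, and the other term differs from it by d α_i, which goes
  -- into the twist.
  demazure-⊟ : ∀ {e f g} (κ : Vec ℕ n) → Demazure e f g →
    Demazure (e ℤ.+ diff κ (lo i) (hi i)) (λ γ → f (γ ⊟ κ)) (λ γ → g (γ ⊟ (s i • κ)))
  demazure-⊟ {e} {f} {g} κ rel γ = trans
    (cong (λ δ → g δ ℤ.- g γ′) (sym (shift-⊟ i (ℤ.- M) γ (s i • κ))))
    (trans (rel γ′) (cong₂ (λ δ δ′ → f δ ℤ.- f δ′) first second))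
    where
    d  = diff κ (lo i) (hi i)
    γ′ = γ ⊟ (s i • κ)
    lemma : ∀ e M d → (e ℤ.- M) ℤ.+ d ≡ e ℤ.+ d ℤ.- M
    lemma = ℤ-Solver.solve-∀
    first : shift i (e ℤ.- M) γ′ ≡ shift i (e ℤ.+ d ℤ.- M) γ ⊟ κ
    first = trans (cong (shift i (e ℤ.- M)) (⊟-s i γ κ)) (trans (shift-shift i (e ℤ.- M) d (γ ⊟ κ))
      (trans (cong (λ k → shift i k (γ ⊟ κ)) (lemma e M d)) (shift-⊟ i (e ℤ.+ d ℤ.- M) γ κ)))
    second : s i • γ′ ≡ (s i • γ) ⊟ κ
    second = trans (s-⊟ i γ (s i • κ)) (cong ((s i • γ) ⊟_) (s-involutive i κ))

  -- π̄ + 1 = π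
  demazure-N⇒0 : ∀ {f g} → Demazure M f g → Demazure 0ℤ f (λ γ → f γ ℤ.+ g γ)
  demazure-N⇒0 {f} {g} rel γ = trans (regroup (f γ⁻) (g γ⁻) (f γ) (g γ)) (trans
    (cong (λ z → (f γ⁻ ℤ.- f γ) ℤ.+ z) (trans (rel γ) (cong (λ δ → f δ ℤ.- f (s i • γ)) fixed)))
    (trans (telescope (f γ⁻) (f γ) (f (s i • γ))) (cong (λ k → f (shift i k γ) ℤ.- f (s i • γ)) (sym (ℤ.+-identityˡ (ℤ.- M))))))
    where
    γ⁻ = shift i (ℤ.- M) γ
    regroup : ∀ a b c d → (a ℤ.+ b) ℤ.- (c ℤ.+ d) ≡ (a ℤ.- c) ℤ.+ (b ℤ.- d)
    regroup = ℤ-Solver.solve-∀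
    telescope : ∀ a b c → (a ℤ.- b) ℤ.+ (b ℤ.- c) ≡ a ℤ.- c
    telescope = ℤ-Solver.solve-∀
    fixed : shift i (M ℤ.- M) γ ≡ γ
    fixed = trans (cong (λ k → shift i k γ) (ℤ.+-inverseʳ M)) (shift-0 i γ)

  demazure-0⇒N : ∀ {f g} → Demazure 0ℤ f g → Demazure M f (λ γ → g γ ℤ.- f γ)
  demazure-0⇒N {f} {g} rel γ = trans (regroup (g γ⁻) (f γ⁻) (g γ) (f γ)) (trans
    (cong (λ z → z ℤ.- (f γ⁻ ℤ.- f γ)) (trans (rel γ) (cong (λ k → f (shift i k γ) ℤ.- f (s i • γ)) (ℤ.+-identityˡ (ℤ.- M)))))
    (trans (telescope (f γ⁻) (f γ) (f (s i • γ))) (cong (λ δ → f δ ℤ.- f (s i • γ)) (sym fixed))))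
    where
    γ⁻ = shift i (ℤ.- M) γ
    regroup : ∀ a b c d → (a ℤ.- b) ℤ.- (c ℤ.- d) ≡ (a ℤ.- c) ℤ.- (b ℤ.- d)
    regroup = ℤ-Solver.solve-∀
    telescope : ∀ a b c → (a ℤ.- c) ℤ.- (a ℤ.- b) ≡ b ℤ.- c
    telescope = ℤ-Solver.solve-∀
    fixed : shift i (M ℤ.- M) γ ≡ γ
    fixed = trans (cong (λ k → shift i k γ) (ℤ.+-inverseʳ M)) (shift-0 i γ)

  private
    VanishesLo : Coeffs n → Set
    VanishesLo u = ∀ γ → lookup γ (lo i) ℤ.< 0ℤ → u γ ≡ 0ℤ

  -- Injectivity of multiplication by x_i^N − x_{i+1}^N
  periodic⇒0 : 0 ℕ.< N → {u : Coeffs n} → (∀ γ → u (shift i (ℤ.- M) γ) ≡ u γ) → VanishesLo u → ∀ γ → u γ ≡ 0ℤ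
  periodic⇒0 N>0 {u} periodic vanishes γ = trans (sym (iterate K γ)) (vanishes _ (subst (ℤ._< 0ℤ)
    (sym (lookup-shift-lo i (ℤ.- ℤ.+ (K ℕ.* N)) γ)) negative))
    where
    -- Subtracting K N α_i makes entry i negative, because K N ≥ K > |γ_i|.
    K = suc ℤ.∣ lookup γ (lo i) ∣
    iterate : ∀ K γ → u (shift i (ℤ.- ℤ.+ (K ℕ.* N)) γ) ≡ u γ
    iterate zero    γ = cong u (shift-0 i γ)
    iterate (suc K) γ = trans (cong u (trans
      (cong (λ k → shift i k γ) (trans (cong ℤ.-_ (ℤ.pos-+ N (K ℕ.* N))) (ℤ.neg-distrib-+ M (ℤ.+ (K ℕ.* N)))))
      (sym (shift-shift i (ℤ.- M) (ℤ.- ℤ.+ (K ℕ.* N)) γ))))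
      (trans (periodic _) (iterate K γ))
    i≤∣i∣ : ∀ z → z ℤ.≤ ℤ.+ ℤ.∣ z ∣
    i≤∣i∣ (ℤ.+ _)      = ℤ.≤-refl
    i≤∣i∣ ℤ.-[1+ _ ] = ℤ.-≤+
    negative : lookup γ (lo i) ℤ.- ℤ.+ (K ℕ.* N) ℤ.< 0ℤ
    negative = subst (lookup γ (lo i) ℤ.- ℤ.+ (K ℕ.* N) ℤ.<_) (ℤ.+-inverseʳ (ℤ.+ (K ℕ.* N)))
      (ℤ.+-monoˡ-< (ℤ.- ℤ.+ (K ℕ.* N)) (ℤ.≤-<-trans (i≤∣i∣ (lookup γ (lo i)))
        (ℤ.+<+ (ℕ.<-≤-trans (ℕ.n<1+n _) (ℕ.≤-trans (ℕ.≤-reflexive (sym (ℕ.*-identityʳ K))) (ℕ.*-monoʳ-≤ K N>0))))))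

  demazure-unique : 0 ℕ.< N → ∀ {e f g h} → Vanishes g → Vanishes h →
    Demazure e f g → Demazure e f h → g ≗ h
  demazure-unique N>0 {e} {f} {g} {h} g-vanishes h-vanishes rg rh γ = ℤ.i-j≡0⇒i≡j (g γ) (h γ)
    (periodic⇒0 N>0 {λ δ → g δ ℤ.- h δ} periodic
      (λ δ δ<0 → cong₂ ℤ._-_ (g-vanishes δ (lo i) δ<0) (h-vanishes δ (lo i) δ<0)) γ)
    where
    swap : ∀ a b c d → a ℤ.- c ≡ b ℤ.- d → a ℤ.- b ≡ c ℤ.- d
    swap a b c d eq = trans (lemma₁ a b c) (trans (cong (λ z → z ℤ.+ (c ℤ.- b)) eq) (lemma₂ b c d))
      where
      lemma₁ : ∀ a b c → a ℤ.- b ≡ (a ℤ.- c) ℤ.+ (c ℤ.- b)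
      lemma₁ = ℤ-Solver.solve-∀
      lemma₂ : ∀ b c d → (b ℤ.- d) ℤ.+ (c ℤ.- b) ≡ c ℤ.- d
      lemma₂ = ℤ-Solver.solve-∀
    periodic : ∀ γ → g (shift i (ℤ.- M) γ) ℤ.- h (shift i (ℤ.- M) γ) ≡ g γ ℤ.- h γ
    periodic γ = swap (g (shift i (ℤ.- M) γ)) (h (shift i (ℤ.- M) γ)) (g γ) (h γ) (trans (rg γ) (sym (rh γ)))

  -- This is x^(e α_i) g = s_i g, which for e = 0 is the symmetry of π_i f. The relation at γ - e
  -- α_i and the relation at s_i γ + N α_i evaluate f at the same two points with opposite signs. So
  -- the difference of the two sides is periodic under N α_i, and `periodic⇒0` applies.
  demazure-symmetric : 0 ℕ.< N → ∀ {e f g} → Vanishes g → Demazure (ℤ.+ e) f g →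
    ∀ γ → g (shift i (ℤ.- ℤ.+ e) γ) ≡ g (s i • γ)
  demazure-symmetric N>0 {e} {f} {g} vanishes rel γ = ℤ.i-j≡0⇒i≡j _ _ (periodic⇒0 N>0 {u} periodic u-vanishes γ)
    where
    E = ℤ.+ e
    u : Coeffs n
    u γ = g (shift i (ℤ.- E) γ) ℤ.- g (s i • γ)
    u-vanishes : VanishesLo u
    u-vanishes γ γ<0 = cong₂ ℤ._-_
      (vanishes _ (lo i) (subst (ℤ._< 0ℤ) (sym (lookup-shift-lo i (ℤ.- E) γ))
        (ℤ.≤-<-trans (subst (lookup γ (lo i) ℤ.+ ℤ.- E ℤ.≤_) (ℤ.+-identityʳ _)
          (ℤ.+-monoʳ-≤ (lookup γ (lo i)) (ℤ.neg-mono-≤ (ℤ.+≤+ ℕ.z≤n)))) γ<0)))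
      (vanishes _ (hi i) (subst (ℤ._< 0ℤ) (sym (lookup-s-hi i γ)) γ<0))
    periodic : ∀ γ → u (shift i (ℤ.- M) γ) ≡ u γ
    periodic γ = ℤ.i-j≡0⇒i≡j _ _ (trans (regroup (g _) (g _) (g _) (g _)) (trans
      (cong₂ ℤ._-_ first second) (cancel (f (shift i (ℤ.- M) γ)) (f (shift i E (s i • γ))))))
      where
      regroup : ∀ a b c d → (a ℤ.- b) ℤ.- (c ℤ.- d) ≡ (a ℤ.- c) ℤ.- (b ℤ.- d)
      regroup = ℤ-Solver.solve-∀
      cancel : ∀ a b → (a ℤ.- b) ℤ.- (a ℤ.- b) ≡ 0ℤ
      cancel = ℤ-Solver.solve-∀
      swap : ∀ a b → a ℤ.- b ≡ ℤ.- (b ℤ.- a)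
      swap = ℤ-Solver.solve-∀
      sum₁ : ∀ e m → (e ℤ.- m) ℤ.+ (ℤ.- e) ≡ ℤ.- m
      sum₁ = ℤ-Solver.solve-∀
      sum₂ : ∀ e m → (e ℤ.- m) ℤ.+ m ≡ e
      sum₂ = ℤ-Solver.solve-∀
      sγ = s i • γ
      γ′ = shift i (ℤ.- E) γ
      commute : shift i (ℤ.- E) (shift i (ℤ.- M) γ) ≡ shift i (ℤ.- M) γ′
      commute = trans (shift-shift i (ℤ.- E) (ℤ.- M) γ) (trans
        (cong (λ k → shift i k γ) (ℤ.+-comm (ℤ.- E) (ℤ.- M))) (sym (shift-shift i (ℤ.- M) (ℤ.- E) γ)))
      first : g (shift i (ℤ.- E) (shift i (ℤ.- M) γ)) ℤ.- g γ′ ≡ f (shift i (ℤ.- M) γ) ℤ.- f (shift i E sγ)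
      first = trans (cong (λ δ → g δ ℤ.- g γ′) commute) (trans (rel γ′) (cong₂ (λ δ δ′ → f δ ℤ.- f δ′)
        (trans (shift-shift i (E ℤ.- M) (ℤ.- E) γ) (cong (λ k → shift i k γ) (sum₁ E M)))
        (trans (s-shift i (ℤ.- E) γ) (cong (λ k → shift i k sγ) (ℤ.neg-involutive E)))))
      γ″ = shift i M sγ
      second : g (s i • shift i (ℤ.- M) γ) ℤ.- g sγ ≡ f (shift i (ℤ.- M) γ) ℤ.- f (shift i E sγ)
      second = trans (cong₂ (λ δ δ′ → g δ ℤ.- g δ′)
          (trans (s-shift i (ℤ.- M) γ) (cong (λ k → shift i k sγ) (ℤ.neg-involutive M)))
          (sym (trans (shift-shift i (ℤ.- M) M sγ)
            (trans (cong (λ k → shift i k sγ) (ℤ.+-inverseˡ M)) (shift-0 i sγ)))))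
        (trans (swap (g γ″) (g (shift i (ℤ.- M) γ″))) (trans (cong ℤ.-_ (rel γ″)) (trans
          (sym (swap (f (s i • γ″)) (f (shift i (E ℤ.- M) γ″)))) (cong₂ (λ δ δ′ → f δ ℤ.- f δ′)
            (trans (s-shift i M sγ) (cong (shift i (ℤ.- M)) (s-involutive i γ)))
            (trans (shift-shift i (E ℤ.- M) M sγ) (cong (λ k → shift i k sγ) (sum₂ E M)))))))

  -- With 0 as the image, the relation of twist N - e is exactly the symmetry above.
  demazure-image : 0 ℕ.< N → ∀ {e e′ f g} → Vanishes g → Demazure (ℤ.+ e) f g →
    e′ ≡ M ℤ.- ℤ.+ e → Demazure e′ g (λ _ → 0ℤ)
  demazure-image N>0 {e} {f = f} {g} vanishes rel refl γ = sym (trans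
    (cong (λ k → g (shift i k γ) ℤ.- g (s i • γ)) (lemma M (ℤ.+ e)))
    (ℤ.i≡j⇒i-j≡0 (demazure-symmetric N>0 {e} {f} vanishes rel γ)))
    where
    lemma : ∀ m e → (m ℤ.- e) ℤ.- m ≡ ℤ.- e
    lemma = ℤ-Solver.solve-∀

-- Generating functions of continuations

total : (A → ℤ) → List A → ℤ
total f = foldr (λ a z → f a ℤ.+ z) 0ℤ

total-cong : {f g : A → ℤ} (as : List A) → (∀ {a} → a ∈ as → f a ≡ g a) → total f as ≡ total g as
total-cong []       h = refl
total-cong (a ∷ as) h = cong₂ ℤ._+_ (h (here refl)) (total-cong as (h ∘ there))

total-0 : {f : A → ℤ} (as : List A) → (∀ a → f a ≡ 0ℤ) → total f as ≡ 0ℤ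
total-0 []       h = refl
total-0 (a ∷ as) h = cong₂ ℤ._+_ (h a) (total-0 as h)

total-++ : (f : A → ℤ) (as bs : List A) → total f (as ++ bs) ≡ total f as ℤ.+ total f bs
total-++ f []       bs = sym (ℤ.+-identityˡ _)
total-++ f (a ∷ as) bs = trans (cong (λ z → f a ℤ.+ z) (total-++ f as bs)) (sym (ℤ.+-assoc (f a) _ _))

total-concatMap : (f : B → ℤ) (g : A → List B) (as : List A) →
  total f (concatMap g as) ≡ total (λ a → total f (g a)) as
total-concatMap f g []       = refl
total-concatMap f g (a ∷ as) = trans (total-++ f (g a) (concatMap g as))
  (cong (λ z → total f (g a) ℤ.+ z) (total-concatMap f g as))

total-↭ : (f : A → ℤ) {as bs : List A} → as ↭ bs → total f as ≡ total f bs
total-↭ f ↭.refl          = refl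
total-↭ f (↭.prep a p)    = cong (λ z → f a ℤ.+ z) (total-↭ f p)
total-↭ f (↭.swap a b p) = trans (cong (λ z → f a ℤ.+ (f b ℤ.+ z)) (total-↭ f p)) (comm (f a) (f b) _)
  where
  comm : ∀ p q r → p ℤ.+ (q ℤ.+ r) ≡ q ℤ.+ (p ℤ.+ r)
  comm = ℤ-Solver.solve-∀
total-↭ f (↭.trans p q)   = trans (total-↭ f p) (total-↭ f q)

demazure-total : (N : ℕ) (i : Fin (pred n)) {e : ℤ} {F G : A → Coeffs n} (as : List A) →
  (∀ {a} → a ∈ as → Demazure N i e (F a) (G a)) →
  Demazure N i e (λ γ → total (λ a → F a γ) as) (λ γ → total (λ a → G a γ) as)
demazure-total N i {e} []       rel = demazure-zero N i e
demazure-total N i {e} {F} {G} (a ∷ as) rel =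
  demazure-+ N i {e} {F a} {G a} {λ γ → total (λ b → F b γ) as} {λ γ → total (λ b → G b γ) as}
    (rel (here refl)) (demazure-total N i {e} {F} {G} as (rel ∘ there))

embed : Exponent n → Vec ℤ n
embed = Vec.map (ℤ.+_)

_≟ᶻ_ : (β γ : Vec ℤ n) → Dec (β ≡ γ)
_≟ᶻ_ = ≡-dec ℤ._≟_

monomial : Exponent n → Coeffs n
monomial α γ = if does (embed α ≟ᶻ γ) then 1ℤ else 0ℤ

monomial-vanishes : (α : Exponent n) → Vanishes (monomial α)
monomial-vanishes α γ c γ<0 rewrite dec-false (embed α ≟ᶻ γ)
  (λ { refl → ℤ.<⇒≱ γ<0 (subst (0ℤ ℤ.≤_) (sym (lookup-map c (ℤ.+_) α)) (ℤ.+≤+ ℕ.z≤n)) }) = refl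

𝟘 : Exponent n
𝟘 {n} = replicate n 0

embed-• : (σ : Perm n) (α : Exponent n) → σ • embed α ≡ embed (σ • α)
embed-• σ α = lookup-ext λ c → trans (lookup-• σ (embed α) c) (trans (lookup-map _ (ℤ.+_) α)
  (sym (trans (lookup-map c (ℤ.+_) (σ • α)) (cong (ℤ.+_) (lookup-• σ α c)))))

monomial-s : (i : Fin (pred n)) (α : Exponent n) (γ : Vec ℤ n) →
  monomial (s i • α) (s i • γ) ≡ monomial α γ
monomial-s i α γ = cong (λ b → if b then 1ℤ else 0ℤ) (does-⇔ (mk⇔
  (λ eq → trans (sym (s-involutive i (embed α)))
    (trans (cong (s i •_) (trans (embed-• (s i) α) eq)) (s-involutive i γ)))
  (λ eq → trans (sym (embed-• (s i) α)) (cong (s i •_) eq)))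
  (embed (s i • α) ≟ᶻ (s i • γ)) (embed α ≟ᶻ γ))

-- The generating function of the continuations of a path that has run until
-- time j / N, arriving with direction κ, where j + k = N. All exponents are
-- scaled by N, and only the part of the weight after time j / N is counted.
gen : (N k j : ℕ) → Vec ℕ n → Coeffs n
gen N zero    j κ   = monomial 𝟘
gen N (suc k) j κ γ = total (λ ν → gen N k (suc j) ν (γ ⊟ ν)) (atOrBelow N j κ)

-- The same, restricted to continuations with direction exactly ν immediately
-- after time j / N.
genFrom : (N k j : ℕ) → Vec ℕ n → Coeffs n
genFrom N k j ν γ = gen N k (suc j) ν (γ ⊟ ν)

⊟-vanishes : (ν : Vec ℕ n) {f : Coeffs n} → Vanishes f → Vanishes (λ γ → f (γ ⊟ ν))
⊟-vanishes ν f-vanishes γ c γ<0 = f-vanishes (γ ⊟ ν) c (subst (ℤ._< 0ℤ) (sym (lookup-⊟ γ ν c))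
  (ℤ.≤-<-trans (subst (lookup γ c ℤ.- ℤ.+ lookup ν c ℤ.≤_) (ℤ.+-identityʳ _)
    (ℤ.+-monoʳ-≤ (lookup γ c) (ℤ.neg-mono-≤ (ℤ.+≤+ ℕ.z≤n)))) γ<0))

gen-vanishes : (N k j : ℕ) (κ : Vec ℕ n) → Vanishes (gen N k j κ)
gen-vanishes N zero    j κ = monomial-vanishes 𝟘
gen-vanishes N (suc k) j κ γ c γ<0 = total-0 (atOrBelow N j κ) λ ν →
  ⊟-vanishes ν (gen-vanishes N k (suc j) ν) γ c γ<0

genFrom-vanishes : (N k j : ℕ) (κ : Vec ℕ n) → Vanishes (genFrom N k j κ)
genFrom-vanishes N k j ν = ⊟-vanishes ν (gen-vanishes N k (suc j) ν)

-- This serves twice: a number a for which a d is an integer, d being a nonzero difference of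
-- entries, is a multiple of 1 / N, and in `from-Pos` the twist stays nonnegative.
DiffsDivide : ℕ → Vec ℕ n → Set
DiffsDivide N v = ∀ k l → lookup v k ℕ.< lookup v l → (lookup v l ℕ.∸ lookup v k) ℕ.∣ N

diffsDivide-• : {N : ℕ} (σ : Perm n) {v : Vec ℕ n} → DiffsDivide N v → DiffsDivide N (σ • v)
diffsDivide-• σ {v} h k l rewrite lookup-• σ v k | lookup-• σ v l = h (σ ⟨$⟩ˡ k) (σ ⟨$⟩ˡ l)

diffsDivide-reach : {N j : ℕ} {κ ν : Vec ℕ n} → Reach N j κ ν → DiffsDivide N κ → DiffsDivide N ν
diffsDivide-reach ε h = h
diffsDivide-reach {κ = κ} (step β refl _ _ ◅ r) h =
  diffsDivide-reach r (diffsDivide-• (reflection β) {κ} h)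

diff-NonNeg : (i : Fin (pred n)) (v : Vec ℕ n) → NonNeg i v →
  diff v (lo i) (hi i) ≡ ℤ.+ (lookup v (lo i) ℕ.∸ lookup v (hi i))
diff-NonNeg i v v≥0 = trans (ℤ.m-n≡m⊖n (lookup v (lo i)) (lookup v (hi i))) (ℤ.⊖-≥ v≥0)

module _ {N : ℕ} (i : Fin (pred n)) where

  private
    DivConstraint : ℕ → ℕ → Vec ℕ n → Set
    DivConstraint e j ν = ℤ.+ N ∣ ℤ.+ e ℤ.+ ℤ.+ j ℤ.* diff ν (lo i) (hi i)

    -- On arrival the twist is the representative of - j d in [0, N). The relations for e and e + N
    -- are different statements, compare `demazure-N⇒0`, so the range is part of the claim.
    GenDemazure : ℕ → ℕ → Set
    GenDemazure k j = ∀ κ → DiffsDivide N κ → NonNeg i κ → ∀ e → e ℕ.< N → DivConstraint e j κ →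
      Demazure N i (ℤ.+ e) (gen N k j κ) (gen N k j (s i • κ))

    -- After the turn the range is (0, N], residue 0 being represented by N. Since `demazure-⊟` adds
    -- D to the twist, the induction hypothesis is needed at e - D; this is nonnegative because D
    -- divides N and e + j D, hence the positive number e.
    from-Pos : ∀ k j → GenDemazure k (suc j) → ∀ ν → DiffsDivide N ν → Pos i ν →
      ∀ e → 0 ℕ.< e → e ℕ.≤ N → DivConstraint e j ν →
      Demazure N i (ℤ.+ e) (genFrom N k j ν) (genFrom N k j (s i • ν))
    from-Pos k j ih ν ν-div ν>0 e e>0 e≤N N∣ = subst
      (λ z → Demazure N i z (genFrom N k j ν) (genFrom N k j (s i • ν))) e≡
      (demazure-⊟ N i {ℤ.+ (e ℕ.∸ D)} {gen N k (suc j) ν} {gen N k (suc j) (s i • ν)} ν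
        (ih ν ν-div (ℕ.<⇒≤ ν>0) (e ℕ.∸ D)
          (ℕ.<-≤-trans (ℕ.∸-monoʳ-< D>0 D≤e) e≤N)
          (subst (ℤ.+ N ∣_) (trans (cong (λ z → z ℤ.+ ℤ.+ j ℤ.* d) (sym e≡))
            (regroup (ℤ.+ (e ℕ.∸ D)) d (ℤ.+ j))) N∣)))
      where
      D = lookup ν (lo i) ℕ.∸ lookup ν (hi i)
      d = diff ν (lo i) (hi i)
      d≡D : d ≡ ℤ.+ D
      d≡D = diff-NonNeg i ν (ℕ.<⇒≤ ν>0)
      D>0 : 0 ℕ.< D
      D>0 = ℕ.m<n⇒0<n∸m ν>0
      D∣e : D ℕ.∣ e
      D∣e = ℤ.∣⇒∣ᵤ (ℤ.∣m+n∣m⇒∣n (subst (ℤ.+ D ∣_) (ℤ.+-comm (ℤ.+ e) (ℤ.+ j ℤ.* d))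
          (ℤ.∣-trans (ℤ.∣ᵤ⇒∣ (ν-div (hi i) (lo i) ν>0)) N∣))
        (subst (λ z → ℤ.+ D ∣ ℤ.+ j ℤ.* z) (sym d≡D) (ℤ.divides (ℤ.+ j) refl)))
      D≤e : D ℕ.≤ e
      D≤e = ℕ.∣⇒≤ {{ℕ.>-nonZero e>0}} D∣e
      e≡ : ℤ.+ (e ℕ.∸ D) ℤ.+ d ≡ ℤ.+ e
      e≡ = trans (cong (λ z → ℤ.+ (e ℕ.∸ D) ℤ.+ z) d≡D) (cong (ℤ.+_) (ℕ.m∸n+n≡m D≤e))
      regroup : ∀ e d j → (e ℤ.+ d) ℤ.+ j ℤ.* d ≡ e ℤ.+ (1ℤ ℤ.+ j) ℤ.* d
      regroup = ℤ-Solver.solve-∀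

    from-zero : ∀ k j → GenDemazure k (suc j) → 0 ℕ.< N → ∀ ν → DiffsDivide N ν →
      lookup ν (lo i) ≡ lookup ν (hi i) → Demazure N i 0ℤ (genFrom N k j ν) (genFrom N k j ν)
    from-zero k j ih N>0 ν ν-div ν≡0 = subst₂
      (λ z u → Demazure N i z (genFrom N k j ν) (genFrom N k j u)) d≡0 (s-fixes i ν ν≡0)
      (demazure-⊟ N i {0ℤ} {gen N k (suc j) ν} {gen N k (suc j) (s i • ν)} ν
        (ih ν ν-div (ℕ.≤-reflexive (sym ν≡0)) 0 N>0
          (subst (λ z → ℤ.+ N ∣ 0ℤ ℤ.+ ℤ.+ suc j ℤ.* z) (sym d≡0′)
            (ℤ.divides 0ℤ (trans (ℤ.+-identityˡ (ℤ.+ suc j ℤ.* 0ℤ)) (ℤ.*-zeroʳ (ℤ.+ suc j)))))))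
      where
      d≡0′ : diff ν (lo i) (hi i) ≡ 0ℤ
      d≡0′ = ℤ.i≡j⇒i-j≡0 (cong (ℤ.+_) ν≡0)
      d≡0 : 0ℤ ℤ.+ diff ν (lo i) (hi i) ≡ 0ℤ
      d≡0 = trans (ℤ.+-identityˡ _) d≡0′

    -- The vector `s i • ν` falls under `from-Pos` with twist N - e, which exhibits the function of
    -- ν as an image. By `demazure-image` it is annihilated with twist N - (N - e) = e, in
    -- accordance with the empty list in `expand`.
    from-Neg : ∀ k j → GenDemazure k (suc j) → 0 ℕ.< N → ∀ ν → DiffsDivide N ν → Neg i ν →
      ∀ e → e ℕ.< N → DivConstraint e j ν →
      Demazure N i (ℤ.+ e) (genFrom N k j ν) (λ _ → 0ℤ)
    from-Neg k j ih N>0 ν ν-div ν<0 e e<N N∣ = demazure-image N i N>0 {N ℕ.∸ e}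
      {f = genFrom N k j (s i • ν)} {genFrom N k j ν} (genFrom-vanishes N k j ν)
      (subst (λ u → Demazure N i (ℤ.+ (N ℕ.∸ e)) (genFrom N k j (s i • ν)) (genFrom N k j u)) (s-involutive i ν)
        (from-Pos k j ih (s i • ν) (diffsDivide-• (s i) {ν} ν-div) (Neg⇒Pos-s i ν ν<0)
          (N ℕ.∸ e) (ℕ.m<n⇒0<n∸m e<N) (ℕ.m∸n≤m N e)
          (subst (ℤ.+ N ∣_) (trans (regroup (ℤ.+ N) (ℤ.+ e) (ℤ.+ j) (ℤ.+ lookup ν (lo i)) (ℤ.+ lookup ν (hi i)))
              (cong₂ (λ p q → p ℤ.+ ℤ.+ j ℤ.* q) N-e (sym (diff-s i ν))))
            (ℤ.∣m∣n⇒∣m-n ℤ.∣-refl N∣))))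
      (trans (back (ℤ.+ e) (ℤ.+ N)) (cong (λ z → ℤ.+ N ℤ.- z) N-e))
      where
      N-e : ℤ.+ N ℤ.- ℤ.+ e ≡ ℤ.+ (N ℕ.∸ e)
      N-e = trans (ℤ.m-n≡m⊖n N e) (ℤ.⊖-≥ (ℕ.<⇒≤ e<N))
      regroup : ∀ n e j a b → n ℤ.- (e ℤ.+ j ℤ.* (a ℤ.- b)) ≡ (n ℤ.- e) ℤ.+ j ℤ.* (b ℤ.- a)
      regroup = ℤ-Solver.solve-∀
      back : ∀ e n → e ≡ n ℤ.- (n ℤ.- e)
      back = ℤ-Solver.solve-∀

  gen-demazure : 0 ℕ.< N → ∀ k j → j ℕ.+ k ≡ N → GenDemazure k j
  -- At j = N the residue is forced to be 0, and the relation reduces to the symmetry of the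
  -- constant 1.
  gen-demazure N>0 zero j j≡N κ κ-div κ≥0 e e<N N∣ with small-∣ e<N (ℤ.∣m+n∣m⇒∣n
    (subst (ℤ.+ N ∣_) (ℤ.+-comm (ℤ.+ e) (ℤ.+ j ℤ.* diff κ (lo i) (hi i))) N∣)
    (ℤ.∣m⇒∣m*n (diff κ (lo i) (hi i)) (subst (λ m → ℤ.+ N ∣ ℤ.+ m) (sym (trans (sym (ℕ.+-identityʳ j)) j≡N)) ℤ.∣-refl)))
  ... | refl = λ γ → cong₂ (λ k z → monomial 𝟘 (shift i k γ) ℤ.- z)
    (sym (ℤ.+-identityˡ (ℤ.- ℤ.+ N)))
    (trans (sym (monomial-s i 𝟘 γ)) (cong (λ α → monomial α (s i • γ))
      (s-fixes i 𝟘 (trans (lookup-replicate {n = n} (lo i) 0) (sym (lookup-replicate {n = n} (hi i) 0))))))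
  gen-demazure N>0 (suc k) j j+k≡N κ κ-div κ≥0 e e<N N∣ =
    demazure-cong N i {ℤ.+ e} {gen N (suc k) j κ}
      {g = λ γ → total (λ ν → total (λ μ → genFrom N k j μ γ) (expand i e ν)) (atOrBelow N j κ)}
      (λ γ → refl)
      (λ γ → sym (trans (total-↭ (λ μ → genFrom N k j μ γ) (atOrBelow-s {N = N} {j} i κ κ≥0 e e<N N∣))
        (total-concatMap (λ μ → genFrom N k j μ γ) (expand i e) (atOrBelow N j κ))))
      (demazure-total N i {ℤ.+ e} {genFrom N k j} {λ ν γ → total (λ μ → genFrom N k j μ γ) (expand i e ν)}
        (atOrBelow N j κ)
        λ {ν} ν∈ → each ν (∈-atOrBelow⁻ N j ν∈))
    where
    ih : GenDemazure k (suc j)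
    ih = gen-demazure N>0 k (suc j) (trans (sym (ℕ.+-suc j k)) j+k≡N)
    each : ∀ ν → Reach N j κ ν →
      Demazure N i (ℤ.+ e) (genFrom N k j ν) (λ γ → total (λ μ → genFrom N k j μ γ) (expand i e ν))
    each ν κ↝ν = go e e<N (congruent-∣ {N = N} {j} κ ν (lo i) (hi i) (ℤ.+ e) (reach-congruent κ↝ν) N∣)
      where
      ν-div = diffsDivide-reach κ↝ν κ-div
      go : ∀ e → e ℕ.< N → DivConstraint e j ν →
        Demazure N i (ℤ.+ e) (genFrom N k j ν) (λ γ → total (λ μ → genFrom N k j μ γ) (expand i e ν))
      go e e<N N∣ with ℕ.<-cmp (lookup ν (lo i)) (lookup ν (hi i)) | e
      ... | tri< ν<0 _ _ | e′ = from-Neg k j ih N>0 ν ν-div ν<0 e′ e<N N∣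
      ... | tri≈ _ ν≡0 _ | zero = demazure-cong N i {0ℤ} {genFrom N k j ν} {g = genFrom N k j ν} (λ _ → refl)
        (λ γ → sym (ℤ.+-identityʳ _)) (from-zero k j ih N>0 ν ν-div ν≡0)
      ... | tri≈ _ ν≡0 _ | suc e′ = contradiction (small-∣ e<N (subst (ℤ.+ N ∣_)
        (trans (cong (λ z → ℤ.+ suc e′ ℤ.+ ℤ.+ j ℤ.* z) (ℤ.i≡j⇒i-j≡0 (cong (ℤ.+_) ν≡0)))
          (trans (cong (λ z → ℤ.+ suc e′ ℤ.+ z) (ℤ.*-zeroʳ (ℤ.+ j))) (ℤ.+-identityʳ (ℤ.+ suc e′)))) N∣)) λ ()
      -- Both ν and `s i • ν` are listed by `expand` here. Their functions are related with twist N,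
      -- and adding the function of ν to the image turns this into twist 0.
      ... | tri> _ _ ν>0 | zero = demazure-cong N i {0ℤ} {genFrom N k j ν}
        {g = λ γ → genFrom N k j ν γ ℤ.+ genFrom N k j (s i • ν) γ} (λ _ → refl)
        (λ γ → cong (λ z → genFrom N k j ν γ ℤ.+ z) (sym (ℤ.+-identityʳ _)))
        (demazure-N⇒0 N i {genFrom N k j ν} {genFrom N k j (s i • ν)} (from-Pos k j ih ν ν-div ν>0 N N>0 ℕ.≤-refl
          (subst (ℤ.+ N ∣_) (cong (λ z → ℤ.+ N ℤ.+ z)
            (ℤ.+-identityˡ (ℤ.+ j ℤ.* diff ν (lo i) (hi i)))) (ℤ.∣m∣n⇒∣m+n ℤ.∣-refl N∣))))
      ... | tri> _ _ ν>0 | suc e′ = demazure-cong N i {ℤ.+ suc e′} {genFrom N k j ν}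
        {g = genFrom N k j (s i • ν)} (λ _ → refl) (λ γ → sym (ℤ.+-identityʳ _))
        (from-Pos k j ih ν ν-div ν>0 (suc e′) (ℕ.s≤s ℕ.z≤n) (ℕ.<⇒≤ e<N) N∣)

  genFrom-demazure : 0 ℕ.< N → ∀ k → suc k ≡ N → ∀ κ → DiffsDivide N κ → Pos i κ →
    Demazure N i (ℤ.+ N) (genFrom N k 0 κ) (genFrom N k 0 (s i • κ))
  genFrom-demazure N>0 k 1+k≡N κ κ-div κ>0 = from-Pos k 0 (gen-demazure N>0 k 1 1+k≡N) κ κ-div κ>0 N N>0 ℕ.≤-refl
    (subst (ℤ.+ N ∣_) (trans (sym (ℤ.+-identityʳ (ℤ.+ N))) (cong (λ z → ℤ.+ N ℤ.+ z)
      (sym (ℤ.*-zeroˡ (diff κ (lo i) (hi i)))))) ℤ.∣-refl)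

-- Lengths and minimal coset representatives

-- A regular partition: σ is recovered from its action on it.
staircase : (n : ℕ) → Vec ℕ n
staircase n = tabulate λ k → n ℕ.∸ suc (toℕ k)

staircase-< : {k l : Fin n} → k Fin.< l → lookup (staircase n) l ℕ.< lookup (staircase n) k
staircase-< {n} {k} {l} k<l = subst₂ ℕ._<_ (sym (lookup∘tabulate _ l)) (sym (lookup∘tabulate _ k))
  (ℕ.∸-monoʳ-< (ℕ.s≤s k<l) (Fin.toℕ<n l))

len : Perm n → ℕ
len {n} σ = ascents (σ • staircase n)

len-cong : {σ τ : Perm n} → σ ≈ₚ τ → len σ ≡ len τ
len-cong {n} {σ} {τ} σ≈τ = cong ascents (•-cong {σ = σ} {τ} σ≈τ (staircase n))

len-· : (τ σ : Perm n) → len (τ · σ) ≡ ascents (τ • (σ • staircase n))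
len-· {n} τ σ = cong ascents (·-• τ σ (staircase n))

ascents-staircase : ∀ n → ascents (staircase n) ≡ 0
ascents-staircase n with find-ascent (staircase n)
... | inj₁ (i , lt) = contradiction lt (ℕ.<-asym (staircase-< (lo<hi {n} i)))
... | inj₂ eq       = eq

len-product : (w : Word n) → len (product {n} w) ℕ.≤ length w
len-product {n} []      = ℕ.≤-reflexive (trans (cong ascents (id-• (staircase n))) (ascents-staircase n))
len-product {n} (i ∷ w) = ℕ.≤-trans (ℕ.≤-reflexive (len-· (s i) (product {n} w)))
  (ℕ.≤-trans (ascents-s≤1+ i (product {n} w • staircase n)) (ℕ.s≤s (len-product {n} w)))

ascents≡0⇒decreasing : (v : Vec ℕ n) → ascents v ≡ 0 → ∀ {k l} → k Fin.< l → lookup v l ℕ.≤ lookup v k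
ascents≡0⇒decreasing v eq {k} {l} k<l = ℕ.≮⇒≥ λ lt →
  contradiction (subst (ascents (transpose k l • v) ℕ.<_) eq (ascents-transpose v k l k<l lt)) λ ()

increasing⇒≥ : (f : Fin n → Fin n) → (∀ {k l} → k Fin.< l → f k Fin.< f l) → ∀ k → k Fin.≤ f k
increasing⇒≥ f f-inc k = go (toℕ k) k refl
  where
  go : ∀ m k → toℕ k ≡ m → m ℕ.≤ toℕ (f k)
  go zero    k       eq = ℕ.z≤n
  go (suc m) (suc k) eq = ℕ.≤-<-trans
    (go m (inject₁ k) (trans (Fin.toℕ-inject₁ k) (ℕ.suc-injective eq)))
    (f-inc (ℕ.s≤s (ℕ.≤-reflexive (Fin.toℕ-inject₁ k))))

-- Without inversions both σ and its inverse are increasing, and an increasing self-map of `Fin n`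
-- moves no point down.
len≡0⇒id : (σ : Perm n) → len σ ≡ 0 → σ ≈ₚ id
len≡0⇒id {n} σ eq k = Fin.toℕ-injective (ℕ.≤-antisym
  (subst (λ l → toℕ (σ ⟨$⟩ʳ k) ℕ.≤ toℕ l) (Perm.inverseˡ σ) (increasing⇒≥ (σ ⟨$⟩ˡ_) ˡ-inc (σ ⟨$⟩ʳ k)))
  (increasing⇒≥ (σ ⟨$⟩ʳ_) ʳ-inc k))
  where
  ˡ-inc : ∀ {k l} → k Fin.< l → σ ⟨$⟩ˡ k Fin.< σ ⟨$⟩ˡ l
  ˡ-inc {k} {l} k<l with Fin.<-cmp (σ ⟨$⟩ˡ k) (σ ⟨$⟩ˡ l)
  ... | tri< lt _ _ = lt
  ... | tri≈ _ e _ = contradiction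
    (cong toℕ (trans (sym (Perm.inverseʳ σ)) (trans (cong (σ ⟨$⟩ʳ_) e) (Perm.inverseʳ σ)))) (ℕ.<⇒≢ k<l)
  ... | tri> _ _ gt = contradiction
    (subst₂ ℕ._<_ (sym (lookup-• σ (staircase n) k)) (sym (lookup-• σ (staircase n) l)) (staircase-< gt))
    (ℕ.≤⇒≯ (ascents≡0⇒decreasing (σ • staircase n) eq k<l))
  ʳ-inc : ∀ {k l} → k Fin.< l → σ ⟨$⟩ʳ k Fin.< σ ⟨$⟩ʳ l
  ʳ-inc {k} {l} k<l with Fin.<-cmp (σ ⟨$⟩ʳ k) (σ ⟨$⟩ʳ l)
  ... | tri< lt _ _ = lt
  ... | tri≈ _ e _ = contradiction
    (cong toℕ (trans (sym (Perm.inverseˡ σ)) (trans (cong (σ ⟨$⟩ˡ_) e) (Perm.inverseˡ σ)))) (ℕ.<⇒≢ k<l)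
  ... | tri> _ _ gt = contradiction
    (subst₂ (λ p q → p Fin.< q) (Perm.inverseˡ σ) (Perm.inverseˡ σ) (ˡ-inc gt)) (ℕ.<-asym k<l)

s·s· : (i : Fin (pred n)) (σ : Perm n) → s i · (s i · σ) ≈ₚ σ
s·s· {n} i σ k = transpose-involutive (lo {n} i) (hi i) (σ ⟨$⟩ʳ k)

word : ∀ m (σ : Perm n) → len σ ≡ m → ∃ λ w → product w ≈ₚ σ × length w ≡ m
word zero    σ eq = [] , ≈ₚ-sym {σ = σ} {id} (len≡0⇒id σ eq) , refl
word {n} (suc m) σ eq with find-ascent (σ • staircase n)
... | inj₂ eq′ = contradiction (trans (sym eq) eq′) λ ()
... | inj₁ (i , lt) with word m (s i · σ) (trans (len-· (s i) σ)
                          (ℕ.suc-injective (trans (sym (ascents-s< i (σ • staircase n) lt)) eq)))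
...   | w , w≈ , length≡ = i ∷ w ,
  ≈ₚ-trans {σ = s i · product w} {s i · (s i · σ)} {σ} (·-congˡ (s i) {product w} {s i · σ} w≈) (s·s· i σ) ,
  cong suc length≡

len-≤ : {σ : Perm n} (w : Word n) → product {n} w ≈ₚ σ → len σ ℕ.≤ length w
len-≤ {n} {σ} w w≈ = ℕ.≤-trans (ℕ.≤-reflexive (sym (len-cong {σ = product {n} w} {σ} w≈))) (len-product {n} w)

length-reduced : {σ : Perm n} {w : Word n} → IsReducedWord σ w → length w ≡ len σ
length-reduced {σ = σ} {w} (w≈ , minimal) with word (len σ) σ refl
... | v , v≈ , v-length = ℕ.≤-antisym (ℕ.≤-trans (minimal v v≈) (ℕ.≤-reflexive v-length)) (len-≤ {σ = σ} w w≈)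

hasLength⁻ : {σ : Perm n} {k : ℕ} → HasLength σ k → k ≡ len σ
hasLength⁻ {σ = σ} (w , reduced , refl) = length-reduced {σ = σ} {w} reduced

hasLength-len : (σ : Perm n) → HasLength σ (len σ)
hasLength-len σ with word (len σ) σ refl
... | w , w≈ , length≡ = w , (w≈ , λ v v≈ → ℕ.≤-trans (ℕ.≤-reflexive length≡) (len-≤ {σ = σ} v v≈)) , length≡

hasLength⁺ : (σ : Perm n) {k : ℕ} → len σ ≡ k → HasLength σ k
hasLength⁺ σ refl = hasLength-len σ

-- An equality of counts that replaces the quantification over the stabilizer: for a partition it is
-- equivalent to minimality in the coset, by `standard⇒minimal` and `minimal⇒standard`, and it is
-- easily passed on to `s i · τ`.
Standard : Vec ℕ n → Perm n → Set
Standard lam τ = len τ ≡ ascents (τ • lam)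

InOrbit : Vec ℕ n → Vec ℕ n → Set
InOrbit lam v = ∃ λ σ → σ • lam ≡ v

orbit-s : (i : Fin (pred n)) {lam v : Vec ℕ n} → InOrbit lam v → InOrbit lam (s i • v)
orbit-s i {lam} (σ , refl) = s i · σ , ·-• (s i) σ lam

-- The fuel is the number of ascents of the vector to be sorted.
sorting : ℕ → Vec ℕ n → Perm n
sorting zero    v = id
sorting (suc m) v with find-ascent v
... | inj₁ (i , _) = s i · sorting m (s i • v)
... | inj₂ _       = id

len-sorting : ∀ m (v : Vec ℕ n) → len (sorting m v) ℕ.≤ m
len-sorting {n} zero v = len-product {n} []
len-sorting {n} (suc m) v with find-ascent v
... | inj₂ _ = ℕ.≤-trans (len-product {n} []) ℕ.z≤n
... | inj₁ (i , lt) = ℕ.≤-trans (ℕ.≤-reflexive (len-· (s i) (sorting m (s i • v))))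
  (ℕ.≤-trans (ascents-s≤1+ i (sorting m (s i • v) • staircase n)) (ℕ.s≤s (len-sorting m (s i • v))))

minimalRep : Vec ℕ n → Perm n
minimalRep v = sorting (ascents v) v

module MinimalReps (lam : Vec ℕ n) (lam-partition : IsPartition lam) where

  -- The larger of two entries of a partition stands in the earlier position, where the staircase is
  -- larger as well.
  lam-<⇒staircase-< : (σ : Perm n) {k l : Fin n} → lookup (σ • lam) k ℕ.< lookup (σ • lam) l →
    lookup (σ • staircase n) k ℕ.< lookup (σ • staircase n) l
  lam-<⇒staircase-< σ {k} {l} lt
    rewrite lookup-• σ lam k | lookup-• σ lam l | lookup-• σ (staircase n) k | lookup-• σ (staircase n) l
    = staircase-< (ℕ.≰⇒> λ le → ℕ.<⇒≱ lt (lam-partition _ _ le))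

  ascents-≤-len : (σ : Perm n) → ascents (σ • lam) ℕ.≤ len σ
  ascents-≤-len σ = ascents-mono (σ • lam) (σ • staircase n) λ k l _ → lam-<⇒staircase-< σ

  -- Induction on the length of σ. At an adjacent ascent of `σ • staircase n` the entries of
  -- `σ • lam` neither ascend, by hypothesis, nor descend, by `lam-<⇒staircase-<`. So they are
  -- equal, and the simple reflection can be removed from σ without changing the vector.
  decreasing-rearrangement : (σ : Perm n) → ascents (σ • lam) ≡ 0 → σ • lam ≡ lam
  decreasing-rearrangement σ eq = go (len σ) σ refl eq
    where
    go : ∀ m σ → len σ ≡ m → ascents (σ • lam) ≡ 0 → σ • lam ≡ lam
    go zero σ len≡ eq = trans (•-cong {σ = σ} {id} (len≡0⇒id σ len≡) lam) (id-• lam)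
    go (suc m) σ len≡ eq with find-ascent (σ • staircase n)
    ... | inj₂ eq′ = contradiction (trans (sym len≡) eq′) λ ()
    ... | inj₁ (i , lt) = trans (sym fixed) (trans (sym (·-• (s i) σ lam)) (go m (s i · σ)
      (trans (len-· (s i) σ) (ℕ.suc-injective (trans (sym (ascents-s< i (σ • staircase n) lt)) len≡)))
      (trans (cong ascents (trans (·-• (s i) σ lam) fixed)) eq)))
      where
      fixed : s i • (σ • lam) ≡ σ • lam
      fixed = s-fixes i (σ • lam) (ℕ.≤-antisym
        (ℕ.≮⇒≥ λ gt → ℕ.<-asym lt (lam-<⇒staircase-< σ gt))
        (ascents≡0⇒decreasing (σ • lam) eq (lo<hi {n} i)))

  sorting-• : ∀ m v → ascents v ≡ m → InOrbit lam v → sorting m v • lam ≡ v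
  sorting-• zero v eq (σ , refl) = trans (id-• lam) (sym (decreasing-rearrangement σ eq))
  sorting-• (suc m) v eq orb with find-ascent v
  ... | inj₂ eq′ = contradiction (trans (sym eq) eq′) λ ()
  ... | inj₁ (i , lt) = trans (·-• (s i) (sorting m (s i • v)) lam) (trans
    (cong (s i •_) (sorting-• m (s i • v) (ℕ.suc-injective (trans (sym (ascents-s< i v lt)) eq)) (orbit-s i {lam} orb)))
    (s-involutive i v))

  minimalRep-• : {v : Vec ℕ n} → InOrbit lam v → minimalRep v • lam ≡ v
  minimalRep-• {v} = sorting-• (ascents v) v refl

  minimalRep-standard : {v : Vec ℕ n} → InOrbit lam v → Standard lam (minimalRep v)
  minimalRep-standard {v} orb = ℕ.≤-antisym
    (ℕ.≤-trans (len-sorting (ascents v) v) (ℕ.≤-reflexive (cong ascents (sym (minimalRep-• orb)))))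
    (ascents-≤-len (minimalRep v))

  standard⇒minimal : {τ : Perm n} → Standard lam τ → IsMinimalRep lam τ
  standard⇒minimal {τ} std σ stab {k} {m} ℓτ ℓτσ
    rewrite hasLength⁻ {σ = τ} ℓτ | hasLength⁻ {σ = τ · σ} ℓτσ = begin
      len τ                     ≡⟨ std ⟩
      ascents (τ • lam)         ≡⟨ cong (λ v → ascents (τ • v)) stab ⟨
      ascents (τ • (σ • lam))   ≡⟨ cong ascents (·-• τ σ lam) ⟨
      ascents ((τ · σ) • lam)   ≤⟨ ascents-≤-len (τ · σ) ⟩
      len (τ · σ)               ∎
    where open ℕ.≤-Reasoning

  minimal⇒standard : {τ : Perm n} → IsMinimalRep lam τ → Standard lam τ
  minimal⇒standard {τ} minimal = ℕ.≤-antisym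
    (ℕ.≤-trans (minimal σ stab (hasLength-len τ) (hasLength-len (τ · σ)))
      (ℕ.≤-trans (ℕ.≤-reflexive (len-cong {σ = τ · σ} {τ₀} (λ k → Perm.inverseʳ τ)))
        (len-sorting (ascents v) v)))
    (ascents-≤-len τ)
    where
    v = τ • lam
    τ₀ = minimalRep v
    -- Both τ and τ₀ carry `lam` to v, so σ stabilizes it. Moreover τ · σ is τ₀, whose length is at
    -- most `ascents v` because it comes from sorting.
    σ = Perm.flip τ · τ₀
    stab : σ • lam ≡ lam
    stab = trans (·-• (Perm.flip τ) τ₀ lam) (trans (cong (Perm.flip τ •_) (minimalRep-• (τ , refl)))
      (trans (sym (·-• (Perm.flip τ) τ lam)) (trans (•-cong {σ = Perm.flip τ · τ} {id} (λ k → Perm.inverseˡ τ) lam) (id-• lam))))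

  -- If the entries of `τ • lam` did not ascend at i, then `s i · τ` would be shorter than the
  -- number of ascents of the vector it produces, against `ascents-≤-len`.
  standard-s : (i : Fin (pred n)) {τ : Perm n} → Standard lam τ →
    lookup (τ • staircase n) (lo i) ℕ.< lookup (τ • staircase n) (hi i) → Standard lam (s i · τ) ×
    lookup (τ • lam) (lo i) ℕ.< lookup (τ • lam) (hi i)
  standard-s i {τ} std lt with ℕ.≤-<-connex (lookup (τ • lam) (hi i)) (lookup (τ • lam) (lo i))
  ... | inj₂ lam-lt = trans (len-· (s i) τ) (ℕ.suc-injective (trans (sym (ascents-s< i (τ • staircase n) lt))
    (trans std (trans (ascents-s< i (τ • lam) lam-lt) (cong (suc ∘ ascents) (sym (·-• (s i) τ lam))))))) , lam-lt
  ... | inj₁ lam-ge = contradiction (begin-strict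
      len (s i · τ)                  ≡⟨ len-· (s i) τ ⟩
      ascents (s i • (τ • staircase n)) <⟨ ℕ.≤-reflexive (sym (ascents-s< i (τ • staircase n) lt)) ⟩
      len τ                          ≡⟨ std ⟩
      ascents (τ • lam)              ≤⟨ ascents-s≥ i (τ • lam) lam-ge ⟩
      ascents (s i • (τ • lam))      ≡⟨ cong ascents (·-• (s i) τ lam) ⟨
      ascents ((s i · τ) • lam)      ≤⟨ ascents-≤-len (s i · τ) ⟩
      len (s i · τ)                  ∎) (ℕ.<-irrefl refl)
    where open ℕ.≤-Reasoning

  -- The ascent chosen by `find-ascent` depends only on the vector, and `standard-s` allows τ to be
  -- reduced along the very swaps that `sorting` performs.
  standard-unique : {τ : Perm n} → Standard lam τ → τ ≈ₚ minimalRep (τ • lam)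
  standard-unique {τ} std = go (ascents (τ • lam)) τ (τ • lam) refl refl std
    where
    go : ∀ m τ v → τ • lam ≡ v → ascents v ≡ m → Standard lam τ → τ ≈ₚ sorting m v
    go zero τ v refl eq std = len≡0⇒id τ (trans std eq)
    go (suc m) τ v refl eq std with find-ascent v
    ... | inj₂ eq′ = contradiction (trans (sym eq) eq′) λ ()
    ... | inj₁ (i , lt) = ≈ₚ-trans {σ = τ} {s i · (s i · τ)} {s i · sorting m (s i • v)}
      (≈ₚ-sym {σ = s i · (s i · τ)} {τ} (s·s· i τ))
      (·-congˡ (s i) {s i · τ} {sorting m (s i • v)} (go m (s i · τ) (s i • v) (·-• (s i) τ lam)
        (ℕ.suc-injective (trans (sym (ascents-s< i v lt)) eq))
        (proj₁ (standard-s i {τ} std (lam-<⇒staircase-< τ lt)))))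

-- Chains and their integrality conditions

fromℤ : ℤ → ℚ
fromℤ z = z ℚ./ 1

private
  fromℤ-mkℚ : ∀ z → fromℤ z ≡ mkℚ z 0 (Coprime.sym (Coprime.1-coprimeTo ℤ.∣ z ∣))
  fromℤ-mkℚ z = ℚ.↥p/↧p≡p (mkℚ z 0 _)

fromℤ-+ : ∀ y z → fromℤ (y ℤ.+ z) ≡ fromℤ y ℚ.+ fromℤ z
fromℤ-+ y z rewrite fromℤ-mkℚ y | fromℤ-mkℚ z =
  cong fromℤ (sym (cong₂ ℤ._+_ (ℤ.*-identityʳ y) (ℤ.*-identityʳ z)))

fromℤ-* : ∀ y z → fromℤ (y ℤ.* z) ≡ fromℤ y ℚ.* fromℤ z
fromℤ-* y z rewrite fromℤ-mkℚ y | fromℤ-mkℚ z = refl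

fromℤ-injective : ∀ {y z} → fromℤ y ≡ fromℤ z → y ≡ z
fromℤ-injective {y} {z} eq = proj₁ (ℚ.mkℚ-injective (trans (sym (fromℤ-mkℚ y)) (trans eq (fromℤ-mkℚ z))))

fromℤ-- : ∀ y z → fromℤ (y ℤ.- z) ≡ fromℤ y ℚ.- fromℤ z
fromℤ-- y z = trans (lemma (fromℤ (y ℤ.- z)) (fromℤ z)) (cong (λ p → p ℚ.- fromℤ z)
  (trans (sym (fromℤ-+ (y ℤ.- z) z)) (cong fromℤ (cancel y z))))
  where
  open ℚ-Solver.+-*-Solver
  lemma : ∀ p q → p ≡ (p ℚ.+ q) ℚ.- q
  lemma = solve 2 (λ p q → p := (p :+ q) :- q) refl
  cancel : ∀ y z → (y ℤ.- z) ℤ.+ z ≡ y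
  cancel = ℤ-Solver.solve-∀

fromℤ-< : ∀ {y z} → y ℤ.< z → fromℤ y ℚ.< fromℤ z
fromℤ-< {y} {z} lt rewrite fromℤ-mkℚ y | fromℤ-mkℚ z =
  ℚ.*<* (subst₂ ℤ._<_ (sym (ℤ.*-identityʳ y)) (sym (ℤ.*-identityʳ z)) lt)

fromℤ-<⁻¹ : ∀ {y z} → fromℤ y ℚ.< fromℤ z → y ℤ.< z
fromℤ-<⁻¹ {y} {z} lt rewrite fromℤ-mkℚ y | fromℤ-mkℚ z =
  subst₂ ℤ._<_ (ℤ.*-identityʳ y) (ℤ.*-identityʳ z) (ℚ.drop-*<* lt)

sum-unit : (f : Vector ℚ n) (a : Fin n) → sum (λ i → f i ℚ.* unit a i) ≡ f a
sum-unit {suc n} f zero = trans (cong₂ ℚ._+_ (ℚ.*-identityʳ (f zero))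
  (trans (sum-cong-≗ (λ i → ℚ.*-zeroʳ (f (suc i)))) (sum-replicate-zero n))) (ℚ.+-identityʳ (f zero))
sum-unit {suc n} f (suc a) = trans (cong₂ ℚ._+_ (ℚ.*-zeroʳ (f zero)) (sum-unit (f ∘ suc) a)) (ℚ.+-identityˡ _)

sum-- : ∀ {n} (f g : Vector ℚ n) → sum (λ i → f i ℚ.- g i) ≡ sum f ℚ.- sum g
sum-- {zero}  f g = refl
sum-- {suc n} f g = trans (cong (λ p → (f zero ℚ.- g zero) ℚ.+ p) (sum-- (f ∘ suc) (g ∘ suc)))
  (lemma (f zero) (g zero) (sum (f ∘ suc)) (sum (g ∘ suc)))
  where
  open ℚ-Solver.+-*-Solver
  lemma : ∀ a b c d → (a ℚ.- b) ℚ.+ (c ℚ.- d) ≡ (a ℚ.+ c) ℚ.- (b ℚ.+ d)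
  lemma = solve 4 (λ a b c d → (a :- b) :+ (c :- d) := (a :+ c) :- (b :+ d)) refl

pairing-root : (v : Vec ℕ n) (β : PositiveRoot n) →
  ⟨ fromℕᵛ v , root β ⟩ ≡ fromℤ (diff v (PositiveRoot.a β) (PositiveRoot.b β))
pairing-root v β = trans (sum-cong-≗ λ i → lemma (fromℕᵛ v i) (unit a i) (unit b i)) (trans
  (sum-- (λ i → fromℕᵛ v i ℚ.* unit a i) (λ i → fromℕᵛ v i ℚ.* unit b i))
  (trans (cong₂ ℚ._-_ (sum-unit (fromℕᵛ v) a) (sum-unit (fromℕᵛ v) b)) (sym (fromℤ-- (ℤ.+ lookup v a) (ℤ.+ lookup v b)))))
  where
  open PositiveRoot β
  open ℚ-Solver.+-*-Solver
  lemma : ∀ f p q → f ℚ.* (p ℚ.- q) ≡ f ℚ.* p ℚ.- f ℚ.* q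
  lemma = solve 3 (λ f p q → f :* (p :- q) := f :* p :- f :* q) refl

-- Breakpoints as multiples of 1 / N

module Times (N : ℕ) (N>0 : 0 ℕ.< N) where

  private
    instance
      N-positive : ℚ.Positive (fromℤ (ℤ.+ N))
      N-positive = ℚ.positive (fromℤ-< (ℤ.+<+ N>0))

      N-nonZero : ℚ.NonZero (fromℤ (ℤ.+ N))
      N-nonZero = ℚ.pos⇒nonZero (fromℤ (ℤ.+ N))

      N-nonNegative : ℚ.NonNegative (fromℤ (ℤ.+ N))
      N-nonNegative = ℚ.pos⇒nonNeg (fromℤ (ℤ.+ N))

  abstract

    time : ℕ → ℚ
    time j = fromℤ (ℤ.+ j) ℚ.* (ℚ.1/ fromℤ (ℤ.+ N))

    time-* : ∀ j → time j ℚ.* fromℤ (ℤ.+ N) ≡ fromℤ (ℤ.+ j)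
    time-* j = trans (ℚ.*-assoc (fromℤ (ℤ.+ j)) _ _) (trans
      (cong (λ p → fromℤ (ℤ.+ j) ℚ.* p) (ℚ.*-inverseˡ (fromℤ (ℤ.+ N)))) (ℚ.*-identityʳ _))

    time-0 : time 0 ≡ 0ℚ
    time-0 = ℚ.*-zeroˡ (ℚ.1/ fromℤ (ℤ.+ N))

    time-N : time N ≡ 1ℚ
    time-N = ℚ.*-inverseʳ (fromℤ (ℤ.+ N))

  N-cancel : ∀ {p q} → p ℚ.* fromℤ (ℤ.+ N) ≡ q ℚ.* fromℤ (ℤ.+ N) → p ≡ q
  N-cancel {p} {q} eq = trans (divide p) (trans (cong (λ r → r ℚ.* (ℚ.1/ fromℤ (ℤ.+ N))) eq) (sym (divide q)))
    where
    divide : ∀ p → p ≡ p ℚ.* fromℤ (ℤ.+ N) ℚ.* (ℚ.1/ fromℤ (ℤ.+ N))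
    divide p = sym (trans (ℚ.*-assoc p _ _) (trans
      (cong (λ q → p ℚ.* q) (ℚ.*-inverseʳ (fromℤ (ℤ.+ N)))) (ℚ.*-identityʳ p)))

  IsTime : ℚ → ℕ → Set
  IsTime a j = a ℚ.* fromℤ (ℤ.+ N) ≡ fromℤ (ℤ.+ j)

  time-unique : ∀ {a j} → IsTime a j → a ≡ time j
  time-unique {a} {j} h = N-cancel (trans h (sym (time-* j)))

  time-injective : ∀ {j j′} → time j ≡ time j′ → j ≡ j′
  time-injective {j} {j′} eq = ℤ.+-injective (fromℤ-injective (trans (sym (time-* j))
    (trans (cong (λ p → p ℚ.* fromℤ (ℤ.+ N)) eq) (time-* j′))))

  time-< : ∀ {j j′} → j ℕ.< j′ → time j ℚ.< time j′
  time-< {j} {j′} lt = ℚ.*-cancelʳ-<-nonNeg (fromℤ (ℤ.+ N))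
    (subst₂ ℚ._<_ (sym (time-* j)) (sym (time-* j′)) (fromℤ-< (ℤ.+<+ lt)))

  times-< : ∀ {a a′ j j′} → IsTime a j → IsTime a′ j′ → a ℚ.< a′ → j ℕ.< j′
  times-< h h′ lt = ℤ.drop‿+<+ (fromℤ-<⁻¹ (subst₂ ℚ._<_ h h′ (ℚ.*-monoˡ-<-pos (fromℤ (ℤ.+ N)) lt)))

  integral⇒∣ : ∀ {a j} z → IsTime a j → IsInteger (a ℚ.* fromℤ z) → ℤ.+ N ∣ ℤ.+ j ℤ.* z
  integral⇒∣ {a} {j} z h (y , eq) = ℤ.divides y (fromℤ-injective (begin
    fromℤ (ℤ.+ j ℤ.* z)                  ≡⟨ fromℤ-* (ℤ.+ j) z ⟩
    fromℤ (ℤ.+ j) ℚ.* fromℤ z            ≡⟨ cong (λ p → p ℚ.* fromℤ z) h ⟨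
    a ℚ.* fromℤ (ℤ.+ N) ℚ.* fromℤ z      ≡⟨ rotate a (fromℤ (ℤ.+ N)) (fromℤ z) ⟩
    a ℚ.* fromℤ z ℚ.* fromℤ (ℤ.+ N)      ≡⟨ cong (λ p → p ℚ.* fromℤ (ℤ.+ N)) eq ⟩
    fromℤ y ℚ.* fromℤ (ℤ.+ N)            ≡⟨ fromℤ-* y (ℤ.+ N) ⟨
    fromℤ (y ℤ.* ℤ.+ N)                  ∎))
    where
    open ≡-Reasoning
    open ℚ-Solver.+-*-Solver
    rotate : ∀ p q r → p ℚ.* q ℚ.* r ≡ p ℚ.* r ℚ.* q
    rotate = solve 3 (λ p q r → p :* q :* r := p :* r :* q) refl

  ∣⇒integral : ∀ {a j} z → IsTime a j → ℤ.+ N ∣ ℤ.+ j ℤ.* z → IsInteger (a ℚ.* fromℤ z)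
  ∣⇒integral {a} {j} z h (ℤ.divides y eq) = y , N-cancel (begin
    a ℚ.* fromℤ z ℚ.* fromℤ (ℤ.+ N)      ≡⟨ rotate a (fromℤ (ℤ.+ N)) (fromℤ z) ⟨
    a ℚ.* fromℤ (ℤ.+ N) ℚ.* fromℤ z      ≡⟨ cong (λ p → p ℚ.* fromℤ z) h ⟩
    fromℤ (ℤ.+ j) ℚ.* fromℤ z            ≡⟨ fromℤ-* (ℤ.+ j) z ⟨
    fromℤ (ℤ.+ j ℤ.* z)                  ≡⟨ cong fromℤ eq ⟩
    fromℤ (y ℤ.* ℤ.+ N)                  ≡⟨ fromℤ-* y (ℤ.+ N) ⟩
    fromℤ y ℚ.* fromℤ (ℤ.+ N)            ∎)
    where
    open ≡-Reasoning
    open ℚ-Solver.+-*-Solver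
    rotate : ∀ p q r → p ℚ.* q ℚ.* r ≡ p ℚ.* r ℚ.* q
    rotate = solve 3 (λ p q r → p :* q :* r := p :* r :* q) refl

  -- Write N = q z. Then a N is q times the integer a z, and it is natural because a is positive.
  integral⇒time : ∀ {a} z → 0ℚ ℚ.< a → z ∣ ℤ.+ N → IsInteger (a ℚ.* fromℤ z) → ∃ λ j → IsTime a j
  integral⇒time {a} z a>0 (ℤ.divides q eq) (y , eq′) = nonneg (y ℤ.* q) a*N
    where
    open ≡-Reasoning
    a*N : a ℚ.* fromℤ (ℤ.+ N) ≡ fromℤ (y ℤ.* q)
    a*N = begin
      a ℚ.* fromℤ (ℤ.+ N)             ≡⟨ cong (λ z → a ℚ.* fromℤ z) (trans eq (ℤ.*-comm q z)) ⟩
      a ℚ.* fromℤ (z ℤ.* q)           ≡⟨ cong (λ p → a ℚ.* p) (fromℤ-* z q) ⟩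
      a ℚ.* (fromℤ z ℚ.* fromℤ q)     ≡⟨ ℚ.*-assoc a (fromℤ z) (fromℤ q) ⟨
      a ℚ.* fromℤ z ℚ.* fromℤ q       ≡⟨ cong (λ p → p ℚ.* fromℤ q) eq′ ⟩
      fromℤ y ℚ.* fromℤ q             ≡⟨ fromℤ-* y q ⟨
      fromℤ (y ℤ.* q)                 ∎
    nonneg : ∀ x → a ℚ.* fromℤ (ℤ.+ N) ≡ fromℤ x → ∃ λ j → IsTime a j
    nonneg (ℤ.+ j) h = j , h
    nonneg ℤ.-[1+ j ] h = contradiction
      (fromℤ-<⁻¹ {0ℤ} {ℤ.-[1+ j ]} (subst₂ ℚ._<_ (ℚ.*-zeroˡ (fromℤ (ℤ.+ N))) h (ℚ.*-monoˡ-<-pos (fromℤ (ℤ.+ N)) a>0))) λ ()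

  -- Chains of coset representatives and chains of vectors

  module Chains (lam : Vec ℕ n) (lam-partition : IsPartition lam) where

    open MinimalReps lam lam-partition

    chainStep-covers : ∀ {a τ σ} → ChainStep lam a τ σ → ascents (τ • lam) ≡ suc (ascents (σ • lam))
    chainStep-covers {a} {τ} {σ} st = begin
      ascents (τ • lam)        ≡⟨ minimal⇒standard {τ} minimal′ ⟨
      len τ                    ≡⟨ hasLength⁻ {σ = τ} (proj₂ (proj₂ covers)) ⟨
      suc (proj₁ covers)       ≡⟨ cong suc (hasLength⁻ {σ = σ} (proj₁ (proj₂ covers))) ⟩
      suc (len σ)              ≡⟨ cong suc (minimal⇒standard {σ} minimal) ⟩
      suc (ascents (σ • lam))  ∎
      where
      open ChainStep st
      open ≡-Reasoning

    chainStep-reflects : ∀ {a τ σ} (st : ChainStep lam a τ σ) →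
      σ • lam ≡ reflection (ChainStep.β st) • (τ • lam)
    chainStep-reflects {τ = τ} {σ} st = trans (•-cong {σ = σ} {reflection β · τ} reflects lam) (·-• (reflection β) τ lam)
      where open ChainStep st

    chainStep⇒step : ∀ {a j τ σ} → IsTime a j → ChainStep lam a τ σ → Step N j (τ • lam) (σ • lam)
    chainStep⇒step {a} {j} {τ} {σ} h st = record
      { β        = β
      ; reflects = chainStep-reflects st
      ; covers   = chainStep-covers st
      -- A `ChainStep` pairs the root with the lower vector, a `Step` with the upper one; the
      -- reflection only changes the sign.
      ; integral = subst (λ z → ℤ.+ N ∣ ℤ.+ j ℤ.* z) diff-σ (diff-flip {N = N} {j} (σ • lam) a′ b′
          (integral⇒∣ {a} {j} (diff (σ • lam) a′ b′) h (subst (λ p → IsInteger (a ℚ.* p)) (pairing-root (σ • lam) β) integral)))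
      }
      where
      open ChainStep st
      open PositiveRoot β renaming (a to a′; b to b′)
      diff-σ : diff (σ • lam) b′ a′ ≡ diff (τ • lam) a′ b′
      diff-σ = trans (cong (λ v → diff v b′ a′) (chainStep-reflects st)) (cong₂ (λ p q → ℤ.+ p ℤ.- ℤ.+ q)
        (lookup-transpose-second a′ b′ (τ • lam)) (lookup-transpose-first a′ b′ (τ • lam)))

    chain⇒steps : ∀ {a j τ σ} → IsTime a j → Chain lam a τ σ →
      TransClosure (Step N j) (τ • lam) (σ • lam)
    chain⇒steps h [ st ]     = [ chainStep⇒step h st ]
    chain⇒steps h (st ∷ sts) = chainStep⇒step h st ∷ chain⇒steps h sts

    diff-∣ : ∀ {v : Vec ℕ n} k l → DiffsDivide N v → lookup v k ≢ lookup v l → diff v k l ∣ ℤ.+ N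
    diff-∣ {v} k l v-div v≢ with ℕ.<-cmp (lookup v k) (lookup v l)
    ... | tri≈ _ v≡ _ = contradiction v≡ v≢
    ... | tri> _ _ v> = subst (_∣ ℤ.+ N) (sym (trans (ℤ.m-n≡m⊖n (lookup v k) (lookup v l)) (ℤ.⊖-≥ (ℕ.<⇒≤ v>))))
      (ℤ.∣ᵤ⇒∣ (v-div l k v>))
    ... | tri< v< _ _ = ℤ.∣ᵤ⇒∣ (subst (ℕ._∣ N) (sym (trans
      (cong ℤ.∣_∣ (trans (ℤ.m-n≡m⊖n (lookup v k) (lookup v l)) (ℤ.⊖-≤ (ℕ.<⇒≤ v<)))) (ℤ.∣-i∣≡∣i∣ (ℤ.+ (lookup v l ℕ.∸ lookup v k)))))
      (v-div k l v<))

    -- The first step of the chain suffices. The two entries it swaps differ, since the number of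
    -- ascents changes, and so their difference divides N.
    chain⇒time : ∀ {a τ σ} → 0ℚ ℚ.< a → DiffsDivide N lam → Chain lam a τ σ → ∃ λ j → IsTime a j
    chain⇒time {a} a>0 lam-div = λ { [ st ] → go st ; (st ∷ _) → go st }
      where
      go : ∀ {τ σ} → ChainStep lam a τ σ → ∃ λ j → IsTime a j
      go {τ} {σ} st = integral⇒time (diff v a′ b′) a>0 (diff-∣ {v} a′ b′ (diffsDivide-• σ {lam} lam-div) distinct)
        (subst (λ p → IsInteger (a ℚ.* p)) (pairing-root v β) integral)
        where
        open ChainStep st
        open PositiveRoot β renaming (a to a′; b to b′)
        v = σ • lam
        u = τ • lam
        u≡ : u ≡ reflection β • v
        u≡ = trans (sym (•-involutive a′ b′ u)) (cong (reflection β •_) (sym (chainStep-reflects st)))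
        distinct : lookup v a′ ≢ lookup v b′
        distinct v≡ = ℕ.1+n≢n (trans (sym (chainStep-covers st)) (cong ascents (trans u≡ (transpose-• a′ b′ v v≡))))

    step-orbit : ∀ {j v v′} → Step N j v v′ → InOrbit lam v → InOrbit lam v′
    step-orbit (step β refl _ _) (σ , refl) = reflection β · σ , ·-• (reflection β) σ lam

    steps-orbit : ∀ {j v v′} → TransClosure (Step N j) v v′ → InOrbit lam v → InOrbit lam v′
    steps-orbit [ st ]     orb = step-orbit st orb
    steps-orbit (st ∷ sts) orb = steps-orbit sts (step-orbit st orb)

    -- The representatives themselves, not only the vectors, must differ by the reflection. The
    -- reflected representative υ carries `lam` to v′ and is shorter than τ, whose length is one
    -- more than `ascents v′`. Hence υ is standard, and by uniqueness it is σ.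
    step⇒chainStep : ∀ {a j v v′} → IsTime a j → InOrbit lam v → Step N j v v′ →
      ChainStep lam a (minimalRep v) (minimalRep v′)
    step⇒chainStep {a} {j} {v} {v′} h orb st@(step β refl covers integral) = record
      { minimal′ = standard⇒minimal {τ} τ-std
      ; minimal  = standard⇒minimal {σ} σ-std
      ; descends = [ (β , τ≈) , ascents v′ , ascents v , hasLength⁺ σ lenσ , hasLength⁺ τ lenτ , ℕ.≤-reflexive (sym covers) ]
      ; covers   = ascents v′ , hasLength⁺ σ lenσ , hasLength⁺ τ (trans lenτ covers)
      ; β        = β
      ; reflects = σ≈
      ; integral = subst (λ p → IsInteger (a ℚ.* p)) (sym (pairing-root (σ • lam) β))
          (∣⇒integral {a} {j} (diff (σ • lam) a′ b′) h (subst (λ z → ℤ.+ N ∣ ℤ.+ j ℤ.* z) (sym diff-σ)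
            (diff-flip {N = N} {j} v a′ b′ integral)))
      }
      where
      open PositiveRoot β renaming (a to a′; b to b′; a<b to a′<b′)
      τ = minimalRep v
      σ = minimalRep v′
      υ = reflection β · τ
      orb′ : InOrbit lam v′
      orb′ = step-orbit st orb
      τ-std = minimalRep-standard orb
      σ-std = minimalRep-standard orb′
      τ-lam = minimalRep-• orb
      σ-lam = minimalRep-• orb′
      lenτ : len τ ≡ ascents v
      lenτ = trans τ-std (cong ascents τ-lam)
      lenσ : len σ ≡ ascents v′
      lenσ = trans σ-std (cong ascents σ-lam)
      υ-lam : υ • lam ≡ v′
      υ-lam = trans (·-• (reflection β) τ lam) (cong (reflection β •_) τ-lam)
      υ-std : len υ ≡ ascents (υ • lam)
      υ-std = ℕ.≤-antisym
        (ℕ.s≤s⁻¹ (begin-strict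
          len υ                                   ≡⟨ len-· (reflection β) τ ⟩
          ascents (reflection β • (τ • staircase n)) <⟨ ascents-transpose (τ • staircase n) a′ b′ a′<b′
            (lam-<⇒staircase-< τ (subst (λ u → lookup u a′ ℕ.< lookup u b′) (sym τ-lam) (step-ascends st))) ⟩
          len τ                                   ≡⟨ lenτ ⟩
          ascents v                               ≡⟨ covers ⟩
          suc (ascents v′)                        ≡⟨ cong (suc ∘ ascents) υ-lam ⟨
          suc (ascents (υ • lam))                 ∎))
        (ascents-≤-len υ)
        where open ℕ.≤-Reasoning
      σ≈ : σ ≈ₚ υ
      σ≈ = ≈ₚ-sym {σ = υ} {σ} (subst (λ u → υ ≈ₚ minimalRep u) υ-lam (standard-unique {υ} υ-std))
      τ≈ : τ ≈ₚ reflection β · σ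
      τ≈ k = sym (trans (cong (reflection β ⟨$⟩ʳ_) (σ≈ k)) (transpose-involutive a′ b′ (τ ⟨$⟩ʳ k)))
      diff-σ : diff (σ • lam) a′ b′ ≡ diff v b′ a′
      diff-σ = trans (cong (λ u → diff u a′ b′) σ-lam) (cong₂ (λ p q → ℤ.+ p ℤ.- ℤ.+ q)
        (lookup-transpose-first a′ b′ v) (lookup-transpose-second a′ b′ v))

    steps⇒chain : ∀ {a j v v′} → IsTime a j → InOrbit lam v → TransClosure (Step N j) v v′ →
      Chain lam a (minimalRep v) (minimalRep v′)
    steps⇒chain h orb [ st ]     = [ step⇒chainStep h orb st ]
    steps⇒chain h orb (st ∷ sts) = step⇒chainStep h orb st ∷ steps⇒chain h (step-orbit st orb) sts

chain⇒<ᴮ : ∀ {lam : Vec ℕ n} {a τ σ} → Chain lam a τ σ → σ <ᴮ τ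
chain⇒<ᴮ [ st ]     = ChainStep.descends st
chain⇒<ᴮ (st ∷ sts) = chain⇒<ᴮ sts Transitive.++ ChainStep.descends st

-- LS-paths as lists of turns

total-map : (f : B → ℤ) (g : A → B) (as : List A) → total f (List.map g as) ≡ total (f ∘ g) as
total-map f g []       = refl
total-map f g (a ∷ as) = cong (λ z → f (g a) ℤ.+ z) (total-map f g as)

monomial-⊟ : (ν α : Exponent n) (γ : Vec ℤ n) → ∀ β →
  (∀ c → lookup β c ≡ lookup ν c ℕ.+ lookup α c) → monomial α (γ ⊟ ν) ≡ monomial β γ
monomial-⊟ ν α γ β β≡ = cong (λ b → if b then 1ℤ else 0ℤ) (does-⇔ (mk⇔
  (λ eq → lookup-ext λ c → trans (embed-β c) (trans (cong (λ z → ℤ.+ lookup ν c ℤ.+ z)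
    (trans (sym (lookup-map c (ℤ.+_) α)) (trans (cong (λ v → lookup v c) eq) (lookup-⊟ γ ν c))))
    (cancel (ℤ.+ lookup ν c) (lookup γ c))))
  (λ { refl → lookup-ext λ c → sym (trans (lookup-⊟ (embed β) ν c) (trans (cong (λ z → z ℤ.- ℤ.+ lookup ν c) (embed-β c))
    (trans (cancel′ (ℤ.+ lookup ν c) (ℤ.+ lookup α c)) (sym (lookup-map c (ℤ.+_) α))))) }))
  (embed α ≟ᶻ (γ ⊟ ν)) (embed β ≟ᶻ γ))
  where
  embed-β : ∀ c → lookup (embed β) c ≡ ℤ.+ lookup ν c ℤ.+ ℤ.+ lookup α c
  embed-β c = trans (lookup-map c (ℤ.+_) β) (trans (cong (ℤ.+_) (β≡ c)) (ℤ.pos-+ (lookup ν c) (lookup α c)))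
  cancel : ∀ a b → a ℤ.+ (b ℤ.- a) ≡ b
  cancel = ℤ-Solver.solve-∀
  cancel′ : ∀ a b → (a ℤ.+ b) ℤ.- a ≡ b
  cancel′ = ℤ-Solver.solve-∀

-- A path that has reached time j / N with direction κ is continued by the list
-- of the times (scaled by N) and directions of its remaining turns.
Continuation : ℕ → Set
Continuation n = List (ℕ × Vec ℕ n)

module _ (N : ℕ) where

  data Valid (j : ℕ) (κ : Vec ℕ n) : Continuation n → Set where
    []   : Valid j κ []
    turn : ∀ {j′ ν L} → j ℕ.≤ j′ → j′ ℕ.< N → TransClosure (Step N j′) κ ν →
           Valid (suc j′) ν L → Valid j κ ((j′ , ν) ∷ L)

  valid-weaken : ∀ {j j′} {κ : Vec ℕ n} {L} → j ℕ.≤ j′ → Valid j′ κ L → Valid j κ L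
  valid-weaken le []                   = []
  valid-weaken le (turn le′ lt steps v) = turn (ℕ.≤-trans le le′) lt steps v

  -- A turn of an LS-path only requires that some chain exist. Since `below` lists a direction once,
  -- however many chains lead to it, no continuation is repeated.
  continuations : (k j : ℕ) → Vec ℕ n → List (Continuation n)
  continuations zero    j κ = [] ∷ []
  continuations (suc k) j κ = continuations k (suc j) κ ++
    concatMap (λ ν → List.map ((j , ν) ∷_) (continuations k (suc j) ν)) (below N j κ)

  ∈-continuations⁻ : ∀ k j (κ : Vec ℕ n) {L} → j ℕ.+ k ≡ N → L ∈ continuations k j κ → Valid j κ L
  ∈-continuations⁻ zero j κ eq (here refl) = []
  ∈-continuations⁻ (suc k) j κ eq L∈ with ∈-++⁻ (continuations k (suc j) κ) L∈
  ... | inj₁ L∈ˡ = valid-weaken (ℕ.n≤1+n j) (∈-continuations⁻ k (suc j) κ (trans (sym (ℕ.+-suc j k)) eq) L∈ˡ)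
  ... | inj₂ L∈ʳ with find (∈-concatMap⁻ (λ ν → List.map ((j , ν) ∷_) (continuations k (suc j) ν)) {xs = below N j κ} L∈ʳ)
  ...   | ν , ν∈ , L∈ν with ∈-map⁻ ((j , ν) ∷_) L∈ν
  ...     | L′ , L′∈ , refl = turn ℕ.≤-refl
    (ℕ.≤-trans (ℕ.s≤s (ℕ.m≤m+n j k)) (ℕ.≤-reflexive (trans (sym (ℕ.+-suc j k)) eq)))
    (∈-below⁻ N j ν∈) (∈-continuations⁻ k (suc j) ν (trans (sym (ℕ.+-suc j k)) eq) L′∈)

  ∈-continuations⁺ : ∀ k j (κ : Vec ℕ n) {L} → j ℕ.+ k ≡ N → Valid j κ L → L ∈ continuations k j κ
  ∈-continuations⁺ zero j κ eq [] = here refl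
  ∈-continuations⁺ zero j κ eq (turn le lt _ _) =
    contradiction (ℕ.≤-<-trans le lt) (ℕ.<-irrefl (trans (sym (ℕ.+-identityʳ j)) eq))
  ∈-continuations⁺ (suc k) j κ eq [] = ∈-++⁺ˡ (∈-continuations⁺ k (suc j) κ (trans (sym (ℕ.+-suc j k)) eq) [])
  ∈-continuations⁺ (suc k) j κ eq (turn {j′} {ν} le lt steps v) with ℕ.m≤n⇒m<n∨m≡n le
  ... | inj₁ j<j′ = ∈-++⁺ˡ (∈-continuations⁺ k (suc j) κ (trans (sym (ℕ.+-suc j k)) eq) (turn j<j′ lt steps v))
  ... | inj₂ refl = ∈-++⁺ʳ (continuations k (suc j) κ)
    (∈-concatMap⁺ (λ ν → List.map ((j , ν) ∷_) (continuations k (suc j) ν)) (lose (∈-below⁺ N j steps)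
      (∈-map⁺ ((j , ν) ∷_) (∈-continuations⁺ k (suc j) ν (trans (sym (ℕ.+-suc j k)) eq) v))))

  continuations-unique : ∀ k j (κ : Vec ℕ n) → j ℕ.+ k ≡ N → Unique (continuations k j κ)
  continuations-unique zero    j κ eq = [] ∷ []
  continuations-unique {n} (suc k) j κ eq = Unique.++⁺ (continuations-unique k (suc j) κ eq′)
    (concatMap-unique turns next next-turns
      (λ ν → Unique.map⁺ (λ { refl → refl }) (continuations-unique k (suc j) ν eq′)) (below-unique N j κ))
    disjoint
    where
    eq′ = trans (sym (ℕ.+-suc j k)) eq
    turns : Vec ℕ n → List (Continuation n)
    turns ν = List.map ((j , ν) ∷_) (continuations k (suc j) ν)
    next : Continuation n → Vec ℕ n
    next []            = κ
    next ((_ , ν) ∷ _) = ν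
    next-turns : ∀ {ν L} → L ∈ turns ν → next L ≡ ν
    next-turns {ν} L∈ with ∈-map⁻ ((j , ν) ∷_) L∈
    ... | _ , _ , refl = refl
    disjoint : ∀ {L} → ¬ (L ∈ continuations k (suc j) κ × L ∈ concatMap turns (below N j κ))
    disjoint (L∈ , L∈′) with find (∈-concatMap⁻ turns {xs = below N j κ} L∈′)
    ... | ν , _ , L∈ν with ∈-map⁻ ((j , ν) ∷_) L∈ν
    ...   | _ , _ , refl with ∈-continuations⁻ k (suc j) κ eq′ L∈
    ...     | turn le _ _ _ = ℕ.<-irrefl refl le

  -- N times the part of the weight after time j / N
  scaledWeightAt : ℕ → Vec ℕ n → Continuation n → Fin n → ℕ
  scaledWeightAt j κ []             c = (N ℕ.∸ j) ℕ.* lookup κ c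
  scaledWeightAt j κ ((j′ , ν) ∷ L) c = (j′ ℕ.∸ j) ℕ.* lookup κ c ℕ.+ scaledWeightAt j′ ν L c

  scaledWeight : ℕ → Vec ℕ n → Continuation n → Exponent n
  scaledWeight j κ L = tabulate (scaledWeightAt j κ L)

  scaledWeightAt-suc : ∀ {j} {κ : Vec ℕ n} {L} → j ℕ.< N → Valid (suc j) κ L → ∀ c →
    scaledWeightAt j κ L c ≡ lookup κ c ℕ.+ scaledWeightAt (suc j) κ L c
  scaledWeightAt-suc {j = j} {κ} j<N [] c = cong (ℕ._* lookup κ c) (ℕ.+-∸-assoc 1 j<N)
  scaledWeightAt-suc {j = j} {κ} j<N (turn {j′} {ν} {L} j<j′ _ _ _) c = trans
    (cong (λ m → m ℕ.* lookup κ c ℕ.+ scaledWeightAt j′ ν L c) (ℕ.+-∸-assoc 1 j<j′))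
    (ℕ.+-assoc (lookup κ c) _ _)

  genFrom-total : ∀ k j → j ℕ.+ suc k ≡ N → (∀ (ν : Vec ℕ n) γ → gen N k (suc j) ν γ ≡
      total (λ L → monomial (scaledWeight (suc j) ν L) γ) (continuations k (suc j) ν)) →
    ∀ (ν : Vec ℕ n) γ → genFrom N k j ν γ ≡
      total (λ L → monomial (scaledWeight j ν L) γ) (continuations k (suc j) ν)
  genFrom-total k j eq ih ν γ = trans (ih ν (γ ⊟ ν)) (total-cong (continuations k (suc j) ν) λ {L} L∈ →
    monomial-⊟ ν (scaledWeight (suc j) ν L) γ (scaledWeight j ν L) λ c →
      trans (lookup∘tabulate (scaledWeightAt j ν L) c) (trans
        (scaledWeightAt-suc (ℕ.m+n≤o⇒m≤o (suc j) (ℕ.≤-reflexive eq′)) (∈-continuations⁻ k (suc j) ν eq′ L∈) c)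
        (cong (lookup ν c ℕ.+_) (sym (lookup∘tabulate (scaledWeightAt (suc j) ν L) c)))))
    where
    eq′ = trans (sym (ℕ.+-suc j k)) eq

  gen-total : ∀ k j → j ℕ.+ k ≡ N → ∀ (κ : Vec ℕ n) γ → gen N k j κ γ ≡
    total (λ L → monomial (scaledWeight j κ L) γ) (continuations k j κ)
  gen-total {n} zero j eq κ γ = trans (cong (λ α → monomial α γ) 𝟘≡) (sym (ℤ.+-identityʳ _))
    where
    𝟘≡ : 𝟘 ≡ scaledWeight j κ []
    𝟘≡ = lookup-ext λ c → trans (lookup-replicate c 0) (sym (trans (lookup∘tabulate (scaledWeightAt j κ []) c)
      (cong (ℕ._* lookup κ c) (ℕ.m≤n⇒m∸n≡0 (ℕ.≤-reflexive (sym (trans (sym (ℕ.+-identityʳ j)) eq)))))))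
  gen-total {n} (suc k) j eq κ γ = trans
    (cong₂ ℤ._+_ (from κ) (trans (total-cong (below N j κ) λ {ν} _ → trans (from ν) (sym (trans
        (total-map (λ L → monomial (scaledWeight j κ L) γ) ((j , ν) ∷_) (continuations k (suc j) ν))
        (total-cong (continuations k (suc j) ν) λ {L} _ → cong (λ α → monomial α γ) (drop ν L)))))
      (sym (total-concatMap (λ L → monomial (scaledWeight j κ L) γ) turns (below N j κ)))))
    (sym (total-++ (λ L → monomial (scaledWeight j κ L) γ) (continuations k (suc j) κ) (concatMap turns (below N j κ))))
    where
    turns : Vec ℕ n → List (Continuation n)
    turns ν = List.map ((j , ν) ∷_) (continuations k (suc j) ν)
    from : ∀ ν → genFrom N k j ν γ ≡ total (λ L → monomial (scaledWeight j ν L) γ) (continuations k (suc j) ν)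
    from ν = genFrom-total k j eq (gen-total k (suc j) (trans (sym (ℕ.+-suc j k)) eq)) ν γ
    drop : ∀ ν L → scaledWeight j κ ((j , ν) ∷ L) ≡ scaledWeight j ν L
    drop ν L = lookup-ext λ c → trans (lookup∘tabulate (scaledWeightAt j κ ((j , ν) ∷ L)) c) (trans
      (cong (λ m → m ℕ.* lookup κ c ℕ.+ scaledWeightAt j ν L c) (ℕ.n∸n≡0 j))
      (sym (lookup∘tabulate (scaledWeightAt j ν L) c)))

  -- The quantity is unchanged while the path runs straight. A turn at time j′ / N changes it by j′
  -- (κ_c - ν_c), a multiple of N by `reach-congruent`, and at the end it is N times the last
  -- direction. The case j = 0 is the integrality of π(1).
  ∣-scaledWeightAt : ∀ {j} {κ : Vec ℕ n} {L} → j ℕ.≤ N → Valid j κ L → ∀ c →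
    ℤ.+ N ∣ ℤ.+ (j ℕ.* lookup κ c ℕ.+ scaledWeightAt j κ L c)
  ∣-scaledWeightAt {j = j} {κ} j≤N [] c = ℤ.∣ᵤ⇒∣ (ℕ.divides (lookup κ c) (begin
    j ℕ.* lookup κ c ℕ.+ (N ℕ.∸ j) ℕ.* lookup κ c  ≡⟨ ℕ.*-distribʳ-+ (lookup κ c) j (N ℕ.∸ j) ⟨
    (j ℕ.+ (N ℕ.∸ j)) ℕ.* lookup κ c               ≡⟨ cong (ℕ._* lookup κ c) (ℕ.m+[n∸m]≡n j≤N) ⟩
    N ℕ.* lookup κ c                               ≡⟨ ℕ.*-comm N (lookup κ c) ⟩
    lookup κ c ℕ.* N                               ∎))
    where open ≡-Reasoning
  ∣-scaledWeightAt {j = j} {κ} j≤N (turn {j′} {ν} {L} j≤j′ j′<N steps v) c = subst (ℤ.+ N ∣_) shape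
    (ℤ.∣m∣n⇒∣m+n (reach-congruent (TransClosure⇒Star N j′ steps) c)
      (∣-scaledWeightAt (ℕ.<⇒≤ j′<N) (valid-weaken (ℕ.n≤1+n j′) v) c))
    where
    open ≡-Reasoning
    K = lookup κ c
    V = lookup ν c
    W = scaledWeightAt j′ ν L c
    lemma : ∀ j k v w → j ℤ.* (k ℤ.- v) ℤ.+ (j ℤ.* v ℤ.+ w) ≡ j ℤ.* k ℤ.+ w
    lemma = ℤ-Solver.solve-∀
    shape : ℤ.+ j′ ℤ.* (ℤ.+ K ℤ.- ℤ.+ V) ℤ.+ ℤ.+ (j′ ℕ.* V ℕ.+ W) ≡
      ℤ.+ (j ℕ.* K ℕ.+ ((j′ ℕ.∸ j) ℕ.* K ℕ.+ W))
    shape = begin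
      ℤ.+ j′ ℤ.* (ℤ.+ K ℤ.- ℤ.+ V) ℤ.+ ℤ.+ (j′ ℕ.* V ℕ.+ W)
        ≡⟨ cong (λ z → ℤ.+ j′ ℤ.* (ℤ.+ K ℤ.- ℤ.+ V) ℤ.+ z)
            (trans (ℤ.pos-+ (j′ ℕ.* V) W) (cong (λ z → z ℤ.+ ℤ.+ W) (ℤ.pos-* j′ V))) ⟩
      ℤ.+ j′ ℤ.* (ℤ.+ K ℤ.- ℤ.+ V) ℤ.+ (ℤ.+ j′ ℤ.* ℤ.+ V ℤ.+ ℤ.+ W)
        ≡⟨ lemma (ℤ.+ j′) (ℤ.+ K) (ℤ.+ V) (ℤ.+ W) ⟩
      ℤ.+ j′ ℤ.* ℤ.+ K ℤ.+ ℤ.+ W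
        ≡⟨ trans (ℤ.pos-+ (j′ ℕ.* K) W) (cong (λ z → z ℤ.+ ℤ.+ W) (ℤ.pos-* j′ K)) ⟨
      ℤ.+ (j′ ℕ.* K ℕ.+ W)
        ≡⟨ cong (λ m → ℤ.+ (m ℕ.* K ℕ.+ W)) (ℕ.m+[n∸m]≡n j≤j′) ⟨
      ℤ.+ ((j ℕ.+ (j′ ℕ.∸ j)) ℕ.* K ℕ.+ W)
        ≡⟨ cong (λ m → ℤ.+ (m ℕ.+ W)) (ℕ.*-distribʳ-+ K j (j′ ℕ.∸ j)) ⟩
      ℤ.+ (j ℕ.* K ℕ.+ (j′ ℕ.∸ j) ℕ.* K ℕ.+ W)
        ≡⟨ cong (ℤ.+_) (ℕ.+-assoc (j ℕ.* K) _ W) ⟩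
      ℤ.+ (j ℕ.* K ℕ.+ ((j′ ℕ.∸ j) ℕ.* K ℕ.+ W)) ∎

  -- The division is exact for valid continuations (exponent-*).
  exponent : .{{ℕ.NonZero N}} → Vec ℕ n → Continuation n → Exponent n
  exponent κ L = tabulate λ c → scaledWeightAt 0 κ L c ℕ./ N

  exponent-* : .{{_ : ℕ.NonZero N}} {κ : Vec ℕ n} {L : Continuation n} → Valid 1 κ L → ∀ c →
    lookup (exponent κ L) c ℕ.* N ≡ scaledWeightAt 0 κ L c
  exponent-* {κ = κ} {L} v c = trans
    (cong (ℕ._* N) (lookup∘tabulate (λ c → scaledWeightAt 0 κ L c ℕ./ N) c))
    (ℕ.m/n*n≡m (ℤ.∣⇒∣ᵤ (∣-scaledWeightAt ℕ.z≤n (valid-weaken ℕ.z≤n v) c)))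

-- The formula for π(1) in RationalPath, as a function of the breakpoints and
-- directions.
endpoint : (lam : Vec ℕ n) (m : ℕ) → Vec ℚ (suc (suc m)) → Vec (Perm n) (suc m) → Fin n → ℚ
endpoint lam m a τ c =
  sum (λ (i : Fin (toℕ (fromℕ m))) →
    let i′ = inject {i = fromℕ m} i in
    (lookup a (suc i′) ℚ.- lookup a (inject₁ i′)) ℚ.* fromℕᵛ (lookup τ i′ • lam) c)
  ℚ.+ (1ℚ ℚ.- lookup a (inject₁ (fromℕ m))) ℚ.* fromℕᵛ (lookup τ (fromℕ m) • lam) c

endpoint-∷ : (lam : Vec ℕ n) (m : ℕ) (a a′ : ℚ) (as : Vec ℚ (suc m))
  (τ : Perm n) (τs : Vec (Perm n) (suc m)) (c : Fin n) →
  endpoint lam (suc m) (a ∷ a′ ∷ as) (τ ∷ τs) c ≡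
  (a′ ℚ.- a) ℚ.* fromℕᵛ (τ • lam) c ℚ.+ endpoint lam m (a′ ∷ as) τs c
endpoint-∷ lam m a a′ as τ τs c = ℚ.+-assoc ((a′ ℚ.- a) ℚ.* fromℕᵛ (τ • lam) c) _ _

-- Continuations and rational paths

module _ (N : ℕ) (N>0 : 0 ℕ.< N)
         (lam : Vec ℕ n) (lam-partition : IsPartition lam) (lam-div : DiffsDivide N lam) where

  open Times N N>0
  open Chains lam lam-partition
  open MinimalReps lam lam-partition

  laterDirections : (L : Continuation n) → Vec (Perm n) (length L)
  laterDirections []            = []
  laterDirections ((_ , ν) ∷ L) = minimalRep ν ∷ laterDirections L

  laterBreakpoints : (L : Continuation n) → Vec ℚ (suc (length L))
  laterBreakpoints []            = time N ∷ []
  laterBreakpoints ((j , _) ∷ L) = time j ∷ laterBreakpoints L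

  later-minimal : ∀ {j κ L} → InOrbit lam κ → Valid N j κ L → ∀ i →
    IsMinimalRep lam (lookup (minimalRep κ ∷ laterDirections L) i)
  later-minimal {κ = κ} orb v zero = standard⇒minimal {minimalRep κ} (minimalRep-standard orb)
  later-minimal orb (turn _ _ steps v) (suc i) = later-minimal (steps-orbit steps orb) v i

  later-chains : ∀ {j κ L} → InOrbit lam κ → Valid N j κ L → ∀ i → Chain lam (lookup (laterBreakpoints L) (inject₁ i))
    (lookup (minimalRep κ ∷ laterDirections L) (inject₁ i)) (lookup (laterDirections L) i)
  later-chains orb (turn {j′} _ _ steps v) zero = steps⇒chain (time-* j′) orb steps
  later-chains orb (turn _ _ steps v) (suc i) = later-chains (steps-orbit steps orb) v i

  later-increasing : ∀ {j κ L} p → p ℕ.< j → p ℕ.< N → Valid N j κ L → ∀ i →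
    lookup (time p ∷ laterBreakpoints L) (inject₁ i) ℚ.< lookup (laterBreakpoints L) i
  later-increasing p p<j p<N [] zero = time-< p<N
  later-increasing p p<j p<N (turn j≤j′ _ _ _) zero = time-< (ℕ.<-≤-trans p<j j≤j′)
  later-increasing p p<j p<N (turn {j′} _ j′<N _ v) (suc i) = later-increasing j′ (ℕ.n<1+n j′) j′<N v i

  later-last : ∀ L → lookup (laterBreakpoints L) (fromℕ (length L)) ≡ 1ℚ
  later-last []      = time-N
  later-last (_ ∷ L) = later-last L

  path : ∀ {κ L} → InOrbit lam κ → Valid N 1 κ L → RationalPath lam
  path {κ} {L} orb v = record
    { m          = length L
    ; τ          = minimalRep κ ∷ laterDirections L
    ; a          = time 0 ∷ laterBreakpoints L
    ; minimal    = later-minimal orb v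
    ; decreasing = λ i → chain⇒<ᴮ (later-chains orb v i)
    ; a-first    = time-0
    ; a-last     = later-last L
    ; increasing = later-increasing 0 (ℕ.s≤s ℕ.z≤n) N>0 v
    }

  later-injective : ∀ {j j₁ κ κ₁ L L₁} → InOrbit lam κ → InOrbit lam κ₁ → Valid N j κ L → Valid N j₁ κ₁ L₁ →
    Pointwiseᵛ.Pointwise _≈ₚ_ (laterDirections L) (laterDirections L₁) →
    Pointwiseᵛ.Pointwise _≡_ (laterBreakpoints L) (laterBreakpoints L₁) → L ≡ L₁
  later-injective orb orb₁ [] [] _ _ = refl
  later-injective orb orb₁ (turn {ν = ν} _ _ steps v) (turn {ν = ν₁} _ _ steps₁ v₁) (τ≈ ∷ τs≈) (a≡ ∷ as≡) =
    cong₂ _∷_ (cong₂ _,_ (time-injective a≡) (trans (sym (minimalRep-• orbν))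
      (trans (•-cong {σ = minimalRep ν} {minimalRep ν₁} τ≈ lam) (minimalRep-• orbν₁))))
      (later-injective orbν orbν₁ v v₁ τs≈ as≡)
    where
    orbν  = steps-orbit steps orb
    orbν₁ = steps-orbit steps₁ orb₁

  increasing⇒first≤last : ∀ {m} (a : Vec ℚ (suc m)) → (∀ i → lookup a (inject₁ i) ℚ.< lookup a (suc i)) →
    lookup a zero ℚ.≤ lookup a (fromℕ m)
  increasing⇒first≤last (a ∷ [])      inc = ℚ.≤-refl
  increasing⇒first≤last (a ∷ a′ ∷ as) inc = ℚ.≤-trans (ℚ.<⇒≤ (inc zero)) (increasing⇒first≤last (a′ ∷ as) (inc ∘ suc))

  -- Each inner breakpoint is a multiple of 1 / N because of the chain required there; the last one
  -- has no chain but is 1, which is `time N`. The previous scaled time p is carried along to make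
  -- the times strictly increasing.
  continuation : ∀ {m} p (a : ℚ) (as : Vec ℚ (suc m)) (τ : Perm n) (τs : Vec (Perm n) m) →
    IsTime a p → 0ℚ ℚ.≤ a → (∀ i → lookup (a ∷ as) (inject₁ i) ℚ.< lookup as i) →
    lookup as (fromℕ m) ≡ 1ℚ → (∀ i → IsMinimalRep lam (lookup τs i)) →
    (∀ i → Chain lam (lookup as (inject₁ i)) (lookup (τ ∷ τs) (inject₁ i)) (lookup τs i)) →
    ∃ λ L → Valid N (suc p) (τ • lam) L × Pointwiseᵛ.Pointwise _≈ₚ_ τs (laterDirections L) ×
      Pointwiseᵛ.Pointwise _≡_ as (laterBreakpoints L)
  continuation p a (a′ ∷ []) τ [] a-time a≥0 inc last minimal chains =
    [] , [] , [] , trans last (sym (time-N)) ∷ []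
  continuation p a (a′ ∷ a″ ∷ as) τ (τ′ ∷ τs) a-time a≥0 inc last minimal chains
    with chain⇒time (ℚ.≤-<-trans a≥0 (inc zero)) lam-div (chains zero)
  ... | j , a′-time with continuation j a′ (a″ ∷ as) τ′ τs a′-time (ℚ.≤-trans a≥0 (ℚ.<⇒≤ (inc zero))) (inc ∘ suc) last
                           (minimal ∘ suc) (chains ∘ suc)
  ...   | L , v , τs≈ , as≡ = (j , τ′ • lam) ∷ L ,
    turn (times-< {a} {a′} a-time a′-time (inc zero)) j<N (chain⇒steps a′-time (chains zero)) v ,
    standard-unique {τ′} (minimal⇒standard {τ′} (minimal zero)) ∷ τs≈ ,
    time-unique {a′} {j} a′-time ∷ as≡
    where
    -- The breakpoint `a′` has a successor, so it lies strictly below the last one.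
    j<N : j ℕ.< N
    j<N = times-< {a′} {1ℚ} a′-time (trans (cong (λ p → p ℚ.* fromℤ (ℤ.+ N)) (sym (time-N))) (time-* N))
      (ℚ.<-≤-trans (inc (suc zero))
        (ℚ.≤-trans (increasing⇒first≤last (a″ ∷ as) (λ i → inc (suc (suc i)))) (ℚ.≤-reflexive last)))

  endpoint-* : ∀ {j κ L} p → p ℕ.≤ j → p ℕ.≤ N → InOrbit lam κ → Valid N j κ L → ∀ c →
    endpoint lam (length L) (time p ∷ laterBreakpoints L) (minimalRep κ ∷ laterDirections L) c ℚ.* fromℤ (ℤ.+ N)
    ≡ fromℤ (ℤ.+ scaledWeightAt N p κ L c)
  endpoint-* {κ = κ} {L} p p≤j p≤N orb v c = go v
    where
    open ≡-Reasoning
    open ℚ-Solver.+-*-Solver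
    distribute : ∀ x y k v → (x ℚ.- y) ℚ.* k ℚ.* v ≡ (x ℚ.* v ℚ.- y ℚ.* v) ℚ.* k
    distribute = solve 4 (λ x y k v → (x :- y) :* k :* v := (x :* v :- y :* v) :* k) refl
    ν = fromℤ (ℤ.+ N)
    direction : fromℕᵛ (minimalRep κ • lam) c ≡ fromℤ (ℤ.+ lookup κ c)
    direction = cong (λ u → fromℤ (ℤ.+ lookup u c)) (minimalRep-• orb)
    segment : ∀ j → p ℕ.≤ j → (time j ℚ.- time p) ℚ.* fromℕᵛ (minimalRep κ • lam) c ℚ.* ν
      ≡ fromℤ (ℤ.+ ((j ℕ.∸ p) ℕ.* lookup κ c))
    segment j p≤j = begin
      (time j ℚ.- time p) ℚ.* fromℕᵛ (minimalRep κ • lam) c ℚ.* ν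
        ≡⟨ cong (λ q → (time j ℚ.- time p) ℚ.* q ℚ.* ν) direction ⟩
      (time j ℚ.- time p) ℚ.* K ℚ.* ν
        ≡⟨ distribute (time j) (time p) K ν ⟩
      (time j ℚ.* ν ℚ.- time p ℚ.* ν) ℚ.* K
        ≡⟨ cong₂ (λ x y → (x ℚ.- y) ℚ.* K) (time-* j) (time-* p) ⟩
      (fromℤ (ℤ.+ j) ℚ.- fromℤ (ℤ.+ p)) ℚ.* K
        ≡⟨ cong (λ q → q ℚ.* K) (fromℤ-- (ℤ.+ j) (ℤ.+ p)) ⟨
      fromℤ (ℤ.+ j ℤ.- ℤ.+ p) ℚ.* K
        ≡⟨ cong (λ z → fromℤ z ℚ.* K) (trans (ℤ.m-n≡m⊖n j p) (ℤ.⊖-≥ p≤j)) ⟩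
      fromℤ (ℤ.+ (j ℕ.∸ p)) ℚ.* K
        ≡⟨ fromℤ-* (ℤ.+ (j ℕ.∸ p)) (ℤ.+ lookup κ c) ⟨
      fromℤ (ℤ.+ (j ℕ.∸ p) ℤ.* ℤ.+ lookup κ c)
        ≡⟨ cong fromℤ (ℤ.pos-* (j ℕ.∸ p) (lookup κ c)) ⟨
      fromℤ (ℤ.+ ((j ℕ.∸ p) ℕ.* lookup κ c)) ∎
      where
      K = fromℤ (ℤ.+ lookup κ c)
    go : ∀ {L} → Valid N _ κ L →
      endpoint lam (length L) (time p ∷ laterBreakpoints L) (minimalRep κ ∷ laterDirections L) c ℚ.* ν
      ≡ fromℤ (ℤ.+ scaledWeightAt N p κ L c)
    go [] = trans (cong (λ q → q ℚ.* ν) (trans (ℚ.+-identityˡ _)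
      (cong (λ q → (q ℚ.- time p) ℚ.* fromℕᵛ (minimalRep κ • lam) c) (sym (time-N))))) (segment N p≤N)
    go (turn {j′} {ν′} {L′} j≤j′ j′<N steps v′) = begin
      endpoint lam (suc (length L′)) (time p ∷ time j′ ∷ laterBreakpoints L′)
          (minimalRep κ ∷ minimalRep ν′ ∷ laterDirections L′) c ℚ.* ν
        ≡⟨ cong (λ q → q ℚ.* ν) (endpoint-∷ lam (length L′) (time p) (time j′) (laterBreakpoints L′)
              (minimalRep κ) (minimalRep ν′ ∷ laterDirections L′) c) ⟩
      (head ℚ.+ rest) ℚ.* ν
        ≡⟨ ℚ.*-distribʳ-+ ν head rest ⟩
      head ℚ.* ν ℚ.+ rest ℚ.* ν
        ≡⟨ cong₂ ℚ._+_ (segment j′ (ℕ.≤-trans p≤j j≤j′))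
            (endpoint-* j′ (ℕ.n≤1+n j′) (ℕ.<⇒≤ j′<N) (steps-orbit steps orb) v′ c) ⟩
      fromℤ (ℤ.+ ((j′ ℕ.∸ p) ℕ.* lookup κ c)) ℚ.+ fromℤ (ℤ.+ scaledWeightAt N j′ ν′ L′ c)
        ≡⟨ fromℤ-+ (ℤ.+ ((j′ ℕ.∸ p) ℕ.* lookup κ c)) (ℤ.+ scaledWeightAt N j′ ν′ L′ c) ⟨
      fromℤ (ℤ.+ ((j′ ℕ.∸ p) ℕ.* lookup κ c) ℤ.+ ℤ.+ scaledWeightAt N j′ ν′ L′ c)
        ≡⟨ cong fromℤ (ℤ.pos-+ ((j′ ℕ.∸ p) ℕ.* lookup κ c) (scaledWeightAt N j′ ν′ L′ c)) ⟨
      fromℤ (ℤ.+ scaledWeightAt N p κ ((j′ , ν′) ∷ L′) c) ∎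
      where
      head = (time j′ ℚ.- time p) ℚ.* fromℕᵛ (minimalRep κ • lam) c
      rest = endpoint lam (length L′) (time j′ ∷ laterBreakpoints L′) (minimalRep ν′ ∷ laterDirections L′) c

  path-weight : .{{_ : ℕ.NonZero N}} → ∀ {κ L} (orb : InOrbit lam κ) (v : Valid N 1 κ L) →
    RationalPath.weight (path orb v) ≗ fromℕᵛ (exponent N κ L)
  path-weight {κ} {L} orb v c = N-cancel (begin
    RationalPath.weight (path orb v) c ℚ.* fromℤ (ℤ.+ N)      ≡⟨ endpoint-* 0 ℕ.z≤n ℕ.z≤n orb v c ⟩
    fromℤ (ℤ.+ scaledWeightAt N 0 κ L c)                       ≡⟨ cong (λ m → fromℤ (ℤ.+ m)) (exponent-* N v c) ⟨
    fromℤ (ℤ.+ (lookup (exponent N κ L) c ℕ.* N))              ≡⟨ cong fromℤ (ℤ.pos-* (lookup (exponent N κ L) c) N) ⟩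
    fromℤ (ℤ.+ lookup (exponent N κ L) c ℤ.* ℤ.+ N)            ≡⟨ fromℤ-* (ℤ.+ lookup (exponent N κ L) c) (ℤ.+ N) ⟩
    fromℕᵛ (exponent N κ L) c ℚ.* fromℤ (ℤ.+ N)                ∎)
    where open ≡-Reasoning

  module _ (k : ℕ) (1+k≡N : 1 ℕ.+ k ≡ N) (τ : Perm n) (τ-minimal : IsMinimalRep lam τ) where

    private
      κ : Vec ℕ n
      κ = τ • lam

      orb : InOrbit lam κ
      orb = τ , refl

      conts : List (Continuation n)
      -- Starting at 1 excludes a turn at time 0, so that the first direction is τ itself;
      -- `genFrom N k 0` is restricted in the same way.
      conts = continuations N k 1 κ

      valid : All (Valid N 1 κ) conts
      valid = All.tabulate (∈-continuations⁻ N k 1 κ 1+k≡N)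

      τ≈minimalRep : τ ≈ₚ minimalRep κ
      τ≈minimalRep = standard-unique {τ} (minimal⇒standard {τ} τ-minimal)

      paths : ∀ {Ls} → All (Valid N 1 κ) Ls → List (RationalPath lam)
      paths []       = []
      paths (v ∷ vs) = path orb v ∷ paths vs

      all-sound : ∀ {Ls} (vs : All (Valid N 1 κ) Ls) → All (Π̂ lam τ) (paths vs)
      all-sound []       = []
      all-sound (v ∷ vs) = (later-chains orb v , ≈ₚ-sym {σ = τ} {minimalRep κ} τ≈minimalRep) ∷ all-sound vs

      all-distinct : ∀ {Ls} → Unique Ls → (vs : All (Valid N 1 κ) Ls) → AllPairs (λ π ρ → ¬ (π ≈π ρ)) (paths vs)
      all-distinct []             []       = []
      all-distinct (L∉ ∷ Ls!) (v ∷ vs) = apart L∉ vs ∷ all-distinct Ls! vs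
        where
        apart : ∀ {Ls} → All (_ ≢_) Ls → (vs : All (Valid N 1 κ) Ls) → All (λ ρ → ¬ (path orb v ≈π ρ)) (paths vs)
        apart []          []        = []
        apart (L≢ ∷ L≢s) (v′ ∷ vs) = (λ π≈ → L≢ (later-injective orb orb v v′
          (Pointwiseᵛ.tail (_≈π_.τ≈ π≈)) (Pointwiseᵛ.tail (_≈π_.a≈ π≈)))) ∷ apart L≢s vs

      -- The path in the list is built from the validity proof stored there, which need not be the
      -- one at hand; hence the hypothesis for every proof.
      find-path : ∀ {Ls} (vs : All (Valid N 1 κ) Ls) {L} → L ∈ Ls → (π : RationalPath lam) →
        (∀ v → π ≈π path {κ} {L} orb v) → Any (π ≈π_) (paths vs)
      find-path (v ∷ vs) (here refl) π π≈ = here (π≈ v)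
      find-path (v ∷ vs) (there L∈)  π π≈ = there (find-path vs L∈ π π≈)

      all-complete : ∀ π → Π̂ lam τ π → Any (π ≈π_) (paths valid)
      all-complete π@record { m = m ; τ = τ₀ ∷ τs ; a = a ∷ as } (chains , τ₀≈τ)
        with continuation 0 a as τ₀ τs
               (trans (cong (λ p → p ℚ.* fromℤ (ℤ.+ N)) (trans (RationalPath.a-first π) (sym (time-0)))) (time-* 0))
               (ℚ.≤-reflexive (sym (RationalPath.a-first π))) (RationalPath.increasing π) (RationalPath.a-last π)
               (RationalPath.minimal π ∘ suc) chains
      ... | L , v , τs≈ , as≡ = find-path valid
        (∈-continuations⁺ N k 1 κ 1+k≡N (subst (λ u → Valid N 1 u L) (•-cong {σ = τ₀} {τ} τ₀≈τ lam) v)) π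
        λ v′ → record
          { τ≈ = ≈ₚ-trans {σ = τ₀} {τ} {minimalRep κ} τ₀≈τ τ≈minimalRep ∷ τs≈
          ; a≈ = trans (RationalPath.a-first π) (sym (time-0)) ∷ as≡
          }

    lsPaths : List (RationalPath lam)
    lsPaths = paths valid

    lsPaths-enumerates : Enumerates (Π̂ lam τ) lsPaths
    lsPaths-enumerates = record
      { sound    = all-sound valid
      ; distinct = all-distinct (continuations-unique N k 1 κ 1+k≡N) valid
      ; complete = all-complete
      }

    lsPaths-weights : .{{_ : ℕ.NonZero N}} → Pointwise (λ π α → RationalPath.weight π ≗ fromℕᵛ α)
      lsPaths (List.map (exponent N κ) (continuations N k 1 κ))
    lsPaths-weights = go valid
      where
      go : ∀ {Ls} (vs : All (Valid N 1 κ) Ls) → Pointwise (λ π α → RationalPath.weight π ≗ fromℕᵛ α)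
        (paths vs) (List.map (exponent N κ) Ls)
      go []       = []
      go (v ∷ vs) = path-weight orb v ∷ go vs

-- Polynomials by their coefficient functions

coeffs : Poly n → Coeffs n
coeffs f γ = total (λ (c , α) → c ℤ.* monomial α γ) f

coeff-embed : (f : Poly n) (γ : Exponent n) → coeff f γ ≡ coeffs f (embed γ)
coeff-embed []            γ = refl
coeff-embed ((c , α) ∷ f) γ = cong₂ ℤ._+_ (trans (scale (does (α ≟ᵉ γ)))
  (cong (λ b → c ℤ.* (if b then 1ℤ else 0ℤ)) (does-⇔ (mk⇔ (cong embed) embed-injective) (α ≟ᵉ γ) (embed α ≟ᶻ embed γ))))
  (coeff-embed f γ)
  where
  scale : ∀ b → (if b then c else 0ℤ) ≡ c ℤ.* (if b then 1ℤ else 0ℤ)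
  scale true  = sym (ℤ.*-identityʳ c)
  scale false = sym (ℤ.*-zeroʳ c)
  embed-injective : embed α ≡ embed γ → α ≡ γ
  embed-injective eq = lookup-ext λ k → ℤ.+-injective (trans (sym (lookup-map k (ℤ.+_) α))
    (trans (cong (λ v → lookup v k) eq) (lookup-map k (ℤ.+_) γ)))

coeffs-vanishes : (f : Poly n) → Vanishes (coeffs f)
coeffs-vanishes []            γ c γ<0 = refl
coeffs-vanishes ((d , α) ∷ f) γ c γ<0 = cong₂ ℤ._+_
  (trans (cong (λ z → d ℤ.* z) (monomial-vanishes α γ c γ<0)) (ℤ.*-zeroʳ d)) (coeffs-vanishes f γ c γ<0)

-- Equality of polynomials tests natural exponents only; at all other integer exponents both sides
-- vanish.
≈⇒coeffs : (f g : Poly n) → f ≈ g → coeffs f ≗ coeffs g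
≈⇒coeffs {n} f g f≈g γ with Fin.all? (λ c → 0ℤ ℤ.≤? lookup γ c)
... | yes γ≥0 = subst (λ δ → coeffs f δ ≡ coeffs g δ) embed-abs
  (trans (sym (coeff-embed f ∣γ∣)) (trans (f≈g ∣γ∣) (coeff-embed g ∣γ∣)))
  where
  ∣γ∣ : Exponent n
  ∣γ∣ = Vec.map ℤ.∣_∣ γ
  embed-abs : embed ∣γ∣ ≡ γ
  embed-abs = lookup-ext λ c → trans (lookup-map c (ℤ.+_) ∣γ∣)
    (trans (cong (ℤ.+_) (lookup-map c ℤ.∣_∣ γ)) (ℤ.0≤i⇒+∣i∣≡i (γ≥0 c)))
... | no γ≱0 with Fin.¬∀⟶∃¬ n _ (λ c → 0ℤ ℤ.≤? lookup γ c) γ≱0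
...   | c , γc≱0 = trans (coeffs-vanishes f γ c (ℤ.≰⇒> γc≱0)) (sym (coeffs-vanishes g γ c (ℤ.≰⇒> γc≱0)))

coeffs⇒≈ : (f g : Poly n) → coeffs f ≗ coeffs g → f ≈ g
coeffs⇒≈ f g f≗g γ = trans (coeff-embed f γ) (trans (f≗g (embed γ)) (sym (coeff-embed g γ)))

coeffs-neg : (f : Poly n) → coeffs (neg f) ≗ λ γ → ℤ.- coeffs f γ
coeffs-neg []            γ = refl
coeffs-neg ((c , α) ∷ f) γ = trans
  (cong₂ ℤ._+_ (sym (ℤ.neg-distribˡ-* c (monomial α γ))) (coeffs-neg f γ))
  (sym (ℤ.neg-distrib-+ (c ℤ.* monomial α γ) (coeffs f γ)))

coeffs-++ : (f g : Poly n) → coeffs (f ++ g) ≗ λ γ → coeffs f γ ℤ.+ coeffs g γ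
coeffs-++ f g γ = total-++ (λ (c , α) → c ℤ.* monomial α γ) f g

coeffs-- : (f g : Poly n) → coeffs (f - g) ≗ λ γ → coeffs f γ ℤ.- coeffs g γ
coeffs-- f g γ = trans (coeffs-++ f (neg g) γ) (cong (λ z → coeffs f γ ℤ.+ z) (coeffs-neg g γ))

coeffs-mulTerm : (c : ℤ) (β : Exponent n) (f : Poly n) →
  coeffs (map (mulTerm (c , β)) f) ≗ λ γ → c ℤ.* coeffs f (γ ⊟ β)
coeffs-mulTerm c β []            γ = sym (ℤ.*-zeroʳ c)
coeffs-mulTerm c β ((d , α) ∷ f) γ = trans
  (cong₂ (λ p q → c ℤ.* d ℤ.* p ℤ.+ q)
    (sym (monomial-⊟ β α γ (β ⊕ α) (Quotient.lookup-⊕ β α)))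
    (coeffs-mulTerm c β f γ))
  (distribute c d (monomial α (γ ⊟ β)) (coeffs f (γ ⊟ β)))
  where
  distribute : ∀ c d m f → c ℤ.* d ℤ.* m ℤ.+ c ℤ.* f ≡ c ℤ.* (d ℤ.* m ℤ.+ f)
  distribute = ℤ-Solver.solve-∀

coeffs-x* : (k : Fin n) (f : Poly n) → coeffs (x k * f) ≗ λ γ → coeffs f (γ ⊟ spike k 1)
coeffs-x* k f γ = trans (coeffs-++ (map (mulTerm (1ℤ , spike k 1)) f) [] γ) (trans (ℤ.+-identityʳ _)
  (trans (coeffs-mulTerm 1ℤ (spike k 1) f γ) (ℤ.*-identityˡ _)))

coeffs-x-x* : (k l : Fin n) (f : Poly n) →
  coeffs ((x k - x l) * f) ≗ λ γ → coeffs f (γ ⊟ spike k 1) ℤ.- coeffs f (γ ⊟ spike l 1)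
coeffs-x-x* k l f γ = trans (coeffs-++ (map (mulTerm (1ℤ , spike k 1)) f) (map (mulTerm (ℤ.- 1ℤ , spike l 1)) f ++ []) γ)
  (cong₂ ℤ._+_
    (trans (coeffs-mulTerm 1ℤ (spike k 1) f γ) (ℤ.*-identityˡ _))
    (trans (coeffs-++ (map (mulTerm (ℤ.- 1ℤ , spike l 1)) f) [] γ) (trans (ℤ.+-identityʳ _)
      (trans (coeffs-mulTerm (ℤ.- 1ℤ) (spike l 1) f γ) (ℤ.-1*i≡-i (coeffs f (γ ⊟ spike l 1)))))))

coeffs-permute : (i : Fin (pred n)) (f : Poly n) → coeffs (permute (s i) f) ≗ λ γ → coeffs f (s i • γ)
coeffs-permute i []            γ = refl
coeffs-permute i ((c , α) ∷ f) γ = cong₂ (λ p q → c ℤ.* p ℤ.+ q)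
  (trans (cong (monomial (s i • α)) (sym (s-involutive i γ))) (monomial-s i α (s i • γ)))
  (coeffs-permute i f γ)

s-spike : (i : Fin (pred n)) → s i • spike {n} (hi i) 1 ≡ spike (lo i) 1
s-spike {n} i = lookup-ext λ c → go c (c Fin.≟ lo i) (c Fin.≟ hi i)
  where
  go : ∀ c → Dec (c ≡ lo i) → Dec (c ≡ hi i) → lookup (s i • spike {n} (hi i) 1) c ≡ lookup (spike {n} (lo i) 1) c
  go c (yes refl) _ = trans (lookup-s-lo i (spike {n} (hi i) 1))
    (trans (Quotient.lookup-spike-same (hi {n} i) 1) (sym (Quotient.lookup-spike-same (lo {n} i) 1)))
  go c (no c≢lo) (yes refl) = trans (lookup-s-hi i (spike {n} (hi i) 1))
    (trans (Quotient.lookup-spike-other (hi {n} i) (lo i) 1 (Quotient.lo≢hi {n} i))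
      (sym (Quotient.lookup-spike-other (lo {n} i) (hi i) 1 c≢lo)))
  go c (no c≢lo) (no c≢hi) = trans (lookup-transpose-other (lo i) (hi i) (spike {n} (hi i) 1) c c≢lo c≢hi)
    (trans (Quotient.lookup-spike-other (hi i) c 1 c≢hi) (sym (Quotient.lookup-spike-other (lo i) c 1 c≢lo)))

-- This is ∂-quotient, read off at the exponent γ + e_{i+1}.
coeffs-demazure : (i : Fin (pred n)) (f : Poly n) → Demazure 1 i 0ℤ (coeffs f) (coeffs (demazure i f))
coeffs-demazure {n} i f γ = begin
  coeffs q (shift i (ℤ.- 1ℤ) γ) ℤ.- coeffs q γ
    ≡⟨ cong₂ (λ δ δ′ → coeffs q δ ℤ.- coeffs q δ′) γ⁺-lo γ⁺-hi ⟨
  coeffs q (γ⁺ ⊟ spike (lo i) 1) ℤ.- coeffs q (γ⁺ ⊟ spike (hi i) 1)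
    ≡⟨ coeffs-x-x* (lo i) (hi i) q γ⁺ ⟨
  coeffs ((x (lo i) - x (hi i)) * q) γ⁺
    ≡⟨ ≈⇒coeffs ((x (lo i) - x (hi i)) * q) (g - permute (s i) g) (∂-quotient i g) γ⁺ ⟩
  coeffs (g - permute (s i) g) γ⁺
    ≡⟨ coeffs-- g (permute (s i) g) γ⁺ ⟩
  coeffs g γ⁺ ℤ.- coeffs (permute (s i) g) γ⁺
    ≡⟨ cong₂ ℤ._-_ (coeffs-x* (lo i) f γ⁺) (trans (coeffs-permute i g γ⁺) (coeffs-x* (lo i) f (s i • γ⁺))) ⟩
  coeffs f (γ⁺ ⊟ spike (lo i) 1) ℤ.- coeffs f ((s i • γ⁺) ⊟ spike (lo i) 1)
    ≡⟨ cong₂ (λ δ δ′ → coeffs f δ ℤ.- coeffs f δ′) γ⁺-lo sγ⁺-lo ⟩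
  coeffs f (shift i (0ℤ ℤ.- 1ℤ) γ) ℤ.- coeffs f (s i • γ) ∎
  where
  open ≡-Reasoning
  g = x (lo i) * f
  q = demazure i f
  γ⁺ : Vec ℤ n
  γ⁺ = tabulate λ c → lookup γ c ℤ.+ ℤ.+ lookup (spike (hi i) 1) c
  cancel : ∀ a b → (a ℤ.+ b) ℤ.- b ≡ a
  cancel = ℤ-Solver.solve-∀
  γ⁺-hi : γ⁺ ⊟ spike (hi i) 1 ≡ γ
  γ⁺-hi = lookup-ext λ c → trans (lookup-⊟ γ⁺ (spike (hi i) 1) c) (trans
    (cong (λ z → z ℤ.- ℤ.+ lookup (spike (hi i) 1) c) (lookup∘tabulate _ c))
    (cancel (lookup γ c) (ℤ.+ lookup (spike (hi i) 1) c)))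
  γ⁺-lo : γ⁺ ⊟ spike (lo i) 1 ≡ shift i (ℤ.- 1ℤ) γ
  γ⁺-lo = trans (cong (γ⁺ ⊟_) (sym (s-spike i))) (trans (⊟-s i γ⁺ (spike (hi i) 1))
    (cong₂ (shift i) (cong₂ (λ p q → ℤ.+ p ℤ.- ℤ.+ q)
      (Quotient.lookup-spike-other (hi {n} i) (lo i) 1 (Quotient.lo≢hi {n} i))
      (Quotient.lookup-spike-same (hi {n} i) 1)) γ⁺-hi))
  sγ⁺-lo : (s i • γ⁺) ⊟ spike (lo i) 1 ≡ s i • γ
  sγ⁺-lo = trans (cong ((s i • γ⁺) ⊟_) (sym (s-spike i)))
    (trans (sym (s-⊟ i γ⁺ (spike (hi i) 1))) (cong (s i •_) γ⁺-hi))

coeffs-demazureAtomOp : (i : Fin (pred n)) (f : Poly n) → Demazure 1 i 1ℤ (coeffs f) (coeffs (demazureAtomOp i f))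
coeffs-demazureAtomOp i f = demazure-cong 1 i {1ℤ} {coeffs f} {g = λ γ → coeffs (demazure i f) γ ℤ.- coeffs f γ}
  (λ _ → refl) (λ γ → sym (coeffs-- (demazure i f) f γ))
  (demazure-0⇒N 1 i {coeffs f} {coeffs (demazure i f)} (coeffs-demazure i f))

coeffs-sumPoly : (αs : List (Exponent n)) → coeffs (sumPoly (map x^_ αs)) ≗ λ γ → total (λ α → monomial α γ) αs
coeffs-sumPoly []       γ = refl
coeffs-sumPoly (α ∷ αs) γ = cong₂ ℤ._+_ (ℤ.*-identityˡ (monomial α γ)) (coeffs-sumPoly αs γ)

-- x_c ↦ x_c^N on exponents
dilate : ℕ → Vec ℤ n → Vec ℤ n
dilate N = Vec.map (λ z → ℤ.+ N ℤ.* z)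

lookup-dilate : (N : ℕ) (γ : Vec ℤ n) (c : Fin n) → lookup (dilate N γ) c ≡ ℤ.+ N ℤ.* lookup γ c
lookup-dilate N γ c = lookup-map c _ γ

s-dilate : (N : ℕ) (i : Fin (pred n)) (γ : Vec ℤ n) → s i • dilate N γ ≡ dilate N (s i • γ)
s-dilate N i γ = lookup-ext λ c → trans (lookup-• (s i) (dilate N γ) c) (trans (lookup-dilate N γ _)
  (sym (trans (lookup-dilate N (s i • γ) c) (cong (λ z → ℤ.+ N ℤ.* z) (lookup-• (s i) γ c)))))

shift-dilate : (N : ℕ) (i : Fin (pred n)) (k : ℤ) (γ : Vec ℤ n) →
  shift i (ℤ.+ N ℤ.* k) (dilate N γ) ≡ dilate N (shift i k γ)
shift-dilate N i k γ = lookup-ext λ c → trans (lookup-shift i (ℤ.+ N ℤ.* k) (dilate N γ) c) (trans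
  (cong (λ z → z ℤ.+ ℤ.+ N ℤ.* k ℤ.* simpleRoot i c) (lookup-dilate N γ c)) (trans
  (factor (ℤ.+ N) (lookup γ c) k (simpleRoot i c)) (sym (trans (lookup-dilate N (shift i k γ) c)
  (cong (λ z → ℤ.+ N ℤ.* z) (lookup-shift i k γ c))))))
  where
  factor : ∀ N g k a → N ℤ.* g ℤ.+ N ℤ.* k ℤ.* a ≡ N ℤ.* (g ℤ.+ k ℤ.* a)
  factor = ℤ-Solver.solve-∀

-- At a dilated exponent the relation involves dilated exponents only: the shifts are by - N α_i and
-- by N - N = 0, and s_i commutes with dilation.
demazure-dilate : (N : ℕ) (i : Fin (pred n)) {f g : Coeffs n} → Demazure N i (ℤ.+ N) f g →
  Demazure 1 i 1ℤ (f ∘ dilate N) (g ∘ dilate N)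
demazure-dilate N i {f} {g} rel γ = trans
  (cong (λ δ → g δ ℤ.- g (dilate N γ))
    (trans (sym (shift-dilate N i (ℤ.- 1ℤ) γ)) (cong (λ k → shift i k (dilate N γ)) (neg-1 (ℤ.+ N)))))
  (trans (rel (dilate N γ)) (cong₂ (λ δ δ′ → f δ ℤ.- f δ′)
    (trans (cong (λ k → shift i k (dilate N γ)) (zero-N (ℤ.+ N))) (shift-dilate N i (1ℤ ℤ.- 1ℤ) γ))
    (s-dilate N i γ)))
  where
  neg-1 : ∀ N → N ℤ.* (ℤ.- 1ℤ) ≡ ℤ.- N
  neg-1 = ℤ-Solver.solve-∀
  zero-N : ∀ N → N ℤ.- N ≡ N ℤ.* (1ℤ ℤ.- 1ℤ)
  zero-N = ℤ-Solver.solve-∀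

dilate-vanishes : (N : ℕ) → 0 ℕ.< N → {f : Coeffs n} → Vanishes f → Vanishes (f ∘ dilate N)
dilate-vanishes N N>0 f-vanishes γ c γ<0 = f-vanishes (dilate N γ) c (subst (ℤ._< 0ℤ) (sym (lookup-dilate N γ c))
  (subst (ℤ.+ N ℤ.* lookup γ c ℤ.<_) (ℤ.*-zeroʳ (ℤ.+ N)) (ℤ.*-monoˡ-<-pos (ℤ.+ N) {{ℤ.positive (ℤ.+<+ N>0)}} γ<0)))

monomial-dilate : (N : ℕ) .{{_ : ℕ.NonZero N}} (α β : Exponent n) → (∀ c → lookup α c ℕ.* N ≡ lookup β c) → ∀ γ →
  monomial β (dilate N γ) ≡ monomial α γ
monomial-dilate N α β α*N≡β γ = cong (λ b → if b then 1ℤ else 0ℤ) (does-⇔ (mk⇔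
  (λ eq → lookup-ext λ c → ℤ.*-cancelˡ-≡ (ℤ.+ N) _ _ (trans (sym (embed-β c))
    (trans (cong (λ v → lookup v c) eq) (lookup-dilate N γ c))))
  (λ { refl → lookup-ext λ c → trans (embed-β c) (sym (lookup-dilate N (embed α) c)) }))
  (embed β ≟ᶻ dilate N γ) (embed α ≟ᶻ γ))
  where
  embed-β : ∀ c → lookup (embed β) c ≡ ℤ.+ N ℤ.* lookup (embed α) c
  embed-β c = trans (lookup-map c (ℤ.+_) β) (trans (cong (ℤ.+_) (trans (sym (α*N≡β c)) (ℕ.*-comm (lookup α c) N)))
    (trans (ℤ.pos-* N (lookup α c)) (cong (λ z → ℤ.+ N ℤ.* z) (sym (lookup-map c (ℤ.+_) α)))))

lookup≤sum : (v : Vec ℕ n) (k : Fin n) → lookup v k ℕ.≤ Vec.sum v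
lookup≤sum (a ∷ v) zero    = ℕ.m≤m+n a (Vec.sum v)
lookup≤sum (a ∷ v) (suc k) = ℕ.≤-trans (lookup≤sum v k) (ℕ.m≤n+m (Vec.sum v) a)

-- Hence (Σ_k v_k)! is a common denominator of the breakpoints.
diffsDivide-! : (v : Vec ℕ n) → DiffsDivide (Vec.sum v !) v
diffsDivide-! v k l lt = ∣! (ℕ.m<n⇒0<n∸m lt) (ℕ.≤-trans (ℕ.m∸n≤m (lookup v l) (lookup v k)) (lookup≤sum v l))
  where
  ∣! : ∀ {d m} → 0 ℕ.< d → d ℕ.≤ m → d ℕ.∣ m !
  ∣! {suc d} _ d≤m = ℕ.∣-trans (ℕ.m∣m*n (d !)) (ℕ.m≤n⇒m!∣n! d≤m)

-- Comparison of Demazure atoms with path generating functions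

module _ (lam : Vec ℕ n) (lam-partition : IsPartition lam) (k : ℕ) (lam-div : DiffsDivide (suc k) lam) where

  open MinimalReps lam lam-partition

  private
    N : ℕ
    N = suc k

    N>0 : 0 ℕ.< N
    N>0 = ℕ.s≤s ℕ.z≤n

  exponents : Vec ℕ n → List (Exponent n)
  exponents κ = map (exponent N κ) (continuations N k 1 κ)

  exponents-total : (κ : Vec ℕ n) → ∀ γ → genFrom N k 0 κ (dilate N γ) ≡ total (λ α → monomial α γ) (exponents κ)
  exponents-total κ γ = trans (genFrom-total N k 0 refl (gen-total N k 1 refl) κ (dilate N γ)) (trans
    (total-cong (continuations N k 1 κ) λ {L} L∈ → monomial-dilate N (exponent N κ L) (scaledWeight N 0 κ L)
      (λ c → trans (exponent-* N (∈-continuations⁻ N k 1 κ refl L∈) c) (sym (lookup∘tabulate (scaledWeightAt N 0 κ L) c))) γ)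
    (sym (total-map (λ α → monomial α γ) (exponent N κ) (continuations N k 1 κ))))

  ascents-lam : ascents lam ≡ 0
  ascents-lam with find-ascent lam
  ... | inj₂ eq       = eq
  ... | inj₁ (i , lt) = contradiction (lam-partition (lo i) (hi i) (ℕ.<⇒≤ (lo<hi {n} i))) (ℕ.<⇒≱ lt)

  continuations-lam : ∀ m j → continuations N m j lam ≡ [] ∷ []
  continuations-lam zero    j = refl
  -- As `lam` has no ascents, the fuel of `reachable` is zero, so `below` is empty and no turn can
  -- occur.
  continuations-lam (suc m) j rewrite ascents-lam | continuations-lam m (suc j) = refl

  -- Induction on the word. Both sides arise from the function of the shorter word by the relation
  -- with N = 1 and twist 1, and both vanish at negative exponents, so `demazure-unique` identifies
  -- them. For the empty word the straight path is the only one.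
  coeffs-atom : ∀ (w : Word n) (τ : Perm n) → Standard lam τ → IsReducedWord τ w →
    coeffs (demazureAtomOpWord w (x^ lam)) ≗ λ γ → genFrom N k 0 (τ • lam) (dilate N γ)
  coeffs-atom [] τ τ-std (id≈τ , _) γ = sym (trans (exponents-total (τ • lam) γ) (trans
    (cong (λ κ → total (λ α → monomial α γ) (exponents κ)) τ•lam≡lam) (trans
    (cong (λ Ls → total (λ α → monomial α γ) (map (exponent N lam) Ls)) (continuations-lam k 1))
    (cong (λ z → z ℤ.+ 0ℤ) (trans (cong (λ α → monomial α γ) constant) (sym (ℤ.*-identityˡ (monomial lam γ))))))))
    where
    τ•lam≡lam : τ • lam ≡ lam
    τ•lam≡lam = trans (•-cong {σ = τ} {id} (≈ₚ-sym {σ = id} {τ} id≈τ) lam) (id-• lam)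
    constant : exponent N lam [] ≡ lam
    constant = lookup-ext λ c → ℕ.*-cancelʳ-≡ _ _ N (trans (exponent-* N {κ = lam} {[]} [] c) (ℕ.*-comm N (lookup lam c)))
  coeffs-atom (i ∷ w) τ τ-std reduced@(iw≈τ , minimal) = demazure-unique 1 i (ℕ.s≤s ℕ.z≤n) {1ℤ} {coeffs f}
    (coeffs-vanishes (demazureAtomOp i f))
    (dilate-vanishes N N>0 (genFrom-vanishes N k 0 (τ • lam)))
    (coeffs-demazureAtomOp i f)
    (demazure-cong 1 i {1ℤ} {genFrom N k 0 κ ∘ dilate N} {g = genFrom N k 0 (τ • lam) ∘ dilate N}
      (λ γ → sym (coeffs-atom w τ′ (proj₁ τ′-std) (w≈τ′ , minimal′) γ)) (λ _ → refl)
      (demazure-dilate N i {genFrom N k 0 κ} {genFrom N k 0 (τ • lam)}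
        (subst (λ u → Demazure N i (ℤ.+ N) (genFrom N k 0 κ) (genFrom N k 0 u)) sκ≡
          (genFrom-demazure i N>0 k refl κ (diffsDivide-• τ′ {lam} lam-div) κ>0))))
    where
    f = demazureAtomOpWord w (x^ lam)
    τ′ = s i · τ
    κ = τ′ • lam
    κ≡ : κ ≡ s i • (τ • lam)
    κ≡ = ·-• (s i) τ lam
    sκ≡ : s i • κ ≡ τ • lam
    sκ≡ = trans (cong (s i •_) κ≡) (s-involutive i (τ • lam))
    w≈τ′ : product w ≈ₚ τ′
    w≈τ′ = ≈ₚ-trans {σ = product w} {s i · (s i · product w)} {τ′}
      (≈ₚ-sym {σ = s i · (s i · product w)} {product w} (s·s· i (product w)))
      (·-congˡ (s i) {s i · product w} {τ} iw≈τ)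
    minimal′ : ∀ v → product v ≈ₚ τ′ → length w ℕ.≤ length v
    minimal′ v v≈ = ℕ.s≤s⁻¹ (minimal (i ∷ v) (≈ₚ-trans {σ = s i · product v} {s i · τ′} {τ}
      (·-congˡ (s i) {product v} {τ′} v≈) (s·s· i τ)))
    -- Otherwise `s i · τ`, which has the word w, would be at least as long as τ, whose length is
    -- that of the reduced word `i ∷ w`.
    ascends : lookup (τ • staircase n) (lo i) ℕ.< lookup (τ • staircase n) (hi i)
    ascends = ℕ.≰⇒> λ ge → ℕ.<-irrefl refl (begin-strict
      length w                              <⟨ ℕ.n<1+n (length w) ⟩
      length (i ∷ w)                        ≡⟨ length-reduced {σ = τ} {i ∷ w} reduced ⟩
      len τ                                 ≤⟨ ascents-s≥ i (τ • staircase n) ge ⟩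
      ascents (s i • (τ • staircase n))     ≡⟨ len-· (s i) τ ⟨
      len τ′                                ≤⟨ len-≤ {σ = τ′} w w≈τ′ ⟩
      length w                              ∎)
      where open ℕ.≤-Reasoning
    τ′-std = standard-s i {τ} τ-std ascends
    κ>0 : Pos i κ
    κ>0 = subst (Pos i) (sym κ≡) (Neg⇒Pos-s i (τ • lam) (proj₂ τ′-std))

  atom-lsPaths : ∀ (τ : Perm n) → IsMinimalRep lam τ → ∀ (w : Word n) → IsReducedWord τ w →
    Σ[ πs ∈ List (RationalPath lam) ] Enumerates (Π̂ lam τ) πs ×
    (Σ[ αs ∈ List (Exponent n) ]
      Pointwise (λ π α → RationalPath.weight π ≗ fromℕᵛ α) πs αs ×
      demazureAtomOpWord w (x^ lam) ≈ sumPoly (map x^_ αs))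
  atom-lsPaths τ τ-minimal w reduced =
    lsPaths N N>0 lam lam-partition lam-div k refl τ τ-minimal ,
    lsPaths-enumerates N N>0 lam lam-partition lam-div k refl τ τ-minimal ,
    exponents (τ • lam) ,
    lsPaths-weights N N>0 lam lam-partition lam-div k refl τ τ-minimal ,
    coeffs⇒≈ (demazureAtomOpWord w (x^ lam)) (sumPoly (map x^_ (exponents (τ • lam)))) λ γ → trans
      (coeffs-atom w τ (minimal⇒standard {τ} τ-minimal) reduced γ) (trans
      (exponents-total (τ • lam) γ) (sym (coeffs-sumPoly (exponents (τ • lam)) γ)))

proposition3p4p3 : ∀ {n : ℕ} (lam : Vec ℕ n) → IsPartition lam →
    ∀ (τ : Perm n) → IsMinimalRep lam τ →
    ∀ (w : Word n) → IsReducedWord τ w →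
    Σ[ πs ∈ List (RationalPath lam) ] Enumerates (Π̂ lam τ) πs ×
    (Σ[ αs ∈ List (Exponent n) ]
    Pointwise (λ π α → RationalPath.weight π ≗ fromℕᵛ α) πs αs ×
    demazureAtomOpWord w (x^ lam) ≈ sumPoly (map x^_ αs))
-- The construction takes N in the form suc k; factorials being positive, N is the factorial itself.
proposition3p4p3 lam lam-partition = atom-lsPaths lam lam-partition (pred (Vec.sum lam !))
  (subst (λ N → DiffsDivide N lam) (sym (ℕ.suc-pred (Vec.sum lam !) {{Vec.sum lam ℕ.!≢0}})) (diffsDivide-! lam))
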